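{- (i) For every real number $\beta>1$ there is a number $\theta_\beta$ with irrationality base $\beta(\theta_\beta)=\beta$ which is approximable to order $\beta^{ -x}$. In fact, any continued fraction $\theta_\beta=[0;b_1,b_2,\ldots]$, with $n$-th convergent $p_n/q_n$, which satisfies $$b_{n+1}\,\omega(q_n)\,q_n^2>1\quad(n\ge0),\qquad \lim_{n\to\infty}b_{n+1}\,\omega(q_n)\,q_n^2=1$$ with $\omega(x)=\beta^{ -x}$ has these properties. (ii) For every real number $\mu>2$ there is a number $\theta$ with irrationality exponent $\mu(\theta)=\mu$ which is approximable to order $x^{ -\mu}$. In fact, any continued fraction $\theta=[0;b_1,b_2,\ldots]$, with $n$-th convergent $p_n/q_n$, which satisfies $$b_{n+1}\,\omega(q_n)\,q_n^2>1\quad(n\ge0),\qquad \lim_{n\to\infty}b_{n+1}\,\omega(q_n)\,q_n^2=1$$ with $\omega(x)=x^{ -\mu}$ has these properties.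
   Context: Irrationality exponent: for a real irrational number $\alpha$, $\mu(\alpha)$ is the least real $\mu>0$ such that for every $\varepsilon>0$ there is a positive integer $q(\varepsilon)$ with $\left|\alpha-\frac pq\right|>q^{ -(\mu+\varepsilon)}$ for all integers $p,q$ with $q\ge q(\varepsilon)$; if no such $\mu$ exists, $\mu(\alpha)=\infty$. Irrationality base: $\beta(\alpha)$ is the least real $\beta\ge 1$ such that for every $\varepsilon>0$ there is a positive integer $q(\varepsilon)$ with $\left|\alpha-\frac pq\right|>\frac{1}{(\beta+\varepsilon)^q}$ for all integers $p,q$ with $q\ge q(\varepsilon)$; if no such $\beta$ exists, $\beta(\alpha)=\infty$. Given a real number $\theta$ and a positive real-valued function $\omega(x)$ defined for $x\ge1$, $\theta$ is approximable to order $\omega$ if for every $C>0$ there exists a pair of integers $p,q$, with $q>C$, such that $\left|\theta-\frac pq\right|<\omega(q)$. Conventions: continued fractions $[0;b_1,b_2,\ldots]=\cfrac{1}{b_1+\cfrac{1}{b_2+\cdots}}$ are simple and infinite, with positive integer partial quotients $b_1,b_2,\ldots$; the $n$-th convergent $p_n/q_n=[0;b_1,\ldots,b_n]$ is in lowest terms with $q_n>0$ (so $q_0=1$, $q_1=b_1$, $q_{n+1}=b_{n+1}q_n+q_{n-1}$). -}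

module Defs where

open import Algebra.Bundles using (CommutativeRing)
open import Data.Empty using (⊥; ⊥-elim)
open import Data.Integer as ℤ using (ℤ; +_)
import Data.Integer.Properties as ℤ
open import Data.Nat as ℕ using (ℕ; zero; suc; NonZero)
import Data.Nat.Properties as ℕ
open import Data.Product using (Σ; ∃; Σ-syntax; ∃-syntax; _×_; _,_; proj₁; proj₂)
open import Data.Rational as ℚ using (ℚ; 0ℚ; 1ℚ; ½; Positive; NonNegative; ↧ₙ_)
import Data.Rational.Properties as ℚ
open import Data.Rational.Solver using (module +-*-Solver)
open import Data.Rational.Unnormalised as ℚᵘ using (mkℚᵘ)
import Data.Rational.Unnormalised.Properties as ℚᵘ
open import Data.Sum as Sum using (_⊎_; inj₁; inj₂)
open import Function using (_∘_; case_of_)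
open import Relation.Binary.Definitions using (tri<; tri≈; tri>)
open import Relation.Binary.PropositionalEquality
  using (_≡_; refl; sym; trans; cong; cong₂; subst; subst₂; module ≡-Reasoning)
open import Relation.Nullary using (¬_; yes; no)

open import Algebra.Definitions.RawSemiring ℚ.+-*-rawSemiring public
  using () renaming (_^_ to _^ℚ_)

import Algebra.Solver.Ring.NaturalCoefficients.Default
  (CommutativeRing.commutativeSemiring ℚ.+-*-commutativeRing) as ℕCoefficients

fromℕ : ℕ → ℚ
fromℕ n = + n ℚ./ 1

module RationalLemmas where
  0<1 : 0ℚ ℚ.< 1ℚ
  0<1 = ℚ.positive⁻¹ 1ℚ

  0<½ : 0ℚ ℚ.< ½
  0<½ = ℚ.positive⁻¹ ½

  ½<1 : ½ ℚ.< 1ℚ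
  ½<1 = ℚ.*<* (ℤ.+<+ (ℕ.s≤s (ℕ.s≤s ℕ.z≤n)))

  +-pos : ∀ {p q} → 0ℚ ℚ.< p → 0ℚ ℚ.< q → 0ℚ ℚ.< p ℚ.+ q
  +-pos 0<p 0<q = ℚ.+-mono-< 0<p 0<q

  *-pos : ∀ {p q} → 0ℚ ℚ.< p → 0ℚ ℚ.< q → 0ℚ ℚ.< p ℚ.* q
  *-pos {p} {q} 0<p 0<q =
    ℚ.positive⁻¹ _ {{ℚ.pos*pos⇒pos p {{ℚ.positive 0<p}} q {{ℚ.positive 0<q}}}}

  *-nonNeg : ∀ {p q} → 0ℚ ℚ.≤ p → 0ℚ ℚ.≤ q → 0ℚ ℚ.≤ p ℚ.* q
  *-nonNeg {p} {q} 0≤p 0≤q =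
    ℚ.nonNegative⁻¹ _ {{ℚ.nonNeg*nonNeg⇒nonNeg p {{ℚ.nonNegative 0≤p}} q {{ℚ.nonNegative 0≤q}}}}

  +-nonNeg : ∀ {p q} → 0ℚ ℚ.≤ p → 0ℚ ℚ.≤ q → 0ℚ ℚ.≤ p ℚ.+ q
  +-nonNeg 0≤p 0≤q = ℚ.+-mono-≤ 0≤p 0≤q

  *-mono-≤ : ∀ {p q r s} → 0ℚ ℚ.≤ r → 0ℚ ℚ.≤ q → p ℚ.≤ q → r ℚ.≤ s → p ℚ.* r ℚ.≤ q ℚ.* s
  *-mono-≤ {p} {q} {r} {s} 0≤r 0≤q p≤q r≤s = ℚ.≤-trans
    (ℚ.*-monoʳ-≤-nonNeg r {{ℚ.nonNegative 0≤r}} p≤q)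
    (ℚ.*-monoˡ-≤-nonNeg q {{ℚ.nonNegative 0≤q}} r≤s)

  *-monoˡ-< : ∀ {p q r} → 0ℚ ℚ.< r → p ℚ.< q → p ℚ.* r ℚ.< q ℚ.* r
  *-monoˡ-< {r = r} 0<r = ℚ.*-monoˡ-<-pos r {{ℚ.positive 0<r}}

  *-cancelʳ-< : ∀ {p q r} → 0ℚ ℚ.< r → p ℚ.* r ℚ.< q ℚ.* r → p ℚ.< q
  *-cancelʳ-< {r = r} 0<r =
    ℚ.*-cancelʳ-<-nonNeg r {{ℚ.nonNegative (ℚ.<⇒≤ 0<r)}}

  <⇒0<- : ∀ {p q} → p ℚ.< q → 0ℚ ℚ.< q ℚ.- p
  <⇒0<- {p} {q} p<q =
    subst (ℚ._< q ℚ.- p) (ℚ.+-inverseʳ p) (ℚ.+-monoˡ-< (ℚ.- p) p<q)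

  ≤⇒0≤- : ∀ {p q} → p ℚ.≤ q → 0ℚ ℚ.≤ q ℚ.- p
  ≤⇒0≤- {p} {q} p≤q =
    subst (ℚ._≤ q ℚ.- p) (ℚ.+-inverseʳ p) (ℚ.+-monoˡ-≤ (ℚ.- p) p≤q)

  split : ∀ p q → q ≡ p ℚ.+ (q ℚ.- p)
  split = let open +-*-Solver in solve 2 (λ p q → q := p :+ (q :- p)) refl

  p+q-p≡q : ∀ p q → p ℚ.+ q ℚ.- p ≡ q
  p+q-p≡q = let open +-*-Solver in solve 2 (λ p q → p :+ q :- p := q) refl

  p-q+q≡p : ∀ p q → p ℚ.- q ℚ.+ q ≡ p
  p-q+q≡p = let open +-*-Solver in solve 2 (λ p q → p :- q :+ q := p) refl

  p-[p-q]≡q : ∀ p q → p ℚ.- (p ℚ.- q) ≡ q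
  p-[p-q]≡q = let open +-*-Solver in solve 2 (λ p q → p :- (p :- q) := q) refl

  p<p+q : ∀ p {q} → 0ℚ ℚ.< q → p ℚ.< p ℚ.+ q
  p<p+q p {q} 0<q = subst (ℚ._< p ℚ.+ q) (ℚ.+-identityʳ p) (ℚ.+-monoʳ-< p 0<q)

  neg-neg : ∀ p → ℚ.- (ℚ.- p) ≡ p
  neg-neg = let open +-*-Solver in solve 1 (λ p → :- (:- p) := p) refl

  -p<q⇒-q<p : ∀ {p q} → ℚ.- p ℚ.< q → ℚ.- q ℚ.< p
  -p<q⇒-q<p {p} {q} h = subst (ℚ.- q ℚ.<_) (neg-neg p) (ℚ.neg-antimono-< h)

  p<-q⇒q<-p : ∀ {p q} → p ℚ.< ℚ.- q → q ℚ.< ℚ.- p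
  p<-q⇒q<-p {p} {q} h = subst (ℚ._< ℚ.- p) (neg-neg q) (ℚ.neg-antimono-< h)

  -- Given m and t > 0, a rational r with r t = m.
  divide : ∀ m {t} → 0ℚ ℚ.< t → ∃[ r ] r ℚ.* t ≡ m
  divide m {t} 0<t = m ℚ.* r , trans (ℚ.*-assoc m r t)
    (trans (cong (m ℚ.*_) (ℚ.*-inverseˡ t {{t≢0}})) (ℚ.*-identityʳ m))
    where
    t≢0 = ℚ.>-nonZero 0<t
    r = (ℚ.1/ t) {{t≢0}}

  half : ∀ {p} → 0ℚ ℚ.< p → 0ℚ ℚ.< p ℚ.* ½
  half 0<p = *-pos 0<p 0<½

  half+half : ∀ p → p ℚ.* ½ ℚ.+ p ℚ.* ½ ≡ p
  half+half p = trans (sym (ℚ.*-distribˡ-+ p ½ ½)) (ℚ.*-identityʳ p)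

  /-+ : ∀ a b d → (+ a ℚ./ suc d) ℚ.+ (+ b ℚ./ suc d) ≡ + (a ℕ.+ b) ℚ./ suc d
  /-+ a b d = ℚ.toℚᵘ-injective (begin
    ℚ.toℚᵘ ((+ a ℚ./ suc d) ℚ.+ (+ b ℚ./ suc d))
      ≈⟨ ℚ.toℚᵘ-homo-+ (+ a ℚ./ suc d) (+ b ℚ./ suc d) ⟩
    ℚ.toℚᵘ (+ a ℚ./ suc d) ℚᵘ.+ ℚ.toℚᵘ (+ b ℚ./ suc d)
      ≈⟨ ℚᵘ.+-cong (ℚ.toℚᵘ-fromℚᵘ (mkℚᵘ (+ a) d)) (ℚ.toℚᵘ-fromℚᵘ (mkℚᵘ (+ b) d)) ⟩
    mkℚᵘ (+ a) d ℚᵘ.+ mkℚᵘ (+ b) d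
      ≈⟨ ℚᵘ.*≡* same ⟩
    mkℚᵘ (+ (a ℕ.+ b)) d
      ≈⟨ ℚ.toℚᵘ-fromℚᵘ (mkℚᵘ (+ (a ℕ.+ b)) d) ⟨
    ℚ.toℚᵘ (+ (a ℕ.+ b) ℚ./ suc d) ∎)
    where
    open ℚᵘ.≃-Reasoning
    D = + suc d
    same : (+ a ℤ.* D ℤ.+ + b ℤ.* D) ℤ.* D ≡ + (a ℕ.+ b) ℤ.* (D ℤ.* D)
    same = trans (cong (ℤ._* D) (sym (ℤ.*-distribʳ-+ D (+ a) (+ b))))
                 (ℤ.*-assoc (+ (a ℕ.+ b)) D D)

  /-pos : ∀ a d → 0ℚ ℚ.< + suc a ℚ./ suc d
  /-pos a d = ℚ.positive⁻¹ _ {{ℚ.normalize-pos (suc a) (suc d)}}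

  /-drop-< : ∀ a b c d → + a ℚ./ suc b ℚ.< + c ℚ./ suc d → a ℕ.* suc d ℕ.< c ℕ.* suc b
  /-drop-< a b c d lt = ℤ.drop‿+<+
    (subst₂ ℤ._<_ (sym (ℤ.pos-* a (suc d))) (sym (ℤ.pos-* c (suc b)))
      (ℚᵘ.drop-*<* (ℚᵘ.<-respʳ-≃ (ℚ.toℚᵘ-fromℚᵘ (mkℚᵘ (+ c) d))
        (ℚᵘ.<-respˡ-≃ (ℚ.toℚᵘ-fromℚᵘ (mkℚᵘ (+ a) b)) (ℚ.toℚᵘ-mono-< lt)))))

  fromℕ-suc : ∀ n → fromℕ (suc n) ≡ 1ℚ ℚ.+ fromℕ n
  fromℕ-suc n = sym (/-+ 1 n 0)

  k*1/d : ∀ k d → fromℕ k ℚ.* (+ 1 ℚ./ suc d) ≡ + k ℚ./ suc d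
  k*1/d zero    d = trans (ℚ.*-zeroˡ (+ 1 ℚ./ suc d)) (sym (ℚ.0/n≡0 (suc d)))
  k*1/d (suc k) d = begin
    fromℕ (suc k) ℚ.* u             ≡⟨ cong (ℚ._* u) (fromℕ-suc k) ⟩
    (1ℚ ℚ.+ fromℕ k) ℚ.* u          ≡⟨ ℚ.*-distribʳ-+ u 1ℚ (fromℕ k) ⟩
    1ℚ ℚ.* u ℚ.+ fromℕ k ℚ.* u      ≡⟨ cong₂ ℚ._+_ (ℚ.*-identityˡ u) (k*1/d k d) ⟩
    u ℚ.+ (+ k ℚ./ suc d)           ≡⟨ /-+ 1 k d ⟩
    + suc k ℚ./ suc d               ∎
    where
    open ≡-Reasoning
    u = + 1 ℚ./ suc d

  fromℕ-nonNeg : ∀ n → 0ℚ ℚ.≤ fromℕ n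
  fromℕ-nonNeg n = ℚ.nonNegative⁻¹ _ {{ℚ.normalize-nonNeg n 1}}

  1≤fromℕ : ∀ n .{{_ : NonZero n}} → 1ℚ ℚ.≤ fromℕ n
  1≤fromℕ (suc n) = subst₂ ℚ._≤_ (ℚ.+-identityʳ 1ℚ) (sym (fromℕ-suc n))
    (ℚ.+-monoʳ-≤ 1ℚ (fromℕ-nonNeg n))

  ≤-fromℕ : ∀ p → ∃[ n ] p ℚ.≤ fromℕ n
  ≤-fromℕ p@(ℚ.mkℚ (+ n) d _) = n , ℚ.toℚᵘ-cancel-≤
    (ℚᵘ.≤-respʳ-≃ (ℚᵘ.≃-sym (ℚ.toℚᵘ-fromℚᵘ (mkℚᵘ (+ n) 0)))
      (ℚᵘ.*≤* (ℤ.*-monoˡ-≤-nonNeg (+ n) (ℤ.+≤+ (ℕ.s≤s ℕ.z≤n)))))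
  ≤-fromℕ p@(ℚ.mkℚ (ℤ.-[1+ n ]) d _) = 0 , ℚ.<⇒≤ (ℚ.negative⁻¹ p)

  archimedean : ∀ c {δ} → 0ℚ ℚ.< δ → ∃[ n ] c ℚ.≤ fromℕ n ℚ.* δ
  archimedean c {δ} 0<δ with divide c 0<δ
  ... | r , rδ≡c with ≤-fromℕ r
  ... | n , r≤n = n , subst (ℚ._≤ fromℕ n ℚ.* δ) rδ≡c
                        (ℚ.*-monoʳ-≤-nonNeg δ {{ℚ.nonNegative (ℚ.<⇒≤ 0<δ)}} r≤n)

  ^-nonNeg : ∀ {x} n → 0ℚ ℚ.≤ x → 0ℚ ℚ.≤ x ^ℚ n
  ^-nonNeg zero    0≤x = ℚ.<⇒≤ 0<1
  ^-nonNeg (suc n) 0≤x = *-nonNeg 0≤x (^-nonNeg n 0≤x)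

  ^-pos : ∀ {x} n → 0ℚ ℚ.< x → 0ℚ ℚ.< x ^ℚ n
  ^-pos zero    0<x = 0<1
  ^-pos (suc n) 0<x = *-pos 0<x (^-pos n 0<x)

  ^-mono-≤ : ∀ {x y} n → 0ℚ ℚ.≤ x → x ℚ.≤ y → x ^ℚ n ℚ.≤ y ^ℚ n
  ^-mono-≤ zero    0≤x x≤y = ℚ.≤-refl
  ^-mono-≤ (suc n) 0≤x x≤y =
    *-mono-≤ (^-nonNeg n 0≤x) (ℚ.≤-trans 0≤x x≤y) x≤y (^-mono-≤ n 0≤x x≤y)

  ^-mono-< : ∀ {x y} n → 0ℚ ℚ.≤ x → x ℚ.< y → x ^ℚ suc n ℚ.< y ^ℚ suc n
  ^-mono-< {x} {y} n 0≤x x<y = ℚ.≤-<-trans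
    (ℚ.*-monoˡ-≤-nonNeg x {{ℚ.nonNegative 0≤x}} (^-mono-≤ n 0≤x (ℚ.<⇒≤ x<y)))
    (*-monoˡ-< (^-pos n (ℚ.≤-<-trans 0≤x x<y)) x<y)

  1≤^ : ∀ {x} n → 1ℚ ℚ.≤ x → 1ℚ ℚ.≤ x ^ℚ n
  1≤^ zero    1≤x = ℚ.≤-refl
  1≤^ {x} (suc n) 1≤x = *-mono-≤ (ℚ.<⇒≤ 0<1) (ℚ.≤-trans (ℚ.<⇒≤ 0<1) 1≤x) 1≤x (1≤^ n 1≤x)

  open import Algebra.Properties.Semiring.Exp
    (CommutativeRing.semiring ℚ.+-*-commutativeRing)
    using () renaming (^-homo-* to ^-+; ^-assocʳ to ^-*) public

  ^-monoʳ-≤ : ∀ {x m n} → 1ℚ ℚ.≤ x → m ℕ.≤ n → x ^ℚ m ℚ.≤ x ^ℚ n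
  ^-monoʳ-≤ {x} {m} {n} 1≤x m≤n = begin
    x ^ℚ m                        ≡⟨ ℚ.*-identityʳ (x ^ℚ m) ⟨
    x ^ℚ m ℚ.* 1ℚ                 ≤⟨ ℚ.*-monoˡ-≤-nonNeg (x ^ℚ m)
                                       {{ℚ.nonNegative (^-nonNeg m (ℚ.≤-trans (ℚ.<⇒≤ 0<1) 1≤x))}}
                                       (1≤^ (n ℕ.∸ m) 1≤x) ⟩
    x ^ℚ m ℚ.* x ^ℚ (n ℕ.∸ m)     ≡⟨ ^-+ x m (n ℕ.∸ m) ⟨
    x ^ℚ (m ℕ.+ (n ℕ.∸ m))        ≡⟨ cong (x ^ℚ_) (ℕ.m+[n∸m]≡n m≤n) ⟩
    x ^ℚ n                        ∎
    where open ℚ.≤-Reasoning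

  -- A Lipschitz constant for x ↦ x ^ n on [0 , B].
  lip : ℚ → ℕ → ℚ
  lip B zero    = 0ℚ
  lip B (suc n) = B ℚ.* lip B n ℚ.+ B ^ℚ n

  lip-nonNeg : ∀ {B} n → 0ℚ ℚ.≤ B → 0ℚ ℚ.≤ lip B n
  lip-nonNeg zero    0≤B = ℚ.≤-refl
  lip-nonNeg (suc n) 0≤B = +-nonNeg (*-nonNeg 0≤B (lip-nonNeg n 0≤B)) (^-nonNeg n 0≤B)

  ^-lipschitz : ∀ {x y B} n → 0ℚ ℚ.≤ y → y ℚ.≤ x → x ℚ.≤ B →
                x ^ℚ n ℚ.≤ y ^ℚ n ℚ.+ (x ℚ.- y) ℚ.* lip B n
  ^-lipschitz {x} {y} zero 0≤y y≤x x≤B = ℚ.≤-reflexive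
    (sym (trans (cong (1ℚ ℚ.+_) (ℚ.*-zeroʳ (x ℚ.- y))) (ℚ.+-identityʳ 1ℚ)))
  ^-lipschitz {x} {y} {B} (suc n) 0≤y y≤x x≤B = begin
    x ℚ.* x ^ℚ n
      ≤⟨ ℚ.*-monoˡ-≤-nonNeg x {{ℚ.nonNegative 0≤x}} (^-lipschitz n 0≤y y≤x x≤B) ⟩
    x ℚ.* (y ^ℚ n ℚ.+ d ℚ.* M)
      ≡⟨ trans (ℚ.*-distribˡ-+ x (y ^ℚ n) (d ℚ.* M)) (cong (λ z → z ℚ.* y ^ℚ n ℚ.+ x ℚ.* (d ℚ.* M)) (split y x)) ⟩
    (y ℚ.+ d) ℚ.* y ^ℚ n ℚ.+ x ℚ.* (d ℚ.* M)
      ≡⟨ regroup x y d (y ^ℚ n) M ⟩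
    y ℚ.* y ^ℚ n ℚ.+ d ℚ.* (x ℚ.* M ℚ.+ y ^ℚ n)
      ≤⟨ ℚ.+-monoʳ-≤ (y ℚ.* y ^ℚ n) (ℚ.*-monoˡ-≤-nonNeg d {{ℚ.nonNegative (≤⇒0≤- y≤x)}}
           (ℚ.+-mono-≤ (ℚ.*-monoʳ-≤-nonNeg M {{ℚ.nonNegative 0≤M}} x≤B)
                       (^-mono-≤ n 0≤y (ℚ.≤-trans y≤x x≤B)))) ⟩
    y ℚ.* y ^ℚ n ℚ.+ d ℚ.* lip B (suc n) ∎
    where
    open ℚ.≤-Reasoning
    d = x ℚ.- y
    M = lip B n
    regroup : ∀ x y d Y M → (y ℚ.+ d) ℚ.* Y ℚ.+ x ℚ.* (d ℚ.* M) ≡ y ℚ.* Y ℚ.+ d ℚ.* (x ℚ.* M ℚ.+ Y)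
    regroup = let open ℕCoefficients in solve 5 (λ x y d Y M →
      (y :+ d) :* Y :+ x :* (d :* M) := y :* Y :+ d :* (x :* M :+ Y)) refl
    0≤x = ℚ.≤-trans 0≤y y≤x
    0≤M = lip-nonNeg n (ℚ.≤-trans 0≤x x≤B)

  -- For ε > 0 and M ≥ 0, some δ ∈ (0 , 1] satisfies δ M < ε.
  small : ∀ {ε M} → 0ℚ ℚ.< ε → 0ℚ ℚ.≤ M → ∃[ δ ] 0ℚ ℚ.< δ × δ ℚ.≤ 1ℚ × δ ℚ.* M ℚ.< ε
  small {ε} {M} 0<ε 0≤M = choose (divide ε 0<M+1)
    where
    open ℚ.≤-Reasoning
    0<M+1 : 0ℚ ℚ.< M ℚ.+ 1ℚ
    0<M+1 = ℚ.+-mono-≤-< 0≤M 0<1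
    choose : ∃[ r ] r ℚ.* (M ℚ.+ 1ℚ) ≡ ε → ∃[ δ ] 0ℚ ℚ.< δ × δ ℚ.≤ 1ℚ × δ ℚ.* M ℚ.< ε
    choose (r , r*≡ε) = Sum.[ below , above ]′ (ℚ.≤-total r 1ℚ)
      where
      0<r : 0ℚ ℚ.< r
      0<r = *-cancelʳ-< 0<M+1 (subst₂ ℚ._<_ (sym (ℚ.*-zeroˡ (M ℚ.+ 1ℚ))) (sym r*≡ε) 0<ε)
      rM<ε : r ℚ.* M ℚ.< ε
      rM<ε = subst (r ℚ.* M ℚ.<_) r*≡ε
        (ℚ.*-monoʳ-<-pos r {{ℚ.positive 0<r}} (p<p+q M 0<1))
      below = λ r≤1 → r , 0<r , r≤1 , rM<ε
      above = λ 1≤r → 1ℚ , 0<1 , ℚ.≤-refl ,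
        ℚ.≤-<-trans (ℚ.*-monoʳ-≤-nonNeg M {{ℚ.nonNegative 0≤M}} 1≤r) rM<ε

  +-cancel-< : ∀ {p q d} → d ℚ.< q ℚ.- p → p ℚ.+ d ℚ.< q
  +-cancel-< {p} {q} {d} h = subst (p ℚ.+ d ℚ.<_)
    (sym (split p q)) (ℚ.+-monoʳ-< p h)

  ^-cont-up : ∀ {x K} n → 0ℚ ℚ.≤ x → x ^ℚ n ℚ.< K → ∃[ y ] x ℚ.< y × y ^ℚ n ℚ.< K
  ^-cont-up {x} {K} n 0≤x x^n<K =
    choose (small (<⇒0<- x^n<K) (lip-nonNeg n (+-nonNeg 0≤x (ℚ.<⇒≤ 0<1))))
    where
    open ℚ.≤-Reasoning
    M = lip (x ℚ.+ 1ℚ) n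
    choose : ∃[ δ ] 0ℚ ℚ.< δ × δ ℚ.≤ 1ℚ × δ ℚ.* M ℚ.< K ℚ.- x ^ℚ n →
             ∃[ y ] x ℚ.< y × y ^ℚ n ℚ.< K
    choose (δ , 0<δ , δ≤1 , δM<ε) = x ℚ.+ δ , p<p+q x 0<δ , (begin-strict
      (x ℚ.+ δ) ^ℚ n
        ≤⟨ ^-lipschitz n 0≤x (ℚ.<⇒≤ (p<p+q x 0<δ)) (ℚ.+-monoʳ-≤ x δ≤1) ⟩
      x ^ℚ n ℚ.+ (x ℚ.+ δ ℚ.- x) ℚ.* M
        ≡⟨ cong (λ d → x ^ℚ n ℚ.+ d ℚ.* M) (p+q-p≡q x δ) ⟩
      x ^ℚ n ℚ.+ δ ℚ.* M
        <⟨ +-cancel-< δM<ε ⟩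
      K ∎)

  ^-cont-down : ∀ {x K} n → 0ℚ ℚ.< x → K ℚ.< x ^ℚ n →
                ∃[ y ] 0ℚ ℚ.< y × y ℚ.< x × K ℚ.< y ^ℚ n
  ^-cont-down {x} {K} n 0<x K<x^n =
    choose (small (<⇒0<- K<x^n) (*-nonNeg (ℚ.<⇒≤ 0<x) (lip-nonNeg n (ℚ.<⇒≤ 0<x))))
    where
    open ℚ.≤-Reasoning
    M = lip x n
    choose : ∃[ δ ] 0ℚ ℚ.< δ × δ ℚ.≤ 1ℚ × δ ℚ.* (x ℚ.* M) ℚ.< x ^ℚ n ℚ.- K →
             ∃[ y ] 0ℚ ℚ.< y × y ℚ.< x × K ℚ.< y ^ℚ n
    choose (δ , 0<δ , δ≤1 , δxM<ε) = x ℚ.- e , 0<y , y<x , K<y^n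
      where
      e = δ ℚ.* ½ ℚ.* x
      0<e : 0ℚ ℚ.< e
      0<e = *-pos (half 0<δ) 0<x
      e<x : e ℚ.< x
      e<x = subst (e ℚ.<_) (ℚ.*-identityˡ x)
        (*-monoˡ-< 0<x (ℚ.≤-<-trans (ℚ.*-monoʳ-≤-nonNeg ½ δ≤1) ½<1))
      0<y : 0ℚ ℚ.< x ℚ.- e
      0<y = <⇒0<- e<x
      y<x : x ℚ.- e ℚ.< x
      y<x = subst (x ℚ.- e ℚ.<_) (p-q+q≡p x e) (p<p+q (x ℚ.- e) 0<e)
      eM≤δxM : e ℚ.* M ℚ.≤ δ ℚ.* (x ℚ.* M)
      eM≤δxM = begin
        e ℚ.* M                     ≡⟨ reassoc δ ½ x M ⟩
        ½ ℚ.* (δ ℚ.* (x ℚ.* M))     ≤⟨ ℚ.*-monoʳ-≤-nonNeg (δ ℚ.* (x ℚ.* M))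
                                         {{ℚ.nonNegative 0≤δxM}} (ℚ.<⇒≤ ½<1) ⟩
        1ℚ ℚ.* (δ ℚ.* (x ℚ.* M))    ≡⟨ ℚ.*-identityˡ (δ ℚ.* (x ℚ.* M)) ⟩
        δ ℚ.* (x ℚ.* M)             ∎
        where
        0≤δxM : 0ℚ ℚ.≤ δ ℚ.* (x ℚ.* M)
        0≤δxM = *-nonNeg (ℚ.<⇒≤ 0<δ) (*-nonNeg (ℚ.<⇒≤ 0<x) (lip-nonNeg n (ℚ.<⇒≤ 0<x)))
        reassoc : ∀ d h x M → d ℚ.* h ℚ.* x ℚ.* M ≡ h ℚ.* (d ℚ.* (x ℚ.* M))
        reassoc = let open ℕCoefficients in
          solve 4 (λ d h x M → d :* h :* x :* M := h :* (d :* (x :* M))) refl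
      K<y^n : K ℚ.< (x ℚ.- e) ^ℚ n
      K<y^n = ℚ.≰⇒> λ y^n≤K → ℚ.<-irrefl refl (begin-strict
        x ^ℚ n
          ≤⟨ ^-lipschitz n (ℚ.<⇒≤ 0<y) (ℚ.<⇒≤ y<x) ℚ.≤-refl ⟩
        (x ℚ.- e) ^ℚ n ℚ.+ (x ℚ.- (x ℚ.- e)) ℚ.* M
          ≡⟨ cong (λ d → (x ℚ.- e) ^ℚ n ℚ.+ d ℚ.* M) (p-[p-q]≡q x e) ⟩
        (x ℚ.- e) ^ℚ n ℚ.+ e ℚ.* M
          ≤⟨ ℚ.+-mono-≤ y^n≤K eM≤δxM ⟩
        K ℚ.+ δ ℚ.* (x ℚ.* M)
          <⟨ +-cancel-< δxM<ε ⟩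
        x ^ℚ n ∎)

  *-swap : ∀ p q r → p ℚ.* (q ℚ.* r) ≡ q ℚ.* (p ℚ.* r)
  *-swap = let open ℕCoefficients in
    solve 3 (λ p q r → p :* (q :* r) := q :* (p :* r)) refl

  bernoulli : ∀ {p q} n → 0ℚ ℚ.< p → p ℚ.< q →
              p ^ℚ n ℚ.* (p ℚ.+ fromℕ n ℚ.* (q ℚ.- p)) ℚ.≤ p ℚ.* q ^ℚ n
  bernoulli {p} {q} zero 0<p p<q = ℚ.≤-reflexive (trans
    (cong (λ z → 1ℚ ℚ.* (p ℚ.+ z)) (ℚ.*-zeroˡ (q ℚ.- p)))
    (trans (ℚ.*-identityˡ _) (trans (ℚ.+-identityʳ p) (sym (ℚ.*-identityʳ p)))))
  bernoulli {p} {q} (suc n) 0<p p<q = begin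
    p ℚ.* P ℚ.* (p ℚ.+ fromℕ (suc n) ℚ.* h)
      ≡⟨ cong (λ k → p ℚ.* P ℚ.* (p ℚ.+ k ℚ.* h)) (fromℕ-suc n) ⟩
    p ℚ.* P ℚ.* (p ℚ.+ (1ℚ ℚ.+ N) ℚ.* h)
      ≡⟨ ℚ.+-identityʳ (p ℚ.* P ℚ.* (p ℚ.+ (1ℚ ℚ.+ N) ℚ.* h)) ⟨
    p ℚ.* P ℚ.* (p ℚ.+ (1ℚ ℚ.+ N) ℚ.* h) ℚ.+ 0ℚ
      ≤⟨ ℚ.+-monoʳ-≤ (p ℚ.* P ℚ.* (p ℚ.+ (1ℚ ℚ.+ N) ℚ.* h)) (*-nonNeg (^-nonNeg n (ℚ.<⇒≤ 0<p))
           (*-nonNeg (fromℕ-nonNeg n) (*-nonNeg (ℚ.<⇒≤ 0<h) (ℚ.<⇒≤ 0<h)))) ⟩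
    p ℚ.* P ℚ.* (p ℚ.+ (1ℚ ℚ.+ N) ℚ.* h) ℚ.+ P ℚ.* (N ℚ.* (h ℚ.* h))
      ≡⟨ expand p h P N ⟩
    (p ℚ.+ h) ℚ.* (P ℚ.* (p ℚ.+ N ℚ.* h))
      ≡⟨ cong (ℚ._* (P ℚ.* (p ℚ.+ N ℚ.* h))) (split p q) ⟨
    q ℚ.* (P ℚ.* (p ℚ.+ N ℚ.* h))
      ≤⟨ ℚ.*-monoˡ-≤-nonNeg q {{ℚ.nonNegative (ℚ.<⇒≤ (ℚ.<-trans 0<p p<q))}} (bernoulli n 0<p p<q) ⟩
    q ℚ.* (p ℚ.* q ^ℚ n)
      ≡⟨ *-swap q p (q ^ℚ n) ⟩
    p ℚ.* (q ℚ.* q ^ℚ n) ∎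
    where
    open ℚ.≤-Reasoning
    h = q ℚ.- p
    0<h = <⇒0<- p<q
    P = p ^ℚ n
    N = fromℕ n
    open ℕCoefficients
    expand : ∀ p h P N → p ℚ.* P ℚ.* (p ℚ.+ (1ℚ ℚ.+ N) ℚ.* h) ℚ.+ P ℚ.* (N ℚ.* (h ℚ.* h))
                       ≡ (p ℚ.+ h) ℚ.* (P ℚ.* (p ℚ.+ N ℚ.* h))
    expand = solve 4 (λ p h P N →
      p :* P :* (p :+ (con 1 :+ N) :* h) :+ P :* (N :* (h :* h))
        := (p :+ h) :* (P :* (p :+ N :* h))) refl

  ^-gap : ∀ {p q} T → 0ℚ ℚ.< p → p ℚ.< q → ∃[ b ] T ℚ.* p ^ℚ suc b ℚ.< q ^ℚ suc b
  ^-gap {p} {q} T 0<p p<q = choose (archimedean (p ℚ.* T) (<⇒0<- p<q))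
    where
    open ℚ.≤-Reasoning
    h = q ℚ.- p
    rotate : ∀ p T P → p ℚ.* (T ℚ.* P) ≡ P ℚ.* (p ℚ.* T)
    rotate = let open ℕCoefficients in
      solve 3 (λ p T P → p :* (T :* P) := P :* (p :* T)) refl
    collect : ∀ N h p → N ℚ.* h ℚ.+ (p ℚ.+ h) ≡ p ℚ.+ (1ℚ ℚ.+ N) ℚ.* h
    collect = let open ℕCoefficients in
      solve 3 (λ N h p → N :* h :+ (p :+ h) := p :+ (con 1 :+ N) :* h) refl
    choose : ∃[ n ] p ℚ.* T ℚ.≤ fromℕ n ℚ.* h → ∃[ b ] T ℚ.* p ^ℚ suc b ℚ.< q ^ℚ suc b
    choose (n , pT≤nh) = n , ℚ.*-cancelˡ-<-nonNeg p {{ℚ.nonNegative (ℚ.<⇒≤ 0<p)}} (begin-strict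
      p ℚ.* (T ℚ.* P)
        ≡⟨ rotate p T P ⟩
      P ℚ.* (p ℚ.* T)
        <⟨ ℚ.*-monoʳ-<-pos P {{ℚ.positive (^-pos (suc n) 0<p)}} pT<p+nh ⟩
      P ℚ.* (p ℚ.+ fromℕ (suc n) ℚ.* h)
        ≤⟨ bernoulli (suc n) 0<p p<q ⟩
      p ℚ.* q ^ℚ suc n ∎)
      where
      P = p ^ℚ suc n
      pT<p+nh : p ℚ.* T ℚ.< p ℚ.+ fromℕ (suc n) ℚ.* h
      pT<p+nh = begin-strict
        p ℚ.* T                           ≤⟨ pT≤nh ⟩
        fromℕ n ℚ.* h                     <⟨ p<p+q (fromℕ n ℚ.* h) (+-pos 0<p (<⇒0<- p<q)) ⟩
        fromℕ n ℚ.* h ℚ.+ (p ℚ.+ h)       ≡⟨ collect (fromℕ n) h p ⟩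
        p ℚ.+ (1ℚ ℚ.+ fromℕ n) ℚ.* h      ≡⟨ cong (λ k → p ℚ.+ k ℚ.* h) (fromℕ-suc n) ⟨
        p ℚ.+ fromℕ (suc n) ℚ.* h         ∎

open RationalLemmas

-- Two-sided Dedekind cuts: L and U hold the rationals strictly below and above.
record ℝ : Set₁ where
  field
    L U         : ℚ → Set
    L-inhabited : ∃ L
    U-inhabited : ∃ U
    L-down      : ∀ {p q} → p ℚ.< q → L q → L p
    U-up        : ∀ {p q} → p ℚ.< q → U p → U q
    L-open      : ∀ {p} → L p → ∃[ q ] p ℚ.< q × L q
    U-open      : ∀ {q} → U q → ∃[ p ] p ℚ.< q × U p
    disjoint    : ∀ {q} → L q → U q → ⊥
    located     : ∀ {p q} → p ℚ.< q → L p ⊎ U q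

open ℝ public

infix 4 _<_ _≤_ _≈_

_<_ : ℝ → ℝ → Set
x < y = ∃[ q ] U x q × L y q

_≤_ : ℝ → ℝ → Set
x ≤ y = ¬ (y < x)

_≈_ : ℝ → ℝ → Set
x ≈ y = x ≤ y × y ≤ x

L<U : ∀ x {p q} → L x p → U x q → p ℚ.< q
L<U x {p} {q} Lp Uq = compare (ℚ.<-cmp p q)
  where
  compare : _ → p ℚ.< q
  compare (tri< p<q _ _) = p<q
  compare (tri≈ _ p≡q _) = ⊥-elim (disjoint x Lp (subst (U x) (sym p≡q) Uq))
  compare (tri> _ _ q<p) = ⊥-elim (disjoint x Lp (U-up x q<p Uq))

L-down-≤ : ∀ x {p q} → p ℚ.≤ q → L x q → L x p
L-down-≤ x p≤q Lq =
  let r , q<r , Lr = L-open x Lq in L-down x (ℚ.≤-<-trans p≤q q<r) Lr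

U-up-≤ : ∀ x {p q} → p ℚ.≤ q → U x p → U x q
U-up-≤ x p≤q Up =
  let r , r<p , Ur = U-open x Up in U-up x (ℚ.<-≤-trans r<p p≤q) Ur

<⇒≤ : ∀ {x y} → x < y → x ≤ y
<⇒≤ {x} {y} (p , Uxp , Lyp) (q , Uyq , Lxq) =
  ℚ.<-asym (L<U y Lyp Uyq) (L<U x Lxq Uxp)

<-≤-trans : ∀ {x y z} → x < y → y ≤ z → x < z
<-≤-trans {x} {y} {z} (p , Uxp , Lyp) y≤z =
  let q , p<q , Lyq = L-open y Lyp in
  p , Uxp , Sum.[ (λ Lzp → Lzp) , (λ Uzq → ⊥-elim (y≤z (q , Uzq , Lyq))) ]′ (located z p<q)

<-trans : ∀ {x y z} → x < y → y < z → x < z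
<-trans {x} {y} {z} x<y y<z = <-≤-trans {x} {y} {z} x<y (<⇒≤ {y} {z} y<z)

fromℚ : ℚ → ℝ
fromℚ c = record
  { L           = ℚ._< c
  ; U           = c ℚ.<_
  ; L-inhabited = c ℚ.- 1ℚ , subst (c ℚ.- 1ℚ ℚ.<_) (p-q+q≡p c 1ℚ) (p<p+q (c ℚ.- 1ℚ) 0<1)
  ; U-inhabited = c ℚ.+ 1ℚ , p<p+q c 0<1
  ; L-down      = ℚ.<-trans
  ; U-up        = λ p<q c<p → ℚ.<-trans c<p p<q
  ; L-open      = ℚ.<-dense
  ; U-open      = λ c<q → let r , c<r , r<q = ℚ.<-dense c<q in r , r<q , c<r
  ; disjoint    = ℚ.<-asym
  ; located     = λ {p} {q} p<q → case p ℚ.<? c of λ where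
      (yes p<c) → inj₁ p<c
      (no  p≮c) → inj₂ (ℚ.≤-<-trans (ℚ.≮⇒≥ p≮c) p<q)
  }

fromℚ-mono-< : ∀ {p q} → p ℚ.< q → fromℚ p < fromℚ q
fromℚ-mono-< = ℚ.<-dense

fromℚ-mono-≤ : ∀ {p q} → p ℚ.≤ q → fromℚ p ≤ fromℚ q
fromℚ-mono-≤ p≤q (r , q<r , r<p) = ℚ.<-irrefl refl (ℚ.<-≤-trans (ℚ.<-trans q<r r<p) p≤q)

0ℝ 1ℝ 2ℝ : ℝ
0ℝ = fromℚ 0ℚ
1ℝ = fromℚ 1ℚ
2ℝ = fromℚ (fromℕ 2)

0<1ℝ : 0ℝ < 1ℝ
0<1ℝ = fromℚ-mono-< 0<1

0<2ℝ : 0ℝ < 2ℝ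
0<2ℝ = fromℚ-mono-< (/-pos 1 0)

-- Walking in steps of size δ from a ∈ L x, one meets a step a + k δ ∈ L x
-- such that a + (k + 2) δ ∈ U x.
grid : ∀ x {a δ} → 0ℚ ℚ.< δ → L x a →
       ∃[ k ] L x (a ℚ.+ fromℕ k ℚ.* δ) × U x (a ℚ.+ fromℕ (2 ℕ.+ k) ℚ.* δ)
grid x {a} {δ} 0<δ La =
  let c , Uc      = U-inhabited x
      n , c-a≤nδ  = archimedean (c ℚ.- a) 0<δ
  in walk n 0 (subst (L x) (sym at0) La) (U-up-≤ x
       (subst₂ ℚ._≤_ (sym (split a c)) (cong (λ k → point k) (sym (ℕ.+-identityʳ n)))
         (ℚ.+-monoʳ-≤ a c-a≤nδ)) Uc)
  where
  point : ℕ → ℚ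
  point k = a ℚ.+ fromℕ k ℚ.* δ
  at0 : point 0 ≡ a
  at0 = trans (cong (a ℚ.+_) (ℚ.*-zeroˡ δ)) (ℚ.+-identityʳ a)
  step : ∀ k → point k ℚ.< point (suc k)
  step k = ℚ.+-monoʳ-< a (*-monoˡ-< 0<δ
    (subst (fromℕ k ℚ.<_) (trans (ℚ.+-comm (fromℕ k) 1ℚ) (sym (fromℕ-suc k))) (p<p+q (fromℕ k) 0<1)))
  walk : ∀ n k → L x (point k) → U x (point (n ℕ.+ k)) →
         ∃[ j ] L x (point j) × U x (point (2 ℕ.+ j))
  walk zero    k Lk Uk  = ⊥-elim (disjoint x Lk Uk)
  walk (suc n) k Lk Unk = Sum.[ next , (λ U2 → k , Lk , U2) ]′ (located x (step (suc k)))
    where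
    next = λ Lsk → walk n (suc k) Lsk (subst (λ m → U x (point m)) (sym (ℕ.+-suc n k)) Unk)

approx : ∀ x {a c δ} → 0ℚ ℚ.< δ → L x a → U x c →
         ∃[ s ] ∃[ t ] L x s × U x t × a ℚ.≤ s × t ℚ.≤ c × t ℚ.- s ℚ.≤ δ
approx x {a} {c} {δ} 0<δ La Uc = choose (grid x (half 0<δ) La)
  where
  choose : _ → _
  choose (k , Ls , Ut) = case ℚ.≤-total t c of λ where
      (inj₁ t≤c) → s , t , Ls , Ut , a≤s , t≤c , ℚ.≤-reflexive t-s≡δ
      (inj₂ c≤t) → s , c , Ls , Uc , a≤s , ℚ.≤-refl ,
        ℚ.≤-trans (ℚ.+-monoˡ-≤ (ℚ.- s) c≤t) (ℚ.≤-reflexive t-s≡δ)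
    where
    h = δ ℚ.* ½
    s = a ℚ.+ fromℕ k ℚ.* h
    t = a ℚ.+ fromℕ (2 ℕ.+ k) ℚ.* h
    a≤s : a ℚ.≤ s
    a≤s = subst (ℚ._≤ s) (ℚ.+-identityʳ a)
      (ℚ.+-monoʳ-≤ a (*-nonNeg (fromℕ-nonNeg k) (ℚ.<⇒≤ (half 0<δ))))
    regroup : ∀ a N h → a ℚ.+ (1ℚ ℚ.+ (1ℚ ℚ.+ N)) ℚ.* h ≡ a ℚ.+ N ℚ.* h ℚ.+ (h ℚ.+ h)
    regroup = let open ℕCoefficients in
      solve 3 (λ a N h → a :+ (con 1 :+ (con 1 :+ N)) :* h := a :+ N :* h :+ (h :+ h)) refl
    t≡s+δ : t ≡ s ℚ.+ δ
    t≡s+δ = trans (cong (λ z → a ℚ.+ z ℚ.* h)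
        (trans (fromℕ-suc (suc k)) (cong (1ℚ ℚ.+_) (fromℕ-suc k))))
      (trans (regroup a (fromℕ k) h) (cong (s ℚ.+_) (half+half δ)))
    t-s≡δ : t ℚ.- s ≡ δ
    t-s≡δ = trans (cong (ℚ._- s) t≡s+δ) (p+q-p≡q s δ)

approximate : ∀ x {δ} → 0ℚ ℚ.< δ → ∃[ s ] ∃[ t ] L x s × U x t × t ℚ.- s ℚ.≤ δ
approximate x 0<δ =
  let s , t , Ls , Ut , _ , _ , t-s≤δ =
        approx x 0<δ (proj₂ (L-inhabited x)) (proj₂ (U-inhabited x))
  in s , t , Ls , Ut , t-s≤δ

infixl 6 _+_ _-_
infix  8 -_
infixl 7 _·_

_+_ : ℝ → ℝ → ℝ
x + y = record
  { L           = λ r → ∃[ s ] ∃[ t ] L x s × L y t × r ℚ.< s ℚ.+ t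
  ; U           = λ r → ∃[ s ] ∃[ t ] U x s × U y t × s ℚ.+ t ℚ.< r
  ; L-inhabited =
      let s , Ls = L-inhabited x
          t , Lt = L-inhabited y
          r , r<s+t = L-inhabited (fromℚ (s ℚ.+ t))
      in r , s , t , Ls , Lt , r<s+t
  ; U-inhabited =
      let s , Us = U-inhabited x
          t , Ut = U-inhabited y
          r , s+t<r = U-inhabited (fromℚ (s ℚ.+ t))
      in r , s , t , Us , Ut , s+t<r
  ; L-down      = λ p<q (s , t , Ls , Lt , q<s+t) → s , t , Ls , Lt , ℚ.<-trans p<q q<s+t
  ; U-up        = λ p<q (s , t , Us , Ut , s+t<p) → s , t , Us , Ut , ℚ.<-trans s+t<p p<q
  ; L-open      = λ (s , t , Ls , Lt , p<s+t) →
      let m , p<m , m<s+t = ℚ.<-dense p<s+t in m , p<m , s , t , Ls , Lt , m<s+t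
  ; U-open      = λ (s , t , Us , Ut , s+t<q) →
      let m , s+t<m , m<q = ℚ.<-dense s+t<q in m , m<q , s , t , Us , Ut , s+t<m
  ; disjoint    = λ (s , t , Ls , Lt , q<s+t) (s′ , t′ , Us , Ut , s+t<q) →
      ℚ.<-asym (ℚ.+-mono-< (L<U x Ls Us) (L<U y Lt Ut)) (ℚ.<-trans s+t<q q<s+t)
  ; located     = λ {p} {q} → sumLocated p q
  }
  where
  sumLocated : ∀ p q → p ℚ.< q → _ ⊎ _
  sumLocated p q p<q = choose (approximate x 0<δ) (approximate y 0<δ)
    where
    -- two errors of at most (q - p) / 4 leave room for strictness
    δ = (q ℚ.- p) ℚ.* ½ ℚ.* ½
    0<δ = half (half (<⇒0<- p<q))
    δ+δ<q-p : δ ℚ.+ δ ℚ.< q ℚ.- p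
    δ+δ<q-p = subst₂ ℚ._<_ (sym (half+half ((q ℚ.- p) ℚ.* ½))) (half+half (q ℚ.- p))
      (p<p+q ((q ℚ.- p) ℚ.* ½) (half (<⇒0<- p<q)))
    choose : _ → _ → _
    choose (s , s′ , Ls , Us′ , s′-s≤δ) (t , t′ , Lt , Ut′ , t′-t≤δ) =
      case p ℚ.<? s ℚ.+ t of λ where
        (yes p<s+t) → inj₁ (s , t , Ls , Lt , p<s+t)
        (no  p≮s+t) → inj₂ (s′ , t′ , Us′ , Ut′ , (begin-strict
          s′ ℚ.+ t′
            ≡⟨ cong₂ ℚ._+_ (split s s′) (split t t′) ⟩
          s ℚ.+ (s′ ℚ.- s) ℚ.+ (t ℚ.+ (t′ ℚ.- t))
            ≡⟨ interchange s (s′ ℚ.- s) t (t′ ℚ.- t) ⟩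
          s ℚ.+ t ℚ.+ ((s′ ℚ.- s) ℚ.+ (t′ ℚ.- t))
            ≤⟨ ℚ.+-mono-≤ (ℚ.≮⇒≥ p≮s+t) (ℚ.+-mono-≤ s′-s≤δ t′-t≤δ) ⟩
          p ℚ.+ (δ ℚ.+ δ)
            <⟨ +-cancel-< δ+δ<q-p ⟩
          q ∎))
      where
      open ℚ.≤-Reasoning
      interchange : ∀ a b c d → a ℚ.+ b ℚ.+ (c ℚ.+ d) ≡ a ℚ.+ c ℚ.+ (b ℚ.+ d)
      interchange = let open ℕCoefficients in
        solve 4 (λ a b c d → a :+ b :+ (c :+ d) := a :+ c :+ (b :+ d)) refl

-_ : ℝ → ℝ
- x = record
  { L           = λ r → U x (ℚ.- r)
  ; U           = λ r → L x (ℚ.- r)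
  ; L-inhabited = let q , Uq = U-inhabited x in ℚ.- q , subst (U x) (sym (neg-neg q)) Uq
  ; U-inhabited = let q , Lq = L-inhabited x in ℚ.- q , subst (L x) (sym (neg-neg q)) Lq
  ; L-down      = λ p<q → U-up x (ℚ.neg-antimono-< p<q)
  ; U-up        = λ p<q → L-down x (ℚ.neg-antimono-< p<q)
  ; L-open      = λ U-p → let q , q<-p , Uq = U-open x U-p in
      ℚ.- q , p<-q⇒q<-p q<-p , subst (U x) (sym (neg-neg q)) Uq
  ; U-open      = λ L-q → let p , -q<p , Lp = L-open x L-q in
      ℚ.- p , -p<q⇒-q<p -q<p , subst (L x) (sym (neg-neg p)) Lp
  ; disjoint    = λ Uq Lq → disjoint x Lq Uq
  ; located     = λ p<q → Sum.swap (located x (ℚ.neg-antimono-< p<q))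
  }

_-_ : ℝ → ℝ → ℝ
x - y = x + (- y)

∣_∣ : ℝ → ℝ
∣ x ∣ = record
  { L           = λ r → L x r ⊎ L (- x) r
  ; U           = λ r → U x r × U (- x) r
  ; L-inhabited = let q , Lq = L-inhabited x in q , inj₁ Lq
  ; U-inhabited =
      let p , Up = U-inhabited x
          q , Uq = U-inhabited (- x)
      in p ℚ.⊔ q , U-up-≤ x (ℚ.p≤p⊔q p q) Up , U-up-≤ (- x) (ℚ.p≤q⊔p p q) Uq
  ; L-down      = λ p<q → Sum.map (L-down x p<q) (L-down (- x) p<q)
  ; U-up        = λ p<q (Up , Up′) → U-up x p<q Up , U-up (- x) p<q Up′
  ; L-open      = λ where
      (inj₁ Lp) → let q , p<q , Lq = L-open x Lp in q , p<q , inj₁ Lq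
      (inj₂ Lp) → let q , p<q , Lq = L-open (- x) Lp in q , p<q , inj₂ Lq
  ; U-open      = λ (Uq , Uq′) →
      let r , r<q , Ur = U-open x Uq
          s , s<q , Us = U-open (- x) Uq′
      in r ℚ.⊔ s , ⊔-lub-< r s r<q s<q ,
         U-up-≤ x (ℚ.p≤p⊔q r s) Ur , U-up-≤ (- x) (ℚ.p≤q⊔p r s) Us
  ; disjoint    = λ where
      (inj₁ Lq) (Uq , _) → disjoint x Lq Uq
      (inj₂ Lq) (_ , Uq) → disjoint (- x) Lq Uq
  ; located     = λ p<q → combine (located x p<q) (located (- x) p<q)
  }
  where
  combine : ∀ {p q} → L x p ⊎ U x q → L (- x) p ⊎ U (- x) q →
            (L x p ⊎ L (- x) p) ⊎ (U x q × U (- x) q)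
  combine (inj₁ Lp) _          = inj₁ (inj₁ Lp)
  combine (inj₂ _)  (inj₁ Lp)  = inj₁ (inj₂ Lp)
  combine (inj₂ Uq) (inj₂ Uq′) = inj₂ (Uq , Uq′)

  ⊔-lub-< : ∀ r s {q} → r ℚ.< q → s ℚ.< q → r ℚ.⊔ s ℚ.< q
  ⊔-lub-< r s {q} r<q s<q = case ℚ.⊔-sel r s of λ where
    (inj₁ ≡r) → subst (ℚ._< q) (sym ≡r) r<q
    (inj₂ ≡s) → subst (ℚ._< q) (sym ≡s) s<q

_·_ : (k : ℕ) .{{_ : NonZero k}} → ℝ → ℝ
k · x = record
  { L           = λ r → L x (r ℚ.* 1/k)
  ; U           = λ r → U x (r ℚ.* 1/k)
  ; L-inhabited = let q , Lq = L-inhabited x in q ℚ.* K , subst (L x) (sym (cancel q)) Lq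
  ; U-inhabited = let q , Uq = U-inhabited x in q ℚ.* K , subst (U x) (sym (cancel q)) Uq
  ; L-down      = λ p<q → L-down x (*-monoˡ-< 0<1/k p<q)
  ; U-up        = λ p<q → U-up x (*-monoˡ-< 0<1/k p<q)
  ; L-open      = λ {p} Lp → let q , p/k<q , Lq = L-open x Lp in
      q ℚ.* K ,
      *-cancelʳ-< 0<1/k (subst (p ℚ.* 1/k ℚ.<_) (sym (cancel q)) p/k<q) ,
      subst (L x) (sym (cancel q)) Lq
  ; U-open      = λ {q} Uq → let p , p<q/k , Up = U-open x Uq in
      p ℚ.* K ,
      *-cancelʳ-< 0<1/k (subst (ℚ._< q ℚ.* 1/k) (sym (cancel p)) p<q/k) ,
      subst (U x) (sym (cancel p)) Up
  ; disjoint    = disjoint x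
  ; located     = λ p<q → located x (*-monoˡ-< 0<1/k p<q)
  }
  where
  K = fromℕ k
  instance
    K-pos : Positive K
    K-pos = ℚ.normalize-pos k 1
    K≢0 : ℚ.NonZero K
    K≢0 = ℚ.pos⇒nonZero K
  1/k : ℚ
  1/k = ℚ.1/ K
  0<1/k : 0ℚ ℚ.< 1/k
  0<1/k = ℚ.positive⁻¹ 1/k {{ℚ.1/pos⇒pos K}}
  cancel : ∀ q → q ℚ.* K ℚ.* 1/k ≡ q
  cancel q = trans (ℚ.*-assoc q K 1/k)
    (trans (cong (q ℚ.*_) (ℚ.*-inverseʳ K)) (ℚ.*-identityʳ q))

ℝ⁺ : Set₁
ℝ⁺ = Σ[ x ∈ ℝ ] 0ℝ < x

ℝ≥1 : Set₁
ℝ≥1 = Σ[ x ∈ ℝ ] 1ℝ ≤ x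

≥1⇒⁺ : ℝ≥1 → ℝ⁺
≥1⇒⁺ (x , 1≤x) = x , <-≤-trans {0ℝ} {1ℝ} {x} 0<1ℝ 1≤x

fromℕ≥1 : (n : ℕ) .{{_ : NonZero n}} → ℝ≥1
fromℕ≥1 n = fromℚ (fromℕ n) , fromℚ-mono-≤ (1≤fromℕ n)

infixl 6 _+⁺_ _+¹_

_+⁺_ : ℝ⁺ → ℝ⁺ → ℝ⁺
(x , p , 0<p , Lp) +⁺ (y , q , 0<q , Lq) = x + y ,
  (let r , 0<r , r<p+q = ℚ.<-dense (+-pos 0<p 0<q) in r , 0<r , p , q , Lp , Lq , r<p+q)

_+¹_ : ℝ≥1 → ℝ⁺ → ℝ≥1
(x , 1≤x) +¹ (y , 0<y) = x + y , λ (r , (s , t , Us , Ut , s+t<r) , r<1) →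
  let u , u<s , Uu = U-open x Us
      0<t = U⇒0< 0<y Ut
      s<1 = ℚ.<-trans (p<p+q s 0<t) (ℚ.<-trans s+t<r r<1)
  in 1≤x (s , Us , s<1)
  where
  U⇒0< : 0ℝ < y → ∀ {t} → U y t → 0ℚ ℚ.< t
  U⇒0< (q , 0<q , Lq) Ut = ℚ.<-trans 0<q (L<U y Lq Ut)

infix 8 _⁻¹
infixr 8 _^_

_⁻¹ : ℝ⁺ → ℝ⁺
(x , 0<x) ⁻¹ = inverse , positive
  where
  0<U : ∀ {t} → U x t → 0ℚ ℚ.< t
  0<U Ut = let q , 0<q , Lq = 0<x in ℚ.<-trans 0<q (L<U x Lq Ut)

  inverse : ℝ
  inverse = record
    { L           = λ r → ∃[ t ] U x t × r ℚ.* t ℚ.< 1ℚ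
    ; U           = λ r → ∃[ s ] 0ℚ ℚ.< s × L x s × 1ℚ ℚ.< r ℚ.* s
    ; L-inhabited = let t , Ut = U-inhabited x in
        0ℚ , t , Ut , subst (ℚ._< 1ℚ) (sym (ℚ.*-zeroˡ t)) 0<1
    ; U-inhabited =
        let s , 0<s , Ls = 0<x
            r , rs≡2 = divide (1ℚ ℚ.+ 1ℚ) 0<s
        in r , s , 0<s , Ls , subst (1ℚ ℚ.<_) (sym rs≡2) (p<p+q 1ℚ 0<1)
    ; L-down      = λ p<q (t , Ut , qt<1) →
        t , Ut , ℚ.<-trans (*-monoˡ-< (0<U Ut) p<q) qt<1
    ; U-up        = λ p<q (s , 0<s , Ls , 1<ps) →
        s , 0<s , Ls , ℚ.<-trans 1<ps (*-monoˡ-< 0<s p<q)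
    ; L-open      = λ {p} (t , Ut , pt<1) →
        let m , pt<m , m<1 = ℚ.<-dense pt<1
            q , qt≡m = divide m (0<U Ut)
        in q , *-cancelʳ-< (0<U Ut) (subst (p ℚ.* t ℚ.<_) (sym qt≡m) pt<m) ,
           t , Ut , subst (ℚ._< 1ℚ) (sym qt≡m) m<1
    ; U-open      = λ {q} (s , 0<s , Ls , 1<qs) →
        let m , 1<m , m<qs = ℚ.<-dense 1<qs
            p , ps≡m = divide m 0<s
        in p , *-cancelʳ-< 0<s (subst (ℚ._< q ℚ.* s) (sym ps≡m) m<qs) ,
           s , 0<s , Ls , subst (1ℚ ℚ.<_) (sym ps≡m) 1<m
    ; disjoint    = λ {q} (t , Ut , qt<1) (s , 0<s , Ls , 1<qs) →
        let 0<q : 0ℚ ℚ.< q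
            0<q = *-cancelʳ-< 0<s (subst (ℚ._< q ℚ.* s) (sym (ℚ.*-zeroˡ s)) (ℚ.<-trans 0<1 1<qs))
        in ℚ.<-asym (ℚ.<-trans qt<1 1<qs) (ℚ.*-monoʳ-<-pos q {{ℚ.positive 0<q}} (L<U x Ls Ut))
    ; located     = λ {p} {q} p<q → case 0ℚ ℚ.<? p of λ where
        (no 0≮p)  → let t , Ut = U-inhabited x in inj₁ (t , Ut ,
          ℚ.≤-<-trans (subst (p ℚ.* t ℚ.≤_) (ℚ.*-zeroˡ t)
            (ℚ.*-monoʳ-≤-nonNeg t {{ℚ.nonNegative (ℚ.<⇒≤ (0<U Ut))}} (ℚ.≮⇒≥ 0≮p))) 0<1)
        (yes 0<p) → bothPositive 0<p p<q
    }
    where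
    bothPositive : ∀ {p q} → 0ℚ ℚ.< p → p ℚ.< q →
      (∃[ t ] U x t × p ℚ.* t ℚ.< 1ℚ) ⊎ (∃[ s ] 0ℚ ℚ.< s × L x s × 1ℚ ℚ.< q ℚ.* s)
    bothPositive {p} {q} 0<p p<q = Sum.[ inj₂ ∘ above , inj₁ ∘ below ]′ (located x 1/q<1/p)
      where
      0<q = ℚ.<-trans 0<p p<q
      1/p = proj₁ (divide 1ℚ 0<p)
      1/q = proj₁ (divide 1ℚ 0<q)
      1/p*p = proj₂ (divide 1ℚ 0<p)
      1/q*q = proj₂ (divide 1ℚ 0<q)
      0<1/p : 0ℚ ℚ.< 1/p
      0<1/p = *-cancelʳ-< 0<p (subst₂ ℚ._<_ (sym (ℚ.*-zeroˡ p)) (sym 1/p*p) 0<1)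
      0<1/q : 0ℚ ℚ.< 1/q
      0<1/q = *-cancelʳ-< 0<q (subst₂ ℚ._<_ (sym (ℚ.*-zeroˡ q)) (sym 1/q*q) 0<1)
      1/q<1/p : 1/q ℚ.< 1/p
      1/q<1/p = *-cancelʳ-< 0<q (subst₂ ℚ._<_ (trans 1/p*p (sym 1/q*q)) refl
        (ℚ.*-monoʳ-<-pos 1/p {{ℚ.positive 0<1/p}} p<q))
      above : L x 1/q → ∃[ s ] 0ℚ ℚ.< s × L x s × 1ℚ ℚ.< q ℚ.* s
      above L1/q = let s , 1/q<s , Ls = L-open x L1/q in
        s , ℚ.<-trans 0<1/q 1/q<s , Ls ,
        subst₂ ℚ._<_ 1/q*q (ℚ.*-comm s q) (*-monoˡ-< 0<q 1/q<s)
      below : U x 1/p → ∃[ t ] U x t × p ℚ.* t ℚ.< 1ℚ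
      below U1/p = let t , t<1/p , Ut = U-open x U1/p in
        t , Ut , subst₂ ℚ._<_ (ℚ.*-comm t p) 1/p*p (*-monoˡ-< 0<p t<1/p)

  positive : 0ℝ < inverse
  positive =
    let t , Ut = U-inhabited x
        r , rt≡½ = divide ½ (0<U Ut)
    in r , *-cancelʳ-< (0<U Ut) (subst₂ ℚ._<_ (sym (ℚ.*-zeroˡ t)) (sym rt≡½) 0<½) ,
       t , Ut , subst (ℚ._< 1ℚ) (sym rt≡½) ½<1

-- For x ≥ 1 and y > 0 the rationals below x ^ y are those below some
-- s ^ (a / b) with s < x and a / b < y, and dually from above.  The inequality
-- r < s ^ (a / b) is expressed as r ^ b < s ^ a (or r < 0).
module Power (x y : ℝ) where

  record Below (r : ℚ) : Set where
    constructor below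
    field
      s      : ℚ
      a b-1  : ℕ
      0<s    : 0ℚ ℚ.< s
      s<x    : L x s
      a/b<y  : L y (+ a ℚ./ suc b-1)
      r^b<s^a : r ^ℚ suc b-1 ℚ.< s ^ℚ a

  record Above (r : ℚ) : Set where
    constructor above
    field
      t      : ℚ
      a b-1  : ℕ
      0<r    : 0ℚ ℚ.< r
      x<t    : U x t
      y<a/b  : U y (+ a ℚ./ suc b-1)
      t^a<r^b : t ^ℚ a ℚ.< r ^ℚ suc b-1

  Lower Upper : ℚ → Set
  Lower r = r ℚ.< 0ℚ ⊎ Below r
  Upper r = Above r

_^_ : ℝ≥1 → ℝ⁺ → ℝ⁺
(x , 1≤x) ^ (y , 0<y) = power , positive
  where
  open Power x y

  Ly0 : L y 0ℚ
  Ly0 = let q , 0<q , Lq = 0<y in L-down y 0<q Lq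

  1≤U : ∀ {t} → U x t → 1ℚ ℚ.≤ t
  1≤U {t} Ut = ℚ.≮⇒≥ λ t<1 → 1≤x (t , Ut , t<1)

  Lx½ : L x ½
  Lx½ = Sum.[ (λ L½ → L½) , (λ U1 → let t , t<1 , Ut = U-open x U1 in ⊥-elim (1≤x (t , Ut , t<1))) ]′
    (located x ½<1)

  below½ : Below ½
  below½ = below ½ 0 0 0<½ Lx½ Ly0 ½<1

  down : ∀ {p q} → p ℚ.< q → Lower q → Lower p
  down p<q (inj₁ q<0) = inj₁ (ℚ.<-trans p<q q<0)
  down {p} p<q (inj₂ (below s a b-1 0<s s<x a/b<y lt)) = case p ℚ.<? 0ℚ of λ where
    (yes p<0) → inj₁ p<0
    (no  p≮0) → inj₂ (below s a b-1 0<s s<x a/b<y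
      (ℚ.≤-<-trans (^-mono-≤ (suc b-1) (ℚ.≮⇒≥ p≮0) (ℚ.<⇒≤ p<q)) lt))

  up : ∀ {p q} → p ℚ.< q → Upper p → Upper q
  up p<q (above t a b-1 0<p x<t y<a/b lt) = above t a b-1 (ℚ.<-trans 0<p p<q) x<t y<a/b
    (ℚ.<-≤-trans lt (^-mono-≤ (suc b-1) (ℚ.<⇒≤ 0<p) (ℚ.<⇒≤ p<q)))

  lowerOpen : ∀ {p} → Lower p → ∃[ q ] p ℚ.< q × Lower q
  lowerOpen (inj₁ p<0) = let q , p<q , q<0 = ℚ.<-dense p<0 in q , p<q , inj₁ q<0
  lowerOpen {p} (inj₂ (below s a b-1 0<s s<x a/b<y lt)) = case p ℚ.<? 0ℚ of λ where
    (yes p<0) → let q , p<q , q<0 = ℚ.<-dense p<0 in q , p<q , inj₁ q<0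
    (no  p≮0) → let q , p<q , lt′ = ^-cont-up (suc b-1) (ℚ.≮⇒≥ p≮0) lt in
      q , p<q , inj₂ (below s a b-1 0<s s<x a/b<y lt′)

  upperOpen : ∀ {q} → Upper q → ∃[ p ] p ℚ.< q × Upper p
  upperOpen (above t a b-1 0<q x<t y<a/b lt) =
    let p , 0<p , p<q , lt′ = ^-cont-down (suc b-1) 0<q lt in
    p , p<q , above t a b-1 0<p x<t y<a/b lt′

  upperInhabited : ∃ Upper
  upperInhabited = choose (U-inhabited x) (grid y {δ = 1ℚ} 0<1 Ly0)
    where
    choose : ∃ (U x) → _ → ∃ Upper
    choose (t , Ut) (k , _ , Uk) = r ,
      above t a 0 (ℚ.<-trans (^-pos a 0<t) t^a<r) Ut (subst (U y) 0+n*1≡n Uk)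
        (subst (t ^ℚ a ℚ.<_) (sym (ℚ.*-identityʳ r)) t^a<r)
      where
      a = 2 ℕ.+ k
      0<t = ℚ.<-≤-trans 0<1 (1≤U Ut)
      r = t ^ℚ a ℚ.+ 1ℚ
      t^a<r : t ^ℚ a ℚ.< r
      t^a<r = p<p+q (t ^ℚ a) 0<1
      0+n*1≡n : 0ℚ ℚ.+ fromℕ a ℚ.* 1ℚ ≡ fromℕ a
      0+n*1≡n = trans (ℚ.+-identityˡ (fromℕ a ℚ.* 1ℚ)) (ℚ.*-identityʳ (fromℕ a))

  separate : ∀ {q} → Lower q → Upper q → ⊥
  separate (inj₁ q<0) A = ℚ.<-asym q<0 (Above.0<r A)
  separate {q} (inj₂ (below s a b-1 0<s s<x a/b<y lt)) (above t c d-1 0<q x<t y<c/d gt) =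
    ℚ.<-irrefl refl (begin-strict
      q ^ℚ (b ℕ.* d)      ≡⟨ ^-* q b d ⟨
      (q ^ℚ b) ^ℚ d       <⟨ ^-mono-< d-1 (^-nonNeg b (ℚ.<⇒≤ 0<q)) lt ⟩
      (s ^ℚ a) ^ℚ d       ≡⟨ ^-* s a d ⟩
      s ^ℚ (a ℕ.* d)      ≤⟨ ^-mono-≤ (a ℕ.* d) (ℚ.<⇒≤ 0<s) (ℚ.<⇒≤ (L<U x s<x x<t)) ⟩
      t ^ℚ (a ℕ.* d)      ≤⟨ ^-monoʳ-≤ (1≤U x<t) (ℕ.<⇒≤ (/-drop-< a b-1 c d-1 (L<U y a/b<y y<c/d))) ⟩
      t ^ℚ (c ℕ.* b)      ≡⟨ ^-* t c b ⟨
      (t ^ℚ c) ^ℚ b       <⟨ ^-mono-< b-1 (^-nonNeg c (ℚ.≤-trans (ℚ.<⇒≤ 0<1) (1≤U x<t))) gt ⟩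
      (q ^ℚ d) ^ℚ b       ≡⟨ ^-* q d b ⟩
      q ^ℚ (d ℕ.* b)      ≡⟨ cong (q ^ℚ_) (ℕ.*-comm d b) ⟩
      q ^ℚ (b ℕ.* d)      ∎)
    where
    open ℚ.≤-Reasoning
    b = suc b-1
    d = suc d-1

  -- Let T bound x from above, let b be so large that T² p ^ b < q ^ b, take
  -- a / b < y < (a + 2) / b and then s < x < t ≤ T close enough together.
  locate⁺ : ∀ {p q} → 0ℚ ℚ.< p → p ℚ.< q → Lower p ⊎ Upper q
  locate⁺ {p} {q} 0<p p<q = chooseT (U-inhabited x)
    where
    module _ (T : ℚ) (UT : U x T) (b-1 : ℕ)
             (gap : T ℚ.* T ℚ.* p ^ℚ suc b-1 ℚ.< q ^ℚ suc b-1)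
             (a : ℕ) (a/b<y : L y (+ a ℚ./ suc b-1)) (y<a+2/b : U y (+ (2 ℕ.+ a) ℚ./ suc b-1)) where
      open ℚ.≤-Reasoning
      b = suc b-1
      0≤T : 0ℚ ℚ.≤ T
      0≤T = ℚ.≤-trans (ℚ.<⇒≤ 0<1) (1≤U UT)
      M = lip T (2 ℕ.+ a)
      compare : ∀ {δ s t} → δ ℚ.* M ℚ.< q ^ℚ b ℚ.- T ℚ.* T ℚ.* p ^ℚ b →
                L x s → U x t → ½ ℚ.≤ s → t ℚ.≤ T → t ℚ.- s ℚ.≤ δ → Lower p ⊎ Upper q
      compare {δ} {s} {t} δM<ε Ls Ut ½≤s t≤T t-s≤δ = case p ^ℚ b ℚ.<? s ^ℚ a of λ where
          (yes lt) → inj₁ (inj₂ (below s a b-1 0<s Ls a/b<y lt))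
          (no ≮)   → inj₂ (above t (2 ℕ.+ a) b-1 (ℚ.<-trans 0<p p<q) Ut y<a+2/b (begin-strict
            t ^ℚ (2 ℕ.+ a)
              ≤⟨ ^-lipschitz (2 ℕ.+ a) (ℚ.<⇒≤ 0<s) s≤t t≤T ⟩
            s ℚ.* (s ℚ.* s ^ℚ a) ℚ.+ (t ℚ.- s) ℚ.* M
              ≡⟨ cong (ℚ._+ (t ℚ.- s) ℚ.* M) (ℚ.*-assoc s s (s ^ℚ a)) ⟨
            s ℚ.* s ℚ.* s ^ℚ a ℚ.+ (t ℚ.- s) ℚ.* M
              ≤⟨ ℚ.+-mono-≤
                   (*-mono-≤ (^-nonNeg a (ℚ.<⇒≤ 0<s)) (*-nonNeg 0≤T 0≤T)
                     (*-mono-≤ (ℚ.<⇒≤ 0<s) 0≤T s≤T s≤T) (ℚ.≮⇒≥ ≮))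
                   (ℚ.*-monoʳ-≤-nonNeg M {{ℚ.nonNegative (lip-nonNeg (2 ℕ.+ a) 0≤T)}} t-s≤δ) ⟩
            T ℚ.* T ℚ.* p ^ℚ b ℚ.+ δ ℚ.* M
              <⟨ +-cancel-< δM<ε ⟩
            q ^ℚ b ∎))
        where
        0<s : 0ℚ ℚ.< s
        0<s = ℚ.<-≤-trans 0<½ ½≤s
        s≤t : s ℚ.≤ t
        s≤t = ℚ.<⇒≤ (L<U x Ls Ut)
        s≤T : s ℚ.≤ T
        s≤T = ℚ.≤-trans s≤t t≤T

      finish : Lower p ⊎ Upper q
      finish =
        let δ , 0<δ , _ , δM<ε = small (<⇒0<- gap) (lip-nonNeg (2 ℕ.+ a) 0≤T)
            s , t , Ls , Ut , ½≤s , t≤T , t-s≤δ = approx x 0<δ Lx½ UT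
        in compare δM<ε Ls Ut ½≤s t≤T t-s≤δ

    chooseT : ∃ (U x) → Lower p ⊎ Upper q
    chooseT (T , UT) =
      let b-1 , gap = ^-gap (T ℚ.* T) 0<p p<q
          k , Lk , Uk = grid y (/-pos 0 b-1) Ly0
      in finish T UT b-1 gap k
           (subst (L y) (multiple k b-1) Lk)
           (subst (U y) (multiple (2 ℕ.+ k) b-1) Uk)
      where
      multiple : ∀ k d → 0ℚ ℚ.+ fromℕ k ℚ.* (+ 1 ℚ./ suc d) ≡ + k ℚ./ suc d
      multiple k d = trans (ℚ.+-identityˡ (fromℕ k ℚ.* (+ 1 ℚ./ suc d))) (k*1/d k d)

  locate : ∀ {p q} → p ℚ.< q → Lower p ⊎ Upper q
  locate {p} {q} p<q = case p ℚ.<? 0ℚ of λ where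
    (yes p<0) → inj₁ (inj₁ p<0)
    (no  p≮0) →
      let m , p<m , m<q = ℚ.<-dense p<q in
      Sum.map₁ (down p<m) (locate⁺ (ℚ.≤-<-trans (ℚ.≮⇒≥ p≮0) p<m) m<q)

  power : ℝ
  power = record
    { L           = Lower
    ; U           = Upper
    ; L-inhabited = ½ , inj₂ below½
    ; U-inhabited = upperInhabited
    ; L-down      = down
    ; U-up        = up
    ; L-open      = lowerOpen
    ; U-open      = upperOpen
    ; disjoint    = separate
    ; located     = locate
    }

  positive : 0ℝ < power
  positive = ½ , 0<½ , inj₂ below½

Converges : (ℕ → ℝ) → ℝ → Set₁
Converges x l = (ε : ℝ) → 0ℝ < ε → ∃[ N ] ∀ n → N ℕ.≤ n → ∣ x n - l ∣ < ε

IsLeast : (ℝ → Set₁) → ℝ → Set₁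
IsLeast P m = P m × (∀ x → P x → m ≤ x)

-- Pairs of integers p, q with q ≥ q(ε) > 0 or q > C > 0 have q positive, so
-- denominators range over non-zero natural numbers throughout.

Irrational : ℝ → Set
Irrational α = ∀ r → ¬ (α ≈ fromℚ r)

distance : ℝ → (p : ℤ) (q : ℕ) .{{_ : NonZero q}} → ℝ
distance α p q = ∣ α - fromℚ (p ℚ./ q) ∣

ExponentBound : ℝ → ℝ → Set₁
ExponentBound α μ = Σ[ 0<μ ∈ 0ℝ < μ ] ((ε : ℝ⁺) →
  Σ[ q₀ ∈ ℕ ] 0 ℕ.< q₀ × ((p : ℤ) (q : ℕ) .{{_ : NonZero q}} → q₀ ℕ.≤ q →
    proj₁ ((fromℕ≥1 q ^ ((μ , 0<μ) +⁺ ε)) ⁻¹) < distance α p q))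

IrrationalityExponent : ℝ → ℝ → Set₁
IrrationalityExponent α μ = Irrational α × IsLeast (ExponentBound α) μ

BaseBound : ℝ → ℝ → Set₁
BaseBound α β = Σ[ 1≤β ∈ 1ℝ ≤ β ] ((ε : ℝ⁺) →
  Σ[ q₀ ∈ ℕ ] 0 ℕ.< q₀ × ((p : ℤ) (q : ℕ) .{{_ : NonZero q}} → q₀ ℕ.≤ q →
    proj₁ ((((β , 1≤β) +¹ ε) ^ ≥1⇒⁺ (fromℕ≥1 q)) ⁻¹) < distance α p q))

IrrationalityBase : ℝ → ℝ → Set₁
IrrationalityBase α β = IsLeast (BaseBound α) β

ApproximableToOrder : (ℝ≥1 → ℝ⁺) → ℝ → Set₁
ApproximableToOrder ω θ = (C : ℝ) → 0ℝ < C →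
  Σ[ p ∈ ℤ ] Σ[ q ∈ ℕ ] Σ[ q≢0 ∈ NonZero q ] let instance _ = q≢0 in
    C < fromℚ (fromℕ q) × distance θ p q < proj₁ (ω (fromℕ≥1 q))

-- x ↦ β ^ (- x)
exponentialOrder : (β : ℝ) → 1ℝ < β → ℝ≥1 → ℝ⁺
exponentialOrder β 1<β x = ((β , <⇒≤ {1ℝ} {β} 1<β) ^ ≥1⇒⁺ x) ⁻¹

-- x ↦ x ^ (- μ)
powerOrder : (μ : ℝ) → 0ℝ < μ → ℝ≥1 → ℝ⁺
powerOrder μ 0<μ x = (x ^ (μ , 0<μ)) ⁻¹

-- A sequence b 0, b 1, … of positive integers stands for the continued
-- fraction [0; b₁, b₂, …] with bₙ₊₁ = b n.

PartialQuotients : Set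
PartialQuotients = Σ[ b ∈ (ℕ → ℕ) ] (∀ n → NonZero (b n))

finite : PartialQuotients → ℕ → Σ ℚ NonNegative
finite b zero = 0ℚ , _
finite (b , b≢0) (suc n) =
  let r , r≥0 = finite (b ∘ suc , b≢0 ∘ suc) n
      s       = fromℕ (b 0) ℚ.+ r
      s>0     = ℚ.pos+nonNeg⇒pos (fromℕ (b 0)) {{ℚ.normalize-pos (b 0) 1 {{_}} {{b≢0 0}}}} r {{r≥0}}
      1/s     = (ℚ.1/ s) {{ℚ.pos⇒nonZero s {{s>0}}}}
  in 1/s , ℚ.pos⇒nonNeg 1/s {{ℚ.1/pos⇒pos s {{s>0}}}}

-- The finite continued fraction [0; b₁, …, bₙ].
convergent : PartialQuotients → ℕ → ℚ
convergent b n = proj₁ (finite b n)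

-- ℚ is the type of fractions in lowest terms with positive denominator.
convergentDenominator : PartialQuotients → ℕ → ℕ
convergentDenominator b n = ↧ₙ (convergent b n)

_IsContinuedFraction_ : ℝ → PartialQuotients → Set₁
θ IsContinuedFraction b = Converges (λ n → fromℚ (convergent b n)) θ

-- bₙ₊₁ ω(qₙ) qₙ²
growth : (ℝ≥1 → ℝ⁺) → PartialQuotients → ℕ → ℝ
growth ω (b , b≢0) n = (b n ℕ.* (q ℕ.* q)) · proj₁ (ω (fromℕ≥1 q))
  where
  q = convergentDenominator (b , b≢0) n
  instance
    bn≢0 : NonZero (b n)
    bn≢0 = b≢0 n
    product≢0 : NonZero (b n ℕ.* (q ℕ.* q))
    product≢0 = ℕ.m*n≢0 (b n) (q ℕ.* q)

GrowthCondition : (ℝ≥1 → ℝ⁺) → PartialQuotients → Set₁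
GrowthCondition ω b = (∀ n → 1ℝ < growth ω b n) × Converges (growth ω b) 1ℝ

{-# OPTIONS --safe #-}
module Submission where

-- Write xₙ = pₙ / qₙ for the convergents, ω = 1 / V and kₙ = bₙ₊₁ qₙ², so that the growth
-- condition reads V(qₙ) < kₙ and kₙ / V(qₙ) → 1.  From |θ - xₙ| ≤ 1 / (qₙ qₙ₊₁) ≤ 1 / kₙ one gets
-- |θ - xₙ| < ω(qₙ), which gives approximability and excludes every smaller base or exponent.
-- For a lower bound on |θ - p / q| choose n with qₙ ≤ 2 q < qₙ₊₁.  If p / q ≠ xₙ, then
-- |p / q - xₙ| ≥ 1 / (q qₙ) is at least twice |θ - xₙ|, so |θ - p / q| ≥ 1 / (8 q²).  If p / q = xₙ,
-- then qₙ ≤ q and |θ - xₙ| ≥ |xₙ - xₙ₊₁| - |θ - xₙ₊₁| ≥ 1 / (2 qₙ qₙ₊₁) > 1 / (8 kₙ) > ω(qₙ) / 16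
-- for large n.  Both bounds exceed the order with base β + ε or exponent μ + ε once q is large,
-- and a lower bound of this kind makes θ irrational.
-- Since V(q) / q² → ∞, choosing bₙ₊₁ within 2 above V(qₙ) / qₙ² meets the growth condition.

open import Defs
open RationalLemmas
open import Algebra.Bundles using (CommutativeRing)
open import Data.Empty using (⊥; ⊥-elim)
open import Data.Integer as ℤ using (ℤ; +_)
open import Data.Integer.GCD using (gcd)
import Data.Integer.Properties as ℤ
import Data.Integer.Solver as ℤ
open import Data.Nat as ℕ using (ℕ; zero; suc; NonZero)
open import Data.Nat.Coprimality using (Coprime)
open import Data.Nat.Divisibility using (∣m+n∣m⇒∣n; ∣n⇒∣m*n; ∣1⇒≡1; divides; ∣⇒≤)
import Data.Nat.Properties as ℕ
import Data.Nat.Solver as ℕ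
open import Data.Product using (∃; Σ-syntax; ∃-syntax; _×_; _,_; proj₁; proj₂)
open import Data.Rational as ℚ using (ℚ; 0ℚ; 1ℚ; ½; ↥_; ↧_; ↧ₙ_)
import Data.Rational.Properties as ℚ
open import Data.Rational.Solver using (module +-*-Solver)
open import Data.Rational.Unnormalised as ℚᵘ using (mkℚᵘ)
import Data.Rational.Unnormalised.Properties as ℚᵘ
open import Data.Sum as Sum using (_⊎_; inj₁; inj₂)
open import Function using (case_of_; _∘_)
open import Relation.Binary.Definitions using (tri<; tri≈; tri>)
open import Relation.Binary.PropositionalEquality
  using (_≡_; refl; sym; trans; cong; cong₂; subst; subst₂; module ≡-Reasoning)
open import Relation.Nullary using (¬_; yes; no)

open import Algebra.Properties.CommutativeSemiring.Exp
  (CommutativeRing.commutativeSemiring ℚ.+-*-commutativeRing) using () renaming (^-distrib-* to ^ℚ-distrib-*)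
import Algebra.Solver.Ring.NaturalCoefficients.Default
  (CommutativeRing.commutativeSemiring ℚ.+-*-commutativeRing) as ℕCoefficients

-- Distances and reciprocals as cuts

-- Both halves are one argument about an abstract V, fed with three facts: V(n) eventually exceeds
-- every multiple of n²; the order V′ with an added ε eventually exceeds T V for every constant T;
-- the order of a smaller base or exponent, with a small ε added, stays below V. As T is arbitrary,
-- constant factors are harmless and the estimates are kept crude. Two obstacles shape the details.
-- First, cuts have no decidable order, so every comparison passes through rational witnesses: V(q)
-- < k is membership of k in an upper cut, and distances are compared with 1 / m for natural m.
-- Likewise the integer part of V(q) / q² cannot be decided; locatedness only places V(q) between
-- two multiples of q² that are two steps apart, which is the origin of the 2 in the construction.
-- Second, p / q need not be reduced. A fraction equal to xₙ may have q much larger than qₙ, so V at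
-- qₙ has to be compared with V′ at q, not at the same argument.

0<-⇒< : ∀ {p q} → 0ℚ ℚ.< q ℚ.- p → p ℚ.< q
0<-⇒< {p} {q} 0<q-p = subst₂ ℚ._<_ (ℚ.+-identityʳ p) (sym (split p q)) (ℚ.+-monoʳ-< p 0<q-p)

-- Reduces a linear rearrangement of a strict inequality to a ring identity, which the solver
-- settles.
<-transport : ∀ {p q r s} → q ℚ.- p ≡ s ℚ.- r → p ℚ.< q → r ℚ.< s
<-transport eq p<q = 0<-⇒< (subst (0ℚ ℚ.<_) eq (<⇒0<- p<q))

module _ (θ : ℝ) where

  -- A sum of cuts demands strict slack in both summands; openness of θ creates it and density
  -- divides it.
  L-translate : ∀ {c r} → L θ (c ℚ.+ r) → L (θ - fromℚ c) r
  L-translate {c} {r} Lθ =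
    let s , c+r<s , Ls = L-open θ Lθ
        t , r-s<t , t<-c = ℚ.<-dense (<-transport (eq c r s) c+r<s)
    in s , t , Ls , p<-q⇒q<-p t<-c , <-transport (eq′ r s t) r-s<t
    where
    open +-*-Solver
    eq : ∀ c r s → s ℚ.- (c ℚ.+ r) ≡ ℚ.- c ℚ.- (r ℚ.- s)
    eq = solve 3 (λ c r s → s :- (c :+ r) := :- c :- (r :- s)) refl
    eq′ : ∀ r s t → t ℚ.- (r ℚ.- s) ≡ s ℚ.+ t ℚ.- r
    eq′ = solve 3 (λ r s t → t :- (r :- s) := s :+ t :- r) refl

  U-translate : ∀ {c r} → U θ (c ℚ.+ r) → U (θ - fromℚ c) r
  U-translate {c} {r} Uθ =
    let s , s<c+r , Us = U-open θ Uθ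
        t , -c<t , t<r-s = ℚ.<-dense (<-transport {s = r ℚ.- s} (eq c r s) s<c+r)
    in s , t , Us , -p<q⇒-q<p -c<t , <-transport (eq′ r s t) t<r-s
    where
    open +-*-Solver
    eq : ∀ c r s → c ℚ.+ r ℚ.- s ≡ r ℚ.- s ℚ.- (ℚ.- c)
    eq = solve 3 (λ c r s → c :+ r :- s := r :- s :- (:- c)) refl
    eq′ : ∀ r s t → r ℚ.- s ℚ.- t ≡ r ℚ.- (s ℚ.+ t)
    eq′ = solve 3 (λ r s t → r :- s :- t := r :- (s :+ t)) refl

  L-untranslate : ∀ {c r} → L (θ - fromℚ c) r → L θ (c ℚ.+ r)
  L-untranslate {c} {r} (s , t , Ls , c<-t , r<s+t) = L-down θ
    (<-transport (eq c r s t) (ℚ.+-mono-< c<-t r<s+t)) Ls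
    where
    open +-*-Solver
    eq : ∀ c r s t → ℚ.- t ℚ.+ (s ℚ.+ t) ℚ.- (c ℚ.+ r) ≡ s ℚ.- (c ℚ.+ r)
    eq = solve 4 (λ c r s t → :- t :+ (s :+ t) :- (c :+ r) := s :- (c :+ r)) refl

  U-untranslate : ∀ {c r} → U (θ - fromℚ c) r → U θ (c ℚ.+ r)
  U-untranslate {c} {r} (s , t , Us , -t<c , s+t<r) = U-up θ
    (<-transport (eq c r s t) (ℚ.+-mono-< -t<c s+t<r)) Us
    where
    open +-*-Solver
    eq : ∀ c r s t → c ℚ.+ r ℚ.- (ℚ.- t ℚ.+ (s ℚ.+ t)) ≡ c ℚ.+ r ℚ.- s
    eq = solve 4 (λ c r s t → c :+ r :- (:- t :+ (s :+ t)) := c :+ r :- s) refl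

  U-distance : ∀ {c r} → L θ (c ℚ.- r) → U θ (c ℚ.+ r) → U ∣ θ - fromℚ c ∣ r
  U-distance Lθ Uθ = U-translate Uθ , L-translate Lθ

  L-distance : ∀ {c r} → L θ (c ℚ.+ r) ⊎ U θ (c ℚ.- r) → L ∣ θ - fromℚ c ∣ r
  L-distance = Sum.map L-translate U-translate

  L-distance⁻¹ : ∀ {c r} → L ∣ θ - fromℚ c ∣ r → L θ (c ℚ.+ r) ⊎ U θ (c ℚ.- r)
  L-distance⁻¹ = Sum.map L-untranslate U-untranslate

  -- `distance` subtracts the rational from θ, whereas `Converges` subtracts θ from the rational
  -- convergent, so both orders occur.
  U-distance′ : ∀ {c r} → L θ (c ℚ.- r) → U θ (c ℚ.+ r) → U ∣ fromℚ c - θ ∣ r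
  U-distance′ {c} {r} Lθ Uθ =
    (let v , c-r<v , Lv = L-open θ Lθ
         s , c<s , s<r+v = ℚ.<-dense (<-transport {s = r ℚ.+ v} (eq₁ c r v) c-r<v)
     in s , ℚ.- v , c<s , subst (L θ) (sym (neg-neg v)) Lv , <-transport (eq₂ r s v) s<r+v) ,
    (let v , v<c+r , Uv = U-open θ Uθ
         s , v-r<s , s<c = ℚ.<-dense (<-transport (eq₃ c r v) v<c+r)
     in s , ℚ.- v , s<c , subst (U θ) (sym (neg-neg v)) Uv , <-transport (eq₄ r s v) v-r<s)
    where
    open +-*-Solver
    eq₁ : ∀ c r v → v ℚ.- (c ℚ.- r) ≡ r ℚ.+ v ℚ.- c
    eq₁ = solve 3 (λ c r v → v :- (c :- r) := r :+ v :- c) refl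
    eq₂ : ∀ r s v → r ℚ.+ v ℚ.- s ≡ r ℚ.- (s ℚ.- v)
    eq₂ = solve 3 (λ r s v → r :+ v :- s := r :- (s :- v)) refl
    eq₃ : ∀ c r v → c ℚ.+ r ℚ.- v ≡ c ℚ.- (v ℚ.- r)
    eq₃ = solve 3 (λ c r v → c :+ r :- v := c :- (v :- r)) refl
    eq₄ : ∀ r s v → s ℚ.- (v ℚ.- r) ≡ s ℚ.- v ℚ.- (ℚ.- r)
    eq₄ = solve 3 (λ r s v → s :- (v :- r) := s :- v :- (:- r)) refl

  U-distance′⁻¹ : ∀ {c r} → U ∣ fromℚ c - θ ∣ r → L θ (c ℚ.- r) × U θ (c ℚ.+ r)
  U-distance′⁻¹ {c} {r} ((s , t , c<s , Lt , s+t<r) , (s′ , t′ , s′<c , Ut′ , -r<s′+t′)) =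
    L-down θ (<-transport (eq₁ c r s t) (ℚ.+-mono-< c<s s+t<r)) Lt ,
    U-up θ (<-transport (eq₂ c r s′ t′) (ℚ.+-mono-< s′<c -r<s′+t′)) Ut′
    where
    open +-*-Solver
    eq₁ : ∀ c r s t → s ℚ.+ r ℚ.- (c ℚ.+ (s ℚ.+ t)) ≡ ℚ.- t ℚ.- (c ℚ.- r)
    eq₁ = solve 4 (λ c r s t → s :+ r :- (c :+ (s :+ t)) := :- t :- (c :- r)) refl
    eq₂ : ∀ c r s t → c ℚ.+ (s ℚ.+ t) ℚ.- (s ℚ.+ (ℚ.- r)) ≡ c ℚ.+ r ℚ.- (ℚ.- t)
    eq₂ = solve 4 (λ c r s t → c :+ (s :+ t) :- (s :+ (:- r)) := c :+ r :- (:- t)) refl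

1/ℕ : (k : ℕ) .{{_ : NonZero k}} → ℚ
1/ℕ k = + 1 ℚ./ k

fromℕ-pos : ∀ k .{{_ : NonZero k}} → 0ℚ ℚ.< fromℕ k
fromℕ-pos k = ℚ.<-≤-trans 0<1 (1≤fromℕ k)

U⇒pos : (x : ℝ⁺) → ∀ {t} → U (proj₁ x) t → 0ℚ ℚ.< t
U⇒pos (x , _ , 0<q , Lq) Ut = ℚ.<-trans 0<q (L<U x Lq Ut)

U⇒≥1 : (x : ℝ≥1) → ∀ {t} → U (proj₁ x) t → 1ℚ ℚ.≤ t
U⇒≥1 (x , 1≤x) {t} Ut = ℚ.≮⇒≥ λ t<1 → 1≤x (t , Ut , t<1)

module _ (k : ℕ) .{{_ : NonZero k}} (X : ℝ⁺) where

  private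
    K = fromℕ k
    instance
      K≢0 : ℚ.NonZero K
      K≢0 = ℚ.>-nonZero (fromℕ-pos k)
    1/K = ℚ.1/ K
    assoc : ∀ r t → r ℚ.* 1/K ℚ.* t ℚ.* K ≡ r ℚ.* t
    assoc r t = trans (eq r 1/K t K) (trans (cong (r ℚ.* t ℚ.*_) (ℚ.*-inverseˡ K)) (ℚ.*-identityʳ (r ℚ.* t)))
      where
      eq : ∀ r i t k → r ℚ.* i ℚ.* t ℚ.* k ≡ r ℚ.* t ℚ.* (i ℚ.* k)
      eq = let open ℕCoefficients in solve 4 (λ r i t k → r :* i :* t :* k := r :* t :* (i :* k)) refl

  -- Clears the reciprocal. With the next three lemmas, the growth condition can be used and proved
  -- as a comparison of k with V(q).
  1<k·X⁻¹⇒X<k : 1ℝ < k · proj₁ (X ⁻¹) → U (proj₁ X) K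
  1<k·X⁻¹⇒X<k (r , 1<r , t , Ut , lt) = U-up (proj₁ X) (ℚ.<-trans t<rt rt<K) Ut
    where
    t<rt : t ℚ.< r ℚ.* t
    t<rt = subst (ℚ._< r ℚ.* t) (ℚ.*-identityˡ t) (*-monoˡ-< (U⇒pos X Ut) 1<r)
    rt<K : r ℚ.* t ℚ.< K
    rt<K = subst₂ ℚ._<_ (assoc r t) (ℚ.*-identityˡ K) (*-monoˡ-< (fromℕ-pos k) lt)

  X<k⇒1<k·X⁻¹ : U (proj₁ X) K → 1ℝ < k · proj₁ (X ⁻¹)
  X<k⇒1<k·X⁻¹ UK =
    let t , t<K , Ut = U-open (proj₁ X) UK
        m , t<m , m<K = ℚ.<-dense t<K
        r , rt≡m = divide m (U⇒pos X Ut)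
    in r , *-cancelʳ-< (U⇒pos X Ut) (subst₂ ℚ._<_ (sym (ℚ.*-identityˡ t)) (sym rt≡m) t<m) ,
       t , Ut , *-cancelʳ-< (fromℕ-pos k) (subst₂ ℚ._<_ (sym (trans (assoc r t) rt≡m)) (sym (ℚ.*-identityˡ K)) m<K)

  U-k·X⁻¹ : ∀ {r s} → 0ℚ ℚ.< s → L (proj₁ X) s → K ℚ.< r ℚ.* s → U (k · proj₁ (X ⁻¹)) r
  U-k·X⁻¹ {r} {s} 0<s Ls K<rs = s , 0<s , Ls ,
    *-cancelʳ-< (fromℕ-pos k) (subst₂ ℚ._<_ (sym (ℚ.*-identityˡ K)) (sym (assoc r s)) K<rs)

  U-k·X⁻¹⁻¹ : ∀ {r} → U (k · proj₁ (X ⁻¹)) r → ∃[ s ] L (proj₁ X) s × K ℚ.< r ℚ.* s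
  U-k·X⁻¹⁻¹ {r} (s , 0<s , Ls , lt) = s , Ls ,
    subst₂ ℚ._<_ (ℚ.*-identityˡ K) (assoc r s) (*-monoˡ-< (fromℕ-pos k) lt)

-- Non-strict comparison of a rational with a cut. `Power` accepts strict rational bounds only; here
-- a base or exponent that is exactly rational serves as its own bound on both sides.
_≤ᵁ_ : ℚ → ℝ → Set
s ≤ᵁ x = ∀ {t} → U x t → s ℚ.≤ t

_≥ᴸ_ : ℚ → ℝ → Set
t ≥ᴸ x = ∀ {s} → L x s → s ℚ.≤ t

L⇒≤ᵁ : ∀ x {s} → L x s → s ≤ᵁ x
L⇒≤ᵁ x Ls Ut = ℚ.<⇒≤ (L<U x Ls Ut)

U⇒≥ᴸ : ∀ x {t} → U x t → t ≥ᴸ x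
U⇒≥ᴸ x Ut Ls = ℚ.<⇒≤ (L<U x Ls Ut)

/-mono-≤ : ∀ i m j n .{{_ : NonZero m}} .{{_ : NonZero n}} →
           i ℤ.* + n ℤ.≤ j ℤ.* + m → i ℚ./ m ℚ.≤ j ℚ./ n
/-mono-≤ i m@(suc m-1) j n@(suc n-1) le = ℚ.toℚᵘ-cancel-≤
  (ℚᵘ.≤-respʳ-≃ (ℚᵘ.≃-sym (ℚ.toℚᵘ-fromℚᵘ (mkℚᵘ j n-1)))
    (ℚᵘ.≤-respˡ-≃ (ℚᵘ.≃-sym (ℚ.toℚᵘ-fromℚᵘ (mkℚᵘ i m-1))) (ℚᵘ.*≤* le)))

/-drop-≤ : ∀ i m j n .{{_ : NonZero m}} .{{_ : NonZero n}} →
           i ℚ./ m ℚ.≤ j ℚ./ n → i ℤ.* + n ℤ.≤ j ℤ.* + m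
/-drop-≤ i m@(suc m-1) j n@(suc n-1) le = ℚᵘ.drop-*≤*
  (ℚᵘ.≤-respʳ-≃ (ℚ.toℚᵘ-fromℚᵘ (mkℚᵘ j n-1))
    (ℚᵘ.≤-respˡ-≃ (ℚ.toℚᵘ-fromℚᵘ (mkℚᵘ i m-1)) (ℚ.toℚᵘ-mono-≤ le)))

/-drop-≤-ℕ : ∀ i m j n .{{_ : NonZero m}} .{{_ : NonZero n}} →
             + i ℚ./ m ℚ.≤ + j ℚ./ n → i ℕ.* n ℕ.≤ j ℕ.* m
/-drop-≤-ℕ i m j n le = ℤ.drop‿+≤+ (subst₂ ℤ._≤_ (sym (ℤ.pos-* i n)) (sym (ℤ.pos-* j m))
  (/-drop-≤ (+ i) m (+ j) n le))

-- Real powers bounded through rational bases and exponents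

module _ (x⁺ : ℝ≥1) (y⁺ : ℝ⁺) where

  private
    x = proj₁ x⁺
    y = proj₁ y⁺
    W = proj₁ (x⁺ ^ y⁺)

    ^-assoc-comm : ∀ q m n → (q ^ℚ m) ^ℚ n ≡ (q ^ℚ n) ^ℚ m
    ^-assoc-comm q m n = trans (^-* q m n) (trans (cong (q ^ℚ_) (ℕ.*-comm m n)) (sym (^-* q n m)))

  -- Locatedness reduces the claim to refuting W < r′ for some r′ > r that still satisfies the hypothesis.
  L-power : ∀ {r s} a b-1 → 0ℚ ℚ.< s → s ≤ᵁ x → (+ a ℚ./ suc b-1) ≤ᵁ y →
            0ℚ ℚ.≤ r → r ^ℚ suc b-1 ℚ.< s ^ℚ a → L W r
  L-power {r} {s} a b-1 0<s s≤x a/b≤y 0≤r r^b<s^a = choose (^-cont-up (suc b-1) 0≤r r^b<s^a)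
    where
    open ℚ.≤-Reasoning
    b = suc b-1
    contra : ∀ {r′} → 0ℚ ℚ.≤ r′ → r′ ^ℚ b ℚ.< s ^ℚ a → U W r′ → ⊥
    -- Passing to the power b d clears both exponent denominators, and a / b ≤ c / d becomes a d ≤ c
    -- b.
    contra {q} 0≤q lt (Power.above t c d-1 _ x<t y<c/d gt) = ℚ.<-irrefl refl (begin-strict
      (q ^ℚ b) ^ℚ d       <⟨ ^-mono-< d-1 (^-nonNeg b 0≤q) lt ⟩
      (s ^ℚ a) ^ℚ d       ≡⟨ ^-* s a d ⟩
      s ^ℚ (a ℕ.* d)      ≤⟨ ^-mono-≤ (a ℕ.* d) (ℚ.<⇒≤ 0<s) (s≤x x<t) ⟩
      t ^ℚ (a ℕ.* d)      ≤⟨ ^-monoʳ-≤ (U⇒≥1 x⁺ x<t) (/-drop-≤-ℕ a b c d (a/b≤y y<c/d)) ⟩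
      t ^ℚ (c ℕ.* b)      ≡⟨ ^-* t c b ⟨
      (t ^ℚ c) ^ℚ b       <⟨ ^-mono-< b-1 (^-nonNeg c (ℚ.≤-trans (ℚ.<⇒≤ 0<1) (U⇒≥1 x⁺ x<t))) gt ⟩
      (q ^ℚ d) ^ℚ b       ≡⟨ ^-assoc-comm q d b ⟩
      (q ^ℚ b) ^ℚ d       ∎)
      where d = suc d-1
    choose : _ → L W r
    choose (r′ , r<r′ , lt) = Sum.[ (λ Lr → Lr) ,
      (λ Ur′ → ⊥-elim (contra (ℚ.≤-trans 0≤r (ℚ.<⇒≤ r<r′)) lt Ur′)) ]′ (located W r<r′)

  U-power : ∀ {r t} a b-1 → 1ℚ ℚ.≤ t → t ≥ᴸ x → (+ a ℚ./ suc b-1) ≥ᴸ y →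
            0ℚ ℚ.< r → t ^ℚ a ℚ.< r ^ℚ suc b-1 → U W r
  U-power {r} {t} a b-1 1≤t t≥x a/b≥y 0<r t^a<r^b = choose (^-cont-down (suc b-1) 0<r t^a<r^b)
    where
    open ℚ.≤-Reasoning
    b = suc b-1
    0≤t = ℚ.≤-trans (ℚ.<⇒≤ 0<1) 1≤t
    contra : ∀ {q} → 0ℚ ℚ.< q → t ^ℚ a ℚ.< q ^ℚ b → L W q → ⊥
    contra 0<q lt (inj₁ q<0) = ℚ.<-asym 0<q q<0
    contra {q} 0<q gt (inj₂ (Power.below s c d-1 0<s s<x c/d<y lt)) = ℚ.<-irrefl refl (begin-strict
      (q ^ℚ b) ^ℚ d       ≡⟨ ^-assoc-comm q b d ⟩
      (q ^ℚ d) ^ℚ b       <⟨ ^-mono-< b-1 (^-nonNeg d (ℚ.<⇒≤ 0<q)) lt ⟩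
      (s ^ℚ c) ^ℚ b       ≡⟨ ^-* s c b ⟩
      s ^ℚ (c ℕ.* b)      ≤⟨ ^-mono-≤ (c ℕ.* b) (ℚ.<⇒≤ 0<s) (t≥x s<x) ⟩
      t ^ℚ (c ℕ.* b)      ≤⟨ ^-monoʳ-≤ 1≤t (/-drop-≤-ℕ c d a b (a/b≥y c/d<y)) ⟩
      t ^ℚ (a ℕ.* d)      ≡⟨ ^-* t a d ⟨
      (t ^ℚ a) ^ℚ d       <⟨ ^-mono-< d-1 (^-nonNeg a 0≤t) gt ⟩
      (q ^ℚ b) ^ℚ d       ∎)
      where d = suc d-1
    choose : _ → U W r
    choose (r′ , 0<r′ , r′<r , lt) = Sum.[ (λ Lr′ → ⊥-elim (contra 0<r′ lt Lr′)) ,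
      (λ Ur → Ur) ]′ (located W r′<r)

  L-power⁻¹ : ∀ {r t} a b-1 → 1ℚ ℚ.≤ t → t ≥ᴸ x → (+ a ℚ./ suc b-1) ≥ᴸ y →
              0ℚ ℚ.< r → L W r → r ^ℚ suc b-1 ℚ.≤ t ^ℚ a
  L-power⁻¹ a b-1 1≤t t≥x a/b≥y 0<r Lr = ℚ.≮⇒≥ λ lt →
    disjoint W Lr (U-power a b-1 1≤t t≥x a/b≥y 0<r lt)

  U-power⁻¹ : ∀ {r s} a b-1 → 0ℚ ℚ.< s → s ≤ᵁ x → (+ a ℚ./ suc b-1) ≤ᵁ y →
              0ℚ ℚ.≤ r → U W r → s ^ℚ a ℚ.≤ r ^ℚ suc b-1
  U-power⁻¹ a b-1 0<s s≤x a/b≤y 0≤r Ur = ℚ.≮⇒≥ λ lt →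
    disjoint W (L-power a b-1 0<s s≤x a/b≤y 0≤r lt) Ur

-- Exponentials and powers against quadratic growth

1/k*k≡1 : ∀ k .{{_ : NonZero k}} → 1/ℕ k ℚ.* fromℕ k ≡ 1ℚ
1/k*k≡1 (suc k) = trans (ℚ.*-comm (1/ℕ (suc k)) (fromℕ (suc k)))
  (trans (k*1/d (suc k) k) (ℚ.toℚᵘ-injective
    (ℚᵘ.≃-trans (ℚ.toℚᵘ-fromℚᵘ (mkℚᵘ (+ suc k) k)) (ℚᵘ.*≡* (ℤ.*-comm (+ suc k) (+ 1))))))

*-monoʳ-≤ : ∀ {p q r} → 0ℚ ℚ.≤ r → p ℚ.≤ q → r ℚ.* p ℚ.≤ r ℚ.* q
*-monoʳ-≤ {r = r} 0≤r = ℚ.*-monoˡ-≤-nonNeg r {{ℚ.nonNegative 0≤r}}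

*-monoʳ-< : ∀ {p q r} → 0ℚ ℚ.< r → p ℚ.< q → r ℚ.* p ℚ.< r ℚ.* q
*-monoʳ-< {r = r} 0<r = ℚ.*-monoʳ-<-pos r {{ℚ.positive 0<r}}

fromℕ-+ : ∀ m n → fromℕ (m ℕ.+ n) ≡ fromℕ m ℚ.+ fromℕ n
fromℕ-+ m n = sym (/-+ m n 0)

fromℕ-* : ∀ m n → fromℕ (m ℕ.* n) ≡ fromℕ m ℚ.* fromℕ n
fromℕ-* zero    n = sym (ℚ.*-zeroˡ (fromℕ n))
fromℕ-* (suc m) n = begin
  fromℕ (n ℕ.+ m ℕ.* n)                     ≡⟨ fromℕ-+ n (m ℕ.* n) ⟩
  fromℕ n ℚ.+ fromℕ (m ℕ.* n)               ≡⟨ cong₂ ℚ._+_ (sym (ℚ.*-identityˡ (fromℕ n))) (fromℕ-* m n) ⟩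
  1ℚ ℚ.* fromℕ n ℚ.+ fromℕ m ℚ.* fromℕ n    ≡⟨ ℚ.*-distribʳ-+ (fromℕ n) 1ℚ (fromℕ m) ⟨
  (1ℚ ℚ.+ fromℕ m) ℚ.* fromℕ n              ≡⟨ cong (ℚ._* fromℕ n) (fromℕ-suc m) ⟨
  fromℕ (suc m) ℚ.* fromℕ n                 ∎
  where open ≡-Reasoning

fromℕ-^ : ∀ m n → fromℕ (m ℕ.^ n) ≡ fromℕ m ^ℚ n
fromℕ-^ m zero    = refl
fromℕ-^ m (suc n) = trans (fromℕ-* m (m ℕ.^ n)) (cong (fromℕ m ℚ.*_) (fromℕ-^ m n))

fromℕ-mono-≤ : ∀ {m n} → m ℕ.≤ n → fromℕ m ℚ.≤ fromℕ n
fromℕ-mono-≤ {m} {n} m≤n = subst₂ ℚ._≤_ (ℚ.+-identityʳ (fromℕ m))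
  (trans (sym (fromℕ-+ m (n ℕ.∸ m))) (cong fromℕ (ℕ.m+[n∸m]≡n m≤n)))
  (ℚ.+-monoʳ-≤ (fromℕ m) (fromℕ-nonNeg (n ℕ.∸ m)))

fromℕ-mono-< : ∀ {m n} → m ℕ.< n → fromℕ m ℚ.< fromℕ n
fromℕ-mono-< {m} {n} m<n = ℚ.<-≤-trans
  (subst (fromℕ m ℚ.<_) (trans (ℚ.+-comm (fromℕ m) 1ℚ) (sym (fromℕ-suc m))) (p<p+q (fromℕ m) 0<1))
  (fromℕ-mono-≤ m<n)

fromℕ-cancel-< : ∀ {m n} → fromℕ m ℚ.< fromℕ n → m ℕ.< n
fromℕ-cancel-< m<n = ℕ.≰⇒> λ n≤m → ℚ.<-irrefl refl (ℚ.<-≤-trans m<n (fromℕ-mono-≤ n≤m))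

nonNegative-fraction : ∀ {w} → 0ℚ ℚ.≤ w → ∃[ a ] ∃[ b-1 ] + a ℚ./ suc b-1 ≡ w
nonNegative-fraction {ℚ.mkℚ (+ a) b-1 c} _ = a , b-1 , ℚ.↥p/↧p≡p (ℚ.mkℚ (+ a) b-1 c)
nonNegative-fraction {w@(ℚ.mkℚ (ℤ.-[1+ n ]) b-1 c)} 0≤w =
  ⊥-elim (ℚ.<-irrefl refl (ℚ.≤-<-trans 0≤w (ℚ.negative⁻¹ w)))

1^n≡1 : ∀ n → 1ℚ ^ℚ n ≡ 1ℚ
1^n≡1 zero    = refl
1^n≡1 (suc n) = trans (ℚ.*-identityˡ (1ℚ ^ℚ n)) (1^n≡1 n)

linear<exponential : ∀ {u} n → 1ℚ ℚ.< u → fromℕ n ℚ.* (u ℚ.- 1ℚ) ℚ.< u ^ℚ n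
linear<exponential {u} n 1<u = begin-strict
  nh                          <⟨ p<p+q nh 0<1 ⟩
  nh ℚ.+ 1ℚ                   ≡⟨ ℚ.+-comm nh 1ℚ ⟩
  1ℚ ℚ.+ nh                   ≡⟨ ℚ.*-identityˡ (1ℚ ℚ.+ nh) ⟨
  1ℚ ℚ.* (1ℚ ℚ.+ nh)          ≡⟨ cong (ℚ._* (1ℚ ℚ.+ nh)) (1^n≡1 n) ⟨
  1ℚ ^ℚ n ℚ.* (1ℚ ℚ.+ nh)     ≤⟨ bernoulli n 0<1 1<u ⟩
  1ℚ ℚ.* u ^ℚ n               ≡⟨ ℚ.*-identityˡ (u ^ℚ n) ⟩
  u ^ℚ n                      ∎
  where
  open ℚ.≤-Reasoning
  nh = fromℕ n ℚ.* (u ℚ.- 1ℚ)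

exponential-unbounded : ∀ {u} C → 1ℚ ℚ.< u → ∃[ n₀ ] ∀ n → n₀ ℕ.≤ n → C ℚ.< u ^ℚ n
exponential-unbounded {u} C 1<u =
  let n₀ , C≤n₀h = archimedean C (<⇒0<- 1<u) in
  n₀ , λ n n₀≤n → ℚ.≤-<-trans C≤n₀h
    (ℚ.<-≤-trans (linear<exponential n₀ 1<u) (^-monoʳ-≤ (ℚ.<⇒≤ 1<u) n₀≤n))

-- Take v > 1 with v ^ 3 < u. Bernoulli gives n ≤ r v ^ n for a constant r, so C n² is at most C r²
-- v ^ (2 n), and one further factor v ^ n eventually beats C r².
quadratic<exponential : ∀ {u C} → 1ℚ ℚ.< u → 0ℚ ℚ.≤ C →
  ∃[ n₀ ] ∀ n → n₀ ℕ.≤ n → C ℚ.* (fromℕ n ℚ.* fromℕ n) ℚ.< u ^ℚ n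
quadratic<exponential {u} {C} 1<u 0≤C =
  let v , 1<v , v³<u = ^-cont-up {1ℚ} {u} 3 (ℚ.<⇒≤ 0<1) 1<u
  in main v 1<v v³<u
  where
  open ℚ.≤-Reasoning
  module _ (v : ℚ) (1<v : 1ℚ ℚ.< v) (v³<u : v ^ℚ 3 ℚ.< u) where
    h = v ℚ.- 1ℚ
    0<h = <⇒0<- 1<v
    r = proj₁ (divide 1ℚ 0<h)
    rh≡1 : r ℚ.* h ≡ 1ℚ
    rh≡1 = proj₂ (divide 1ℚ 0<h)
    0<r : 0ℚ ℚ.< r
    0<r = *-cancelʳ-< 0<h (subst₂ ℚ._<_ (sym (ℚ.*-zeroˡ h)) (sym rh≡1) 0<1)
    0<v = ℚ.<-trans 0<1 1<v
    n≤rvⁿ : ∀ n → fromℕ n ℚ.≤ r ℚ.* v ^ℚ n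
    n≤rvⁿ n = begin
      fromℕ n                     ≡⟨ ℚ.*-identityˡ (fromℕ n) ⟨
      1ℚ ℚ.* fromℕ n              ≡⟨ cong (ℚ._* fromℕ n) rh≡1 ⟨
      r ℚ.* h ℚ.* fromℕ n         ≡⟨ ℚ.*-assoc r h (fromℕ n) ⟩
      r ℚ.* (h ℚ.* fromℕ n)       ≡⟨ cong (r ℚ.*_) (ℚ.*-comm h (fromℕ n)) ⟩
      r ℚ.* (fromℕ n ℚ.* h)       ≤⟨ *-monoʳ-≤ (ℚ.<⇒≤ 0<r) (ℚ.<⇒≤ (linear<exponential n 1<v)) ⟩
      r ℚ.* v ^ℚ n                ∎
    regroup : ∀ C r V → C ℚ.* (r ℚ.* V ℚ.* (r ℚ.* V)) ≡ C ℚ.* (r ℚ.* r) ℚ.* (V ℚ.* V)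
    regroup = let open ℕCoefficients in
      solve 3 (λ C r V → C :* (r :* V :* (r :* V)) := C :* (r :* r) :* (V :* V)) refl
    cube : ∀ V → V ℚ.* (V ℚ.* V) ≡ V ^ℚ 3
    cube V = cong (λ z → V ℚ.* (V ℚ.* z)) (sym (ℚ.*-identityʳ V))
    main : ∃[ n₀ ] ∀ n → n₀ ℕ.≤ n → C ℚ.* (fromℕ n ℚ.* fromℕ n) ℚ.< u ^ℚ n
    main = let n₀ , bound = exponential-unbounded (C ℚ.* (r ℚ.* r)) 1<v in
      n₀ , λ n n₀≤n → let V = v ^ℚ n ; 0<V = ^-pos n 0<v ; N = fromℕ n in begin-strict
        C ℚ.* (N ℚ.* N)
          ≤⟨ *-monoʳ-≤ 0≤C (*-mono-≤ (fromℕ-nonNeg n) (*-nonNeg (ℚ.<⇒≤ 0<r) (ℚ.<⇒≤ 0<V)) (n≤rvⁿ n) (n≤rvⁿ n)) ⟩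
        C ℚ.* (r ℚ.* V ℚ.* (r ℚ.* V))
          ≡⟨ regroup C r V ⟩
        C ℚ.* (r ℚ.* r) ℚ.* (V ℚ.* V)
          <⟨ *-monoˡ-< (*-pos 0<V 0<V) (bound n n₀≤n) ⟩
        V ℚ.* (V ℚ.* V)
          ≡⟨ cube V ⟩
        (v ^ℚ n) ^ℚ 3
          ≡⟨ trans (^-* v n 3) (trans (cong (v ^ℚ_) (ℕ.*-comm n 3)) (sym (^-* v 3 n))) ⟩
        (v ^ℚ 3) ^ℚ n
          ≤⟨ ^-mono-≤ n (^-nonNeg 3 (ℚ.<⇒≤ 0<v)) (ℚ.<⇒≤ v³<u) ⟩
        u ^ℚ n ∎

-- Once the gap opens at one exponent it persists, because each further factor u on the right
-- exceeds the factor t on the left.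
exponential-gap : ∀ {t u} C → 0ℚ ℚ.< t → t ℚ.< u → ∃[ n₀ ] ∀ n → n₀ ℕ.≤ n → C ℚ.* t ^ℚ n ℚ.< u ^ℚ n
exponential-gap {t} {u} C 0<t t<u = let m-1 , gap = ^-gap C 0<t t<u in suc m-1 , extend m-1 gap
  where
  open ℚ.≤-Reasoning
  extend : ∀ m-1 → C ℚ.* t ^ℚ suc m-1 ℚ.< u ^ℚ suc m-1 → ∀ n → suc m-1 ℕ.≤ n → C ℚ.* t ^ℚ n ℚ.< u ^ℚ n
  extend m-1 gap n m≤n = begin-strict
    C ℚ.* t ^ℚ n                    ≡⟨ cong (λ k → C ℚ.* t ^ℚ k) (ℕ.m+[n∸m]≡n m≤n) ⟨
    C ℚ.* t ^ℚ (m ℕ.+ j)            ≡⟨ cong (C ℚ.*_) (^-+ t m j) ⟩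
    C ℚ.* (t ^ℚ m ℚ.* t ^ℚ j)       ≡⟨ ℚ.*-assoc C (t ^ℚ m) (t ^ℚ j) ⟨
    C ℚ.* t ^ℚ m ℚ.* t ^ℚ j         <⟨ *-monoˡ-< (^-pos j 0<t) gap ⟩
    u ^ℚ m ℚ.* t ^ℚ j               ≤⟨ *-monoʳ-≤ (^-nonNeg m (ℚ.<⇒≤ 0<u)) (^-mono-≤ j (ℚ.<⇒≤ 0<t) (ℚ.<⇒≤ t<u)) ⟩
    u ^ℚ m ℚ.* u ^ℚ j               ≡⟨ ^-+ u m j ⟨
    u ^ℚ (m ℕ.+ j)                  ≡⟨ cong (u ^ℚ_) (ℕ.m+[n∸m]≡n m≤n) ⟩
    u ^ℚ n                          ∎
    where
    m = suc m-1
    j = n ℕ.∸ m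
    0<u = ℚ.<-trans 0<t t<u

fromℚ≤ᵁ : ∀ c → c ≤ᵁ fromℚ c
fromℚ≤ᵁ c = ℚ.<⇒≤

fromℚ≥ᴸ : ∀ c → c ≥ᴸ fromℚ c
fromℚ≥ᴸ c = ℚ.<⇒≤

-- Comparison of orders of approximation

at : (ℝ≥1 → ℝ⁺) → (n : ℕ) .{{_ : NonZero n}} → ℝ
at V n = proj₁ (V (fromℕ≥1 n))

Eventually : ((n : ℕ) .{{_ : NonZero n}} → Set) → Set
Eventually P = ∃[ n₀ ] ∀ n .{{_ : NonZero n}} → n₀ ℕ.≤ n → P n

Superquadratic : (ℝ≥1 → ℝ⁺) → Set
Superquadratic V = ∀ T → Eventually λ n → L (at V n) (fromℕ (T ℕ.* (n ℕ.* n)))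

-- Letting n range below m builds in the monotonicity of V: the error of a fraction with denominator
-- m that equals a convergent is governed by V at the reduced denominator n.
DominatesAt : ℕ → (ℝ≥1 → ℝ⁺) → (ℝ≥1 → ℝ⁺) → (m : ℕ) .{{_ : NonZero m}} → Set
DominatesAt T V′ V m = ∀ n .{{_ : NonZero n}} → n ℕ.≤ m →
  ∀ {r} → 0ℚ ℚ.< r → L (at V n) r → L (at V′ m) (fromℕ T ℚ.* r)

Dominates : (ℝ≥1 → ℝ⁺) → (ℝ≥1 → ℝ⁺) → Set
Dominates V′ V = ∀ T → Eventually (λ m → DominatesAt T V′ V m)

-- Encodes V′ ≤ V in the form that carries V(q) < k over to V′(q) < k.
Bounds : (ℝ≥1 → ℝ⁺) → (ℝ≥1 → ℝ⁺) → Set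
Bounds V V′ = ∀ n .{{_ : NonZero n}} {r} → U (at V n) r → U (at V′ n) r

-- The rational power s ^ (a / b) lies between x′ ^ y′ and x ^ y; openness of the upper cut supplies
-- the strictness that `U-power` asks for.
U-power-mono : ∀ (x x′ : ℝ≥1) (y y′ : ℝ⁺) {s} a b-1 → 1ℚ ℚ.≤ s →
  s ≤ᵁ proj₁ x → s ≥ᴸ proj₁ x′ → (+ a ℚ./ suc b-1) ≤ᵁ proj₁ y → (+ a ℚ./ suc b-1) ≥ᴸ proj₁ y′ →
  ∀ {r} → U (proj₁ (x ^ y)) r → U (proj₁ (x′ ^ y′)) r
U-power-mono x x′ y y′ a b-1 1≤s s≤x s≥x′ a/b≤y a/b≥y′ Ur =
  let r′ , r′<r , Ur′ = U-open (proj₁ (x ^ y)) Ur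
      0<r′ = U⇒pos (x ^ y) Ur′
  in U-power x′ y′ a b-1 1≤s s≥x′ a/b≥y′ (ℚ.<-trans 0<r′ r′<r)
       (ℚ.≤-<-trans (U-power⁻¹ x y a b-1 (ℚ.<-≤-trans 0<1 1≤s) s≤x a/b≤y (ℚ.<⇒≤ 0<r′) Ur′)
         (^-mono-< b-1 (ℚ.<⇒≤ 0<r′) r′<r))

-- Used against a base or exponent x below the claimed value y: the definition of such a bound
-- allows any ε, so one is chosen for which x + ε still misses y.
increment : ∀ {x y} → x < y → Σ[ ε ∈ ℝ⁺ ] ∃[ w ] U (x + proj₁ ε) w × L y w
increment {x} {y} (w , Uw , Lw) =
  let w′ , w′<w , Uw′ = U-open x Uw
      t , 0<t , t<w-w′ = ℚ.<-dense (<⇒0<- w′<w)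
      e , 0<e , e<t = ℚ.<-dense 0<t
  in (fromℚ e , fromℚ-mono-< 0<e) , w , (w′ , t , Uw′ , e<t , +-cancel-< t<w-w′) , Lw

module _ (β : ℝ≥1) where

  L-exponential : ∀ {r s} n .{{_ : NonZero n}} → 0ℚ ℚ.< s → L (proj₁ β) s → 0ℚ ℚ.≤ r → r ℚ.< s ^ℚ n →
                  L (proj₁ (β ^ ≥1⇒⁺ (fromℕ≥1 n))) r
  L-exponential {r} {s} n 0<s Ls 0≤r r<sⁿ = L-power β (≥1⇒⁺ (fromℕ≥1 n)) n 0 0<s (L⇒≤ᵁ (proj₁ β) Ls)
    (fromℚ≤ᵁ (fromℕ n)) 0≤r (subst (ℚ._< s ^ℚ n) (sym (ℚ.*-identityʳ r)) r<sⁿ)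

  superquadratic-exponential : 1ℝ < proj₁ β → Superquadratic (λ y → β ^ ≥1⇒⁺ y)
  superquadratic-exponential (w , 1<w , Lw) T =
    let n₀ , bound = quadratic<exponential 1<w (fromℕ-nonNeg T) in
    n₀ , λ n n₀≤n → L-exponential n (ℚ.<-trans 0<1 1<w) Lw (fromℕ-nonNeg (T ℕ.* (n ℕ.* n)))
      (subst (ℚ._< w ^ℚ n)
        (sym (trans (fromℕ-* T (n ℕ.* n)) (cong (fromℕ T ℚ.*_) (fromℕ-* n n)))) (bound n n₀≤n))

-- Choose rationals β < t < u < β + ε. For n ≤ m, β ^ n is at most t ^ n ≤ t ^ m, and T t ^ m < u ^
-- m once m is large. Bracketing β within e / 2, where 0 < e < ε, leaves room for u.
dominates-exponential : (β : ℝ≥1) (ε : ℝ⁺) → Dominates (λ y → (β +¹ ε) ^ ≥1⇒⁺ y) (λ y → β ^ ≥1⇒⁺ y)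
dominates-exponential β ε T =
  let e , 0<e , Le = proj₂ ε
      s , t , Ls , Ut , t-s≤e/2 = approximate (proj₁ β) (half 0<e)
      u , t<u , u<s+e = ℚ.<-dense (t<s+e s t e 0<e t-s≤e/2)
  in bound t u Ut t<u (s , e , Ls , Le , u<s+e)
  where
  t<s+e : ∀ s t e → 0ℚ ℚ.< e → t ℚ.- s ℚ.≤ e ℚ.* ½ → t ℚ.< s ℚ.+ e
  t<s+e s t e 0<e le = subst (ℚ._< s ℚ.+ e) (sym (split s t)) (ℚ.+-monoʳ-< s (ℚ.≤-<-trans le
    (subst (e ℚ.* ½ ℚ.<_) (half+half e) (p<p+q (e ℚ.* ½) (half 0<e)))))
  bound : ∀ t u → U (proj₁ β) t → t ℚ.< u → L (proj₁ (β +¹ ε)) u →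
          Eventually (λ m → DominatesAt T (λ y → (β +¹ ε) ^ ≥1⇒⁺ y) (λ y → β ^ ≥1⇒⁺ y) m)
  bound t u Ut t<u Lu =
    let 1≤t = U⇒≥1 β Ut
        0<t = ℚ.<-≤-trans 0<1 1≤t
        m₀ , gap = exponential-gap (fromℕ T) 0<t t<u
    in m₀ , λ m m₀≤m n n≤m {r} 0<r Lr →
      let r*1≤tⁿ = L-power⁻¹ β (≥1⇒⁺ (fromℕ≥1 n)) n 0 1≤t (U⇒≥ᴸ (proj₁ β) Ut) (fromℚ≥ᴸ (fromℕ n)) 0<r Lr
          r≤tᵐ = ℚ.≤-trans (subst (ℚ._≤ t ^ℚ n) (ℚ.*-identityʳ r) r*1≤tⁿ) (^-monoʳ-≤ 1≤t n≤m)
      in L-exponential (β +¹ ε) m (ℚ.<-trans 0<t t<u) Lu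
           (*-nonNeg (fromℕ-nonNeg T) (ℚ.<⇒≤ 0<r))
           (ℚ.≤-<-trans (*-monoʳ-≤ (fromℕ-nonNeg T) r≤tᵐ) (gap m m₀≤m))

bounds-exponential : (β γ : ℝ≥1) → proj₁ γ < proj₁ β →
  Σ[ ε ∈ ℝ⁺ ] Bounds (λ y → β ^ ≥1⇒⁺ y) (λ y → (γ +¹ ε) ^ ≥1⇒⁺ y)
bounds-exponential β γ γ<β =
  let ε , w , Uw , Lw = increment {proj₁ γ} {proj₁ β} γ<β in
  ε , λ n → U-power-mono β (γ +¹ ε) (≥1⇒⁺ (fromℕ≥1 n)) (≥1⇒⁺ (fromℕ≥1 n)) n 0 (U⇒≥1 (γ +¹ ε) Uw)
    (L⇒≤ᵁ (proj₁ β) Lw) (U⇒≥ᴸ (proj₁ (γ +¹ ε)) Uw) (fromℚ≤ᵁ (fromℕ n)) (fromℚ≥ᴸ (fromℕ n))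

module _ (μ : ℝ⁺) where

  -- With a rational a / b strictly between 2 and μ one has 2 b + 1 ≤ a, so for n > T ^ b the b-th
  -- power of T n² is below n ^ (2 b + 1) ≤ n ^ a.
  superquadratic-power : 2ℝ < proj₁ μ → Superquadratic (λ y → y ^ μ)
  superquadratic-power (w , 2<w , Lw) T =
    bound w 2<w Lw (nonNegative-fraction (ℚ.<⇒≤ (ℚ.<-trans (/-pos 1 0) 2<w)))
    where
    bound : ∀ w → fromℕ 2 ℚ.< w → L (proj₁ μ) w → ∃[ a ] ∃[ b-1 ] + a ℚ./ suc b-1 ≡ w →
            Eventually (λ n → L (at (λ y → y ^ μ) n) (fromℕ (T ℕ.* (n ℕ.* n))))
    bound w 2<w Lw (a , b-1 , refl) = suc (T ℕ.^ b) , λ n Tᵇ<n →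
      L-power (fromℕ≥1 n) μ a b-1 (fromℕ-pos n) (fromℚ≤ᵁ (fromℕ n)) (L⇒≤ᵁ (proj₁ μ) Lw)
        (fromℕ-nonNeg (T ℕ.* (n ℕ.* n)))
        (estimate n Tᵇ<n)
      where
      open ℚ.≤-Reasoning
      b = suc b-1
      2b<a : 2 ℕ.* b ℕ.< a
      2b<a = subst (2 ℕ.* b ℕ.<_) (ℕ.*-identityʳ a) (/-drop-< 2 0 a b-1 2<w)
      TN² : ∀ n → fromℕ (T ℕ.* (n ℕ.* n)) ≡ fromℕ T ℚ.* fromℕ n ^ℚ 2
      TN² n = trans (fromℕ-* T (n ℕ.* n)) (cong (fromℕ T ℚ.*_)
        (trans (fromℕ-* n n) (cong (fromℕ n ℚ.*_) (sym (ℚ.*-identityʳ (fromℕ n))))))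
      estimate : ∀ n .{{_ : NonZero n}} → T ℕ.^ b ℕ.< n → fromℕ (T ℕ.* (n ℕ.* n)) ^ℚ b ℚ.< fromℕ n ^ℚ a
      estimate n Tᵇ<n = begin-strict
        fromℕ (T ℕ.* (n ℕ.* n)) ^ℚ b            ≡⟨ cong (_^ℚ b) (TN² n) ⟩
        (fromℕ T ℚ.* fromℕ n ^ℚ 2) ^ℚ b         ≡⟨ ^ℚ-distrib-* (fromℕ T) (fromℕ n ^ℚ 2) b ⟩
        fromℕ T ^ℚ b ℚ.* (fromℕ n ^ℚ 2) ^ℚ b    ≡⟨ cong₂ ℚ._*_ (sym (fromℕ-^ T b)) (^-* (fromℕ n) 2 b) ⟩
        fromℕ (T ℕ.^ b) ℚ.* fromℕ n ^ℚ (2 ℕ.* b) <⟨ *-monoˡ-< (^-pos (2 ℕ.* b) (fromℕ-pos n)) (fromℕ-mono-< Tᵇ<n) ⟩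
        fromℕ n ^ℚ suc (2 ℕ.* b)                ≤⟨ ^-monoʳ-≤ (1≤fromℕ n) 2b<a ⟩
        fromℕ n ^ℚ a                            ∎

  -- With μ < a / b and (a + 1) / b < μ + ε, the factor T ^ b is absorbed by the extra power.
  dominates-power : (ε : ℝ⁺) → Dominates (λ y → y ^ (μ +⁺ ε)) (λ y → y ^ μ)
  dominates-power ε T =
    let e , 0<e , Le = proj₂ ε
        q , 0<q , Lq = proj₂ μ
        -- `grid` locates μ only to within 2 / b, and passing from a to a + 1 adds a third step, so
        -- 3 / b < e is required; 4 ≤ (b - 1) e provides it.
        b-1 , 4≤b-1*e = archimedean (fromℕ 4) 0<e
        k , Lk , Uk = grid (proj₁ μ) (/-pos 0 b-1) (L-down (proj₁ μ) 0<q Lq)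
    in bound (2 ℕ.+ k) b-1 (subst (U (proj₁ μ)) (multiple (2 ℕ.+ k) b-1) Uk)
         (+ k ℚ./ suc b-1 , e , subst (L (proj₁ μ)) (multiple k b-1) Lk , Le , close k b-1 e 0<e 4≤b-1*e)
    where
    multiple : ∀ k d → 0ℚ ℚ.+ fromℕ k ℚ.* (+ 1 ℚ./ suc d) ≡ + k ℚ./ suc d
    multiple k d = trans (ℚ.+-identityˡ (fromℕ k ℚ.* (+ 1 ℚ./ suc d))) (k*1/d k d)
    close : ∀ k b-1 e → 0ℚ ℚ.< e → fromℕ 4 ℚ.≤ fromℕ b-1 ℚ.* e → + (3 ℕ.+ k) ℚ./ suc b-1 ℚ.< + k ℚ./ suc b-1 ℚ.+ e
    close k b-1 e 0<e 4≤be = subst (ℚ._< + k ℚ./ suc b-1 ℚ.+ e)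
      (trans (/-+ k 3 b-1) (cong (λ z → + z ℚ./ suc b-1) (ℕ.+-comm k 3)))
      (ℚ.+-monoʳ-< (+ k ℚ./ suc b-1) 3/b<e)
      where
      open ℚ.≤-Reasoning
      3/b<e : + 3 ℚ./ suc b-1 ℚ.< e
      3/b<e = *-cancelʳ-< (fromℕ-pos (suc b-1)) (begin-strict
        + 3 ℚ./ suc b-1 ℚ.* fromℕ (suc b-1)                   ≡⟨ cong (ℚ._* fromℕ (suc b-1)) (k*1/d 3 b-1) ⟨
        fromℕ 3 ℚ.* (+ 1 ℚ./ suc b-1) ℚ.* fromℕ (suc b-1)     ≡⟨ ℚ.*-assoc (fromℕ 3) (+ 1 ℚ./ suc b-1) (fromℕ (suc b-1)) ⟩
        fromℕ 3 ℚ.* ((+ 1 ℚ./ suc b-1) ℚ.* fromℕ (suc b-1))   ≡⟨ cong (fromℕ 3 ℚ.*_) (1/k*k≡1 (suc b-1)) ⟩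
        fromℕ 3 ℚ.* 1ℚ                                        <⟨ fromℕ-mono-< {3} {4} (ℕ.n<1+n 3) ⟩
        fromℕ 4                                               ≤⟨ 4≤be ⟩
        fromℕ b-1 ℚ.* e                                       <⟨ *-monoˡ-< 0<e (fromℕ-mono-< (ℕ.n<1+n b-1)) ⟩
        fromℕ (suc b-1) ℚ.* e                                 ≡⟨ ℚ.*-comm (fromℕ (suc b-1)) e ⟩
        e ℚ.* fromℕ (suc b-1)                                 ∎)
    bound : ∀ a b-1 → U (proj₁ μ) (+ a ℚ./ suc b-1) → L (proj₁ (μ +⁺ ε)) (+ suc a ℚ./ suc b-1) →
            Eventually (λ m → DominatesAt T (λ y → y ^ (μ +⁺ ε)) (λ y → y ^ μ) m)
    bound a b-1 Ua La+1 = suc (T ℕ.^ b) , λ m Tᵇ<m n n≤m {r} 0<r Lr →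
      let rᵇ≤nᵃ = L-power⁻¹ (fromℕ≥1 n) μ a b-1 (1≤fromℕ n) (fromℚ≥ᴸ (fromℕ n)) (U⇒≥ᴸ (proj₁ μ) Ua) 0<r Lr
      in L-power (fromℕ≥1 m) (μ +⁺ ε) (suc a) b-1 (fromℕ-pos m) (fromℚ≤ᵁ (fromℕ m))
           (L⇒≤ᵁ (proj₁ (μ +⁺ ε)) La+1) (*-nonNeg (fromℕ-nonNeg T) (ℚ.<⇒≤ 0<r)) (begin-strict
             (fromℕ T ℚ.* r) ^ℚ b
               ≡⟨ ^ℚ-distrib-* (fromℕ T) r b ⟩
             fromℕ T ^ℚ b ℚ.* r ^ℚ b
               ≤⟨ *-monoʳ-≤ (^-nonNeg b (fromℕ-nonNeg T))
                    (ℚ.≤-trans rᵇ≤nᵃ (^-mono-≤ a (fromℕ-nonNeg n) (fromℕ-mono-≤ n≤m))) ⟩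
             fromℕ T ^ℚ b ℚ.* fromℕ m ^ℚ a
               <⟨ *-monoˡ-< (^-pos a (fromℕ-pos m)) (subst (ℚ._< fromℕ m) (fromℕ-^ T b) (fromℕ-mono-< Tᵇ<m)) ⟩
             fromℕ m ^ℚ suc a ∎)
      where
      open ℚ.≤-Reasoning
      b = suc b-1

bounds-power : (μ ν : ℝ⁺) → proj₁ ν < proj₁ μ → Σ[ ε ∈ ℝ⁺ ] Bounds (λ y → y ^ μ) (λ y → y ^ (ν +⁺ ε))
bounds-power μ ν ν<μ =
  let ε , w , Uw , Lw = increment {proj₁ ν} {proj₁ μ} ν<μ
      a , b-1 , eq = nonNegative-fraction (ℚ.<⇒≤ (U⇒pos (ν +⁺ ε) Uw))
  in ε , λ n → U-power-mono (fromℕ≥1 n) (fromℕ≥1 n) μ (ν +⁺ ε) a b-1 (1≤fromℕ n)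
    (fromℚ≤ᵁ (fromℕ n)) (fromℚ≥ᴸ (fromℕ n))
    (L⇒≤ᵁ (proj₁ μ) (subst (L (proj₁ μ)) (sym eq) Lw))
    (U⇒≥ᴸ (proj₁ (ν +⁺ ε)) (subst (U (proj₁ (ν +⁺ ε))) (sym eq) Uw))

-- Convergents

*-cancelʳ-≡ : ∀ {p q r} → 0ℚ ℚ.< r → p ℚ.* r ≡ q ℚ.* r → p ≡ q
*-cancelʳ-≡ {r = r} 0<r eq = ℚ.≤-antisym
  (ℚ.*-cancelʳ-≤-pos r {{ℚ.positive 0<r}} (ℚ.≤-reflexive eq))
  (ℚ.*-cancelʳ-≤-pos r {{ℚ.positive 0<r}} (ℚ.≤-reflexive (sym eq)))

1/ℕ-pos : ∀ k .{{_ : NonZero k}} → 0ℚ ℚ.< 1/ℕ k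
1/ℕ-pos (suc k) = /-pos 0 k

1/ℕ-* : ∀ m n .{{_ : NonZero m}} .{{_ : NonZero n}} →
        1/ℕ (m ℕ.* n) {{ℕ.m*n≢0 m n}} ≡ 1/ℕ m ℚ.* 1/ℕ n
1/ℕ-* m n = *-cancelʳ-≡ (fromℕ-pos (m ℕ.* n)) (begin
  1/ℕ (m ℕ.* n) ℚ.* fromℕ (m ℕ.* n)                        ≡⟨ 1/k*k≡1 (m ℕ.* n) ⟩
  1ℚ ℚ.* 1ℚ                                                ≡⟨ cong₂ ℚ._*_ (1/k*k≡1 m) (1/k*k≡1 n) ⟨
  1/ℕ m ℚ.* fromℕ m ℚ.* (1/ℕ n ℚ.* fromℕ n)                ≡⟨ swap (1/ℕ m) (fromℕ m) (1/ℕ n) (fromℕ n) ⟩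
  1/ℕ m ℚ.* 1/ℕ n ℚ.* (fromℕ m ℚ.* fromℕ n)                ≡⟨ cong (1/ℕ m ℚ.* 1/ℕ n ℚ.*_) (fromℕ-* m n) ⟨
  1/ℕ m ℚ.* 1/ℕ n ℚ.* fromℕ (m ℕ.* n)                      ∎)
  where
  open ≡-Reasoning
  instance
    mn≢0 : NonZero (m ℕ.* n)
    mn≢0 = ℕ.m*n≢0 m n
  swap : ∀ a b c d → a ℚ.* b ℚ.* (c ℚ.* d) ≡ a ℚ.* c ℚ.* (b ℚ.* d)
  swap = let open ℕCoefficients in solve 4 (λ a b c d → a :* b :* (c :* d) := a :* c :* (b :* d)) refl

1/ℕ-halve : ∀ k .{{_ : NonZero k}} → let instance _ = ℕ.m*n≢0 2 k in
            1/ℕ (2 ℕ.* k) ℚ.+ 1/ℕ (2 ℕ.* k) ≡ 1/ℕ k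
1/ℕ-halve k = begin
  1/ℕ (2 ℕ.* k) ℚ.+ 1/ℕ (2 ℕ.* k)   ≡⟨ cong₂ ℚ._+_ eq eq ⟩
  1/ℕ k ℚ.* ½ ℚ.+ 1/ℕ k ℚ.* ½       ≡⟨ half+half (1/ℕ k) ⟩
  1/ℕ k                             ∎
  where
  open ≡-Reasoning
  instance
    2k≢0 : NonZero (2 ℕ.* k)
    2k≢0 = ℕ.m*n≢0 2 k
  eq : 1/ℕ (2 ℕ.* k) ≡ 1/ℕ k ℚ.* ½
  eq = trans (1/ℕ-* 2 k) (ℚ.*-comm ½ (1/ℕ k))

1/ℕ-antimono-≤ : ∀ {m n} .{{_ : NonZero m}} .{{_ : NonZero n}} → m ℕ.≤ n → 1/ℕ n ℚ.≤ 1/ℕ m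
1/ℕ-antimono-≤ {m} {n} m≤n = /-mono-≤ (+ 1) n (+ 1) m
  (subst₂ ℤ._≤_ (sym (ℤ.*-identityˡ (+ m))) (sym (ℤ.*-identityˡ (+ n))) (ℤ.+≤+ m≤n))

1/ℕ-antimono-< : ∀ {m n} .{{_ : NonZero m}} .{{_ : NonZero n}} → m ℕ.< n → 1/ℕ n ℚ.< 1/ℕ m
1/ℕ-antimono-< {m} {n} m<n = ℚ.≰⇒> λ 1/m≤1/n → ℕ.<⇒≱ m<n (ℤ.drop‿+≤+
  (subst₂ ℤ._≤_ (ℤ.*-identityˡ (+ n)) (ℤ.*-identityˡ (+ m)) (/-drop-≤ (+ 1) m (+ 1) n 1/m≤1/n)))

-- The cross products are integers, so when they differ they differ by at least 1.
/-gap : ∀ i m j n .{{_ : NonZero m}} .{{_ : NonZero n}} → i ℤ.* + n ℤ.< j ℤ.* + m →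
        i ℚ./ m ℚ.+ 1/ℕ (m ℕ.* n) {{ℕ.m*n≢0 m n}} ℚ.≤ j ℚ./ n
/-gap i m@(suc m-1) j n@(suc n-1) i*n<j*m = ℚ.toℚᵘ-cancel-≤
  (ℚᵘ.≤-respʳ-≃ (ℚᵘ.≃-sym (ℚ.toℚᵘ-fromℚᵘ (mkℚᵘ j n-1)))
    (ℚᵘ.≤-respˡ-≃ (ℚᵘ.≃-sym (ℚᵘ.≃-trans (ℚ.toℚᵘ-homo-+ (i ℚ./ m) (1/ℕ (m ℕ.* n)))
        (ℚᵘ.+-cong (ℚ.toℚᵘ-fromℚᵘ (mkℚᵘ i m-1)) (ℚ.toℚᵘ-fromℚᵘ (mkℚᵘ (+ 1) (n-1 ℕ.+ m-1 ℕ.* n))))))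
      (ℚᵘ.*≤* (subst₂ ℤ._≤_ (sym eq₁) (sym eq₂)
        (ℤ.*-monoʳ-≤-nonNeg (+ m ℤ.* + n) (ℤ.i<j⇒suc[i]≤j i*n<j*m))))))
  where
  open ℤ.+-*-Solver
  mn : + (m ℕ.* n) ≡ + m ℤ.* + n
  mn = ℤ.pos-* m n
  eq₁ : (i ℤ.* + (m ℕ.* n) ℤ.+ + 1 ℤ.* + m) ℤ.* + n ≡ (+ 1 ℤ.+ i ℤ.* + n) ℤ.* (+ m ℤ.* + n)
  eq₁ = trans (cong (λ z → (i ℤ.* z ℤ.+ + 1 ℤ.* + m) ℤ.* + n) mn)
    (solve 3 (λ i m n → (i :* (m :* n) :+ con (+ 1) :* m) :* n := (con (+ 1) :+ i :* n) :* (m :* n)) refl i (+ m) (+ n))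
  eq₂ : j ℤ.* (+ m ℤ.* + (m ℕ.* n)) ≡ j ℤ.* + m ℤ.* (+ m ℤ.* + n)
  eq₂ = trans (cong (λ z → j ℤ.* (+ m ℤ.* z)) mn) (sym (ℤ.*-assoc j (+ m) (+ m ℤ.* + n)))

/-cong-≡ : ∀ i m j n .{{_ : NonZero m}} .{{_ : NonZero n}} → i ℤ.* + n ≡ j ℤ.* + m → i ℚ./ m ≡ j ℚ./ n
/-cong-≡ i m j n eq = ℚ.≤-antisym (/-mono-≤ i m j n (ℤ.≤-reflexive eq)) (/-mono-≤ j n i m (ℤ.≤-reflexive (sym eq)))

↧ₙ[i/n]≤n : ∀ i n .{{_ : NonZero n}} → ↧ₙ (i ℚ./ n) ℕ.≤ n
↧ₙ[i/n]≤n i n = ∣⇒≤ (divides ℤ.∣ gcd i (+ n) ∣ (begin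
  n                                               ≡⟨ cong ℤ.∣_∣ (ℚ.↧-/ i n) ⟨
  ℤ.∣ ↧ (i ℚ./ n) ℤ.* gcd i (+ n) ∣               ≡⟨ ℤ.abs-* (↧ (i ℚ./ n)) (gcd i (+ n)) ⟩
  ↧ₙ (i ℚ./ n) ℕ.* ℤ.∣ gcd i (+ n) ∣              ≡⟨ ℕ.*-comm (↧ₙ (i ℚ./ n)) ℤ.∣ gcd i (+ n) ∣ ⟩
  ℤ.∣ gcd i (+ n) ∣ ℕ.* ↧ₙ (i ℚ./ n)              ∎))
  where open ≡-Reasoning

tail : PartialQuotients → PartialQuotients
tail (b , b≢0) = b ∘ suc , b≢0 ∘ suc

-- The recursion follows `finite`, which unfolds from the front: if the tail has value N / D, then 1
-- / (b₀ + N / D) = D / (b₀ D + N).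
numerator denominator : PartialQuotients → ℕ → ℕ
numerator b zero    = 0
numerator b (suc n) = denominator (tail b) n
denominator b zero    = 1
denominator b (suc n) = proj₁ b 0 ℕ.* denominator (tail b) n ℕ.+ numerator (tail b) n

denominator≢0 : ∀ b n → NonZero (denominator b n)
denominator≢0 b zero    = _
denominator≢0 b (suc n) = ℕ.>-nonZero (ℕ.≤-trans
  (ℕ.>-nonZero⁻¹ (proj₁ b 0 ℕ.* denominator (tail b) n)
    {{ℕ.m*n≢0 (proj₁ b 0) (denominator (tail b) n) {{proj₂ b 0}} {{denominator≢0 (tail b) n}}}})
  (ℕ.m≤m+n _ _))

coprime : ∀ b n → Coprime (numerator b n) (denominator b n)
coprime b zero    (_ , d∣1) = ∣1⇒≡1 d∣1
coprime b (suc n) (d∣D , d∣bD+N) =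
  coprime (tail b) n (∣m+n∣m⇒∣n d∣bD+N (∣n⇒∣m*n (proj₁ b 0) d∣D) , d∣D)

-- Index shift in which z plays the term of index -1; the usual conventions are q₋₁ = 0 and p₋₁ = 1.
previous : (ℕ → ℕ) → ℕ → ℕ → ℕ
previous f z zero    = z
previous f z (suc n) = f n

-- The classical recurrence, which appends a quotient at the end, recovered from a definition that
-- prepends one. Since a numerator is a denominator of the tail, both inductions run together on the
-- tail, and the first and last quotients are exchanged by a polynomial identity.
denominator-suc : ∀ b n → denominator b (suc n) ≡ proj₁ b n ℕ.* denominator b n ℕ.+ previous (denominator b) 0 n
numerator-suc : ∀ b n → numerator b (suc n) ≡ proj₁ b n ℕ.* numerator b n ℕ.+ previous (numerator b) 1 n
denominator-suc b zero = refl
denominator-suc b (suc zero) = eq (proj₁ b 0) (proj₁ b 1)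
  where
  open ℕ.+-*-Solver
  eq : ∀ b₀ b₁ → b₀ ℕ.* (b₁ ℕ.* 1 ℕ.+ 0) ℕ.+ 1 ≡ b₁ ℕ.* (b₀ ℕ.* 1 ℕ.+ 0) ℕ.+ 1
  eq = solve 2 (λ b₀ b₁ → b₀ :* (b₁ :* con 1 :+ con 0) :+ con 1 := b₁ :* (b₀ :* con 1 :+ con 0) :+ con 1) refl
denominator-suc b (suc (suc n)) = trans
  (cong₂ (λ d m → proj₁ b 0 ℕ.* d ℕ.+ m) (denominator-suc (tail b) (suc n)) (numerator-suc (tail b) (suc n)))
  (eq (proj₁ b 0) (proj₁ b (2 ℕ.+ n)) (denominator (tail b) (suc n)) (denominator (tail b) n)
      (numerator (tail b) (suc n)) (numerator (tail b) n))
  where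
  open ℕ.+-*-Solver
  eq : ∀ c e d₁ d₀ m₁ m₀ → c ℕ.* (e ℕ.* d₁ ℕ.+ d₀) ℕ.+ (e ℕ.* m₁ ℕ.+ m₀) ≡ e ℕ.* (c ℕ.* d₁ ℕ.+ m₁) ℕ.+ (c ℕ.* d₀ ℕ.+ m₀)
  eq = solve 6 (λ c e d₁ d₀ m₁ m₀ →
    c :* (e :* d₁ :+ d₀) :+ (e :* m₁ :+ m₀) := e :* (c :* d₁ :+ m₁) :+ (c :* d₀ :+ m₀)) refl
numerator-suc b zero = sym (cong (ℕ._+ 1) (ℕ.*-zeroʳ (proj₁ b 0)))
numerator-suc b (suc zero) = denominator-suc (tail b) zero
numerator-suc b (suc (suc n)) = denominator-suc (tail b) (suc n)

-- Over the natural numbers the sign (-1)ⁿ of the determinant becomes a disjunction. Passing to the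
-- tail exchanges numerators with denominators and hence the two cases.
determinant : ∀ b n →
  numerator b (suc n) ℕ.* denominator b n ≡ numerator b n ℕ.* denominator b (suc n) ℕ.+ 1 ⊎
  numerator b n ℕ.* denominator b (suc n) ≡ numerator b (suc n) ℕ.* denominator b n ℕ.+ 1
determinant b zero    = inj₁ refl
determinant b (suc n) = Sum.swap (Sum.map shift₁ shift₂ (determinant (tail b) n))
  where
  open ≡-Reasoning
  c = proj₁ b 0
  D₀ = denominator (tail b) n
  D₁ = denominator (tail b) (suc n)
  N₀ = numerator (tail b) n
  N₁ = numerator (tail b) (suc n)
  open ℕ.+-*-Solver
  expand₁ : ∀ c x y z → x ℕ.* (c ℕ.* y ℕ.+ z) ≡ c ℕ.* (x ℕ.* y) ℕ.+ z ℕ.* x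
  expand₁ = solve 4 (λ c x y z → x :* (c :* y :+ z) := c :* (x :* y) :+ z :* x) refl
  expand₂ : ∀ c x y z → c ℕ.* (x ℕ.* y) ℕ.+ (z ℕ.+ 1) ≡ c ℕ.* (y ℕ.* x) ℕ.+ z ℕ.+ 1
  expand₂ = solve 4 (λ c x y z → c :* (x :* y) :+ (z :+ con 1) := c :* (y :* x) :+ z :+ con 1) refl
  step : ∀ x y m k → m ℕ.* x ≡ k ℕ.* y ℕ.+ 1 →
         x ℕ.* (c ℕ.* y ℕ.+ m) ≡ y ℕ.* (c ℕ.* x ℕ.+ k) ℕ.+ 1
  step x y m k eq = begin
    x ℕ.* (c ℕ.* y ℕ.+ m)                       ≡⟨ expand₁ c x y m ⟩
    c ℕ.* (x ℕ.* y) ℕ.+ m ℕ.* x                 ≡⟨ cong (c ℕ.* (x ℕ.* y) ℕ.+_) eq ⟩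
    c ℕ.* (x ℕ.* y) ℕ.+ (k ℕ.* y ℕ.+ 1)         ≡⟨ expand₂ c x y (k ℕ.* y) ⟩
    c ℕ.* (y ℕ.* x) ℕ.+ k ℕ.* y ℕ.+ 1           ≡⟨ cong (ℕ._+ 1) (expand₁ c y x k) ⟨
    y ℕ.* (c ℕ.* x ℕ.+ k) ℕ.+ 1                 ∎
  shift₁ : N₁ ℕ.* D₀ ≡ N₀ ℕ.* D₁ ℕ.+ 1 → D₀ ℕ.* (c ℕ.* D₁ ℕ.+ N₁) ≡ D₁ ℕ.* (c ℕ.* D₀ ℕ.+ N₀) ℕ.+ 1
  shift₁ = step D₀ D₁ N₁ N₀
  shift₂ : N₀ ℕ.* D₁ ≡ N₁ ℕ.* D₀ ℕ.+ 1 → D₁ ℕ.* (c ℕ.* D₀ ℕ.+ N₀) ≡ D₀ ℕ.* (c ℕ.* D₁ ℕ.+ N₁) ℕ.+ 1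
  shift₂ = step D₁ D₀ N₀ N₁

convergent*denominator : ∀ b n → convergent b n ℚ.* fromℕ (denominator b n) ≡ fromℕ (numerator b n)
convergent*denominator b zero    = refl
convergent*denominator b (suc n) = begin
  1/s ℚ.* fromℕ (c ℕ.* D ℕ.+ N)
    ≡⟨ cong (1/s ℚ.*_) (trans (fromℕ-+ (c ℕ.* D) N)
         (cong₂ ℚ._+_ (fromℕ-* c D) (sym (convergent*denominator (tail b) n)))) ⟩
  1/s ℚ.* (fromℕ c ℚ.* fromℕ D ℚ.+ r ℚ.* fromℕ D)
    ≡⟨ cong (1/s ℚ.*_) (ℚ.*-distribʳ-+ (fromℕ D) (fromℕ c) r) ⟨
  1/s ℚ.* (s ℚ.* fromℕ D)
    ≡⟨ ℚ.*-assoc 1/s s (fromℕ D) ⟨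
  1/s ℚ.* s ℚ.* fromℕ D
    ≡⟨ cong (ℚ._* fromℕ D) (ℚ.*-inverseˡ s {{s≢0}}) ⟩
  1ℚ ℚ.* fromℕ D
    ≡⟨ ℚ.*-identityˡ (fromℕ D) ⟩
  fromℕ D ∎
  where
  open ≡-Reasoning
  c = proj₁ b 0
  D = denominator (tail b) n
  N = numerator (tail b) n
  r = convergent (tail b) n
  s = fromℕ c ℚ.+ r
  1/s = convergent b (suc n)
  s≢0 : ℚ.NonZero s
  s≢0 = ℚ.pos⇒nonZero s {{ℚ.pos+nonNeg⇒pos (fromℕ c) {{ℚ.normalize-pos c 1 {{_}} {{proj₂ b 0}}}}
    r {{proj₂ (finite (tail b) n)}}}}

convergent≡ : ∀ b n → convergent b n ≡ (+ numerator b n ℚ./ denominator b n) {{denominator≢0 b n}}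
convergent≡ b n = *-cancelʳ-≡ (fromℕ-pos D) (trans (convergent*denominator b n) (sym (cancel D)))
  where
  N = numerator b n
  D = denominator b n
  instance
    D≢0 : NonZero D
    D≢0 = denominator≢0 b n
  cancel : ∀ d .{{_ : NonZero d}} → (+ N ℚ./ d) ℚ.* fromℕ d ≡ fromℕ N
  cancel (suc d) = trans (cong (ℚ._* fromℕ (suc d)) (sym (k*1/d N d)))
    (trans (ℚ.*-assoc (fromℕ N) (1/ℕ (suc d)) (fromℕ (suc d)))
      (trans (cong (fromℕ N ℚ.*_) (1/k*k≡1 (suc d))) (ℚ.*-identityʳ (fromℕ N))))

convergentDenominator≡ : ∀ b n → convergentDenominator b n ≡ denominator b n
convergentDenominator≡ b n = trans (cong ↧ₙ_ (convergent≡ b n))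
  (lowest (denominator b n) {{denominator≢0 b n}} (coprime b n))
  where
  lowest : ∀ {m} d .{{_ : NonZero d}} → Coprime m d → ↧ₙ (+ m ℚ./ d) ≡ d
  lowest (suc d) c = cong ↧ₙ_ (ℚ.normalize-coprime c)

-- Here c n stands for the partial quotient bₙ₊₁, and x n for the convergent of denominator Q n.
record Approximants (c : ℕ → ℕ) (x : ℕ → ℚ) (Q : ℕ → ℕ) : Set where
  field
    c≢0      : ∀ n → NonZero (c n)
    Q≢0      : ∀ n → NonZero (Q n)
    Q-zero   : Q 0 ≡ 1
    Q-suc    : ∀ n → Q (suc n) ≡ c n ℕ.* Q n ℕ.+ previous Q 0 n
    fraction : ∀ n → ∃[ p ] (p ℚ./ Q n) {{Q≢0 n}} ≡ x n
    lowest   : ∀ {n} p q .{{_ : NonZero q}} → p ℚ./ q ≡ x n → Q n ℕ.≤ q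
    mean     : ∀ n → x (2 ℕ.+ n) ℚ.* fromℕ (Q (2 ℕ.+ n)) ≡
                     x (suc n) ℚ.* fromℕ (c (suc n) ℕ.* Q (suc n)) ℚ.+ x n ℚ.* fromℕ (Q n)

  gap : ℕ → ℚ
  gap n = 1/ℕ (Q n ℕ.* Q (suc n)) {{ℕ.m*n≢0 (Q n) (Q (suc n)) {{Q≢0 n}} {{Q≢0 (suc n)}}}}

  field
    adjacent : ∀ n → x (suc n) ≡ x n ℚ.+ gap n ⊎ x n ≡ x (suc n) ℚ.+ gap n

module Convergents (b : PartialQuotients) where

  private
    N D : ℕ → ℕ
    N = numerator b
    D = denominator b
    instance
      D≢0 : ∀ {n} → NonZero (D n)
      D≢0 {n} = denominator≢0 b n

    x : ℕ → ℚ
    x = convergent b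

    Q : ℕ → ℕ
    Q = convergentDenominator b

  Q-suc : ∀ n → Q (suc n) ≡ proj₁ b n ℕ.* Q n ℕ.+ previous Q 0 n
  Q-suc n = trans (convergentDenominator≡ b (suc n)) (trans (denominator-suc b n)
    (cong₂ (λ d e → proj₁ b n ℕ.* d ℕ.+ e) (sym (convergentDenominator≡ b n)) (previous≡ n)))
    where
    previous≡ : ∀ n → previous D 0 n ≡ previous Q 0 n
    previous≡ zero    = refl
    previous≡ (suc n) = sym (convergentDenominator≡ b n)

  x*Q : ∀ n → x n ℚ.* fromℕ (Q n) ≡ fromℕ (N n)
  x*Q n = trans (cong (λ d → x n ℚ.* fromℕ d) (convergentDenominator≡ b n)) (convergent*denominator b n)

  x-suc² : ∀ n → x (2 ℕ.+ n) ℚ.* fromℕ (Q (2 ℕ.+ n)) ≡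
           x (suc n) ℚ.* fromℕ (proj₁ b (suc n) ℕ.* Q (suc n)) ℚ.+ x n ℚ.* fromℕ (Q n)
  x-suc² n = begin
    x (2 ℕ.+ n) ℚ.* fromℕ (Q (2 ℕ.+ n))
      ≡⟨ x*Q (2 ℕ.+ n) ⟩
    fromℕ (N (2 ℕ.+ n))
      ≡⟨ cong fromℕ (numerator-suc b (suc n)) ⟩
    fromℕ (c ℕ.* N (suc n) ℕ.+ N n)
      ≡⟨ trans (fromℕ-+ (c ℕ.* N (suc n)) (N n)) (cong (ℚ._+ fromℕ (N n)) (fromℕ-* c (N (suc n)))) ⟩
    fromℕ c ℚ.* fromℕ (N (suc n)) ℚ.+ fromℕ (N n)
      ≡⟨ cong₂ (λ y z → fromℕ c ℚ.* y ℚ.+ z) (x*Q (suc n)) (x*Q n) ⟨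
    fromℕ c ℚ.* (x (suc n) ℚ.* fromℕ (Q (suc n))) ℚ.+ x n ℚ.* fromℕ (Q n)
      ≡⟨ cong (ℚ._+ x n ℚ.* fromℕ (Q n)) (trans (*-swap (fromℕ c) (x (suc n)) (fromℕ (Q (suc n))))
           (cong (x (suc n) ℚ.*_) (sym (fromℕ-* c (Q (suc n)))))) ⟩
    x (suc n) ℚ.* fromℕ (c ℕ.* Q (suc n)) ℚ.+ x n ℚ.* fromℕ (Q n) ∎
    where
    open ≡-Reasoning
    c = proj₁ b (suc n)

  instance
    Q*Q≢0 : ∀ {m n} → NonZero (Q m ℕ.* Q n)
    Q*Q≢0 {m} {n} = ℕ.m*n≢0 (Q m) (Q n)

  gap : ℕ → ℚ
  gap n = 1/ℕ (Q n ℕ.* Q (suc n))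

  adjacent : ∀ n → x (suc n) ≡ x n ℚ.+ gap n ⊎ x n ≡ x (suc n) ℚ.+ gap n
  adjacent n = Sum.map (cancel n (suc n)) (cancelled n) det
    where
    open ≡-Reasoning
    det : N (suc n) ℕ.* Q n ≡ N n ℕ.* Q (suc n) ℕ.+ 1 ⊎ N n ℕ.* Q (suc n) ≡ N (suc n) ℕ.* Q n ℕ.+ 1
    det = subst₂ (λ d e → N (suc n) ℕ.* d ≡ N n ℕ.* e ℕ.+ 1 ⊎ N n ℕ.* e ≡ N (suc n) ℕ.* d ℕ.+ 1)
      (sym (convergentDenominator≡ b n)) (sym (convergentDenominator≡ b (suc n))) (determinant b n)
    x*QQ : ∀ i j → x i ℚ.* fromℕ (Q i ℕ.* Q j) ≡ fromℕ (N i ℕ.* Q j)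
    x*QQ i j = trans (cong (x i ℚ.*_) (fromℕ-* (Q i) (Q j)))
      (trans (sym (ℚ.*-assoc (x i) (fromℕ (Q i)) (fromℕ (Q j))))
        (trans (cong (ℚ._* fromℕ (Q j)) (x*Q i)) (sym (fromℕ-* (N i) (Q j)))))
    cancel : ∀ i j → N j ℕ.* Q i ≡ N i ℕ.* Q j ℕ.+ 1 → x j ≡ x i ℚ.+ 1/ℕ (Q i ℕ.* Q j)
    cancel i j eq = *-cancelʳ-≡ (fromℕ-pos (Q i ℕ.* Q j)) (begin
      x j ℚ.* fromℕ (Q i ℕ.* Q j)                         ≡⟨ cong (λ z → x j ℚ.* fromℕ z) (ℕ.*-comm (Q i) (Q j)) ⟩
      x j ℚ.* fromℕ (Q j ℕ.* Q i)                         ≡⟨ x*QQ j i ⟩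
      fromℕ (N j ℕ.* Q i)                                 ≡⟨ cong fromℕ eq ⟩
      fromℕ (N i ℕ.* Q j ℕ.+ 1)                           ≡⟨ fromℕ-+ (N i ℕ.* Q j) 1 ⟩
      fromℕ (N i ℕ.* Q j) ℚ.+ 1ℚ                          ≡⟨ cong₂ ℚ._+_ (x*QQ i j) (1/k*k≡1 (Q i ℕ.* Q j)) ⟨
      x i ℚ.* M ℚ.+ 1/ℕ (Q i ℕ.* Q j) ℚ.* M               ≡⟨ ℚ.*-distribʳ-+ M (x i) (1/ℕ (Q i ℕ.* Q j)) ⟨
      (x i ℚ.+ 1/ℕ (Q i ℕ.* Q j)) ℚ.* M                   ∎)
      where M = fromℕ (Q i ℕ.* Q j)
    1/ℕ-cong : ∀ {m n} .{{_ : NonZero m}} .{{_ : NonZero n}} → m ≡ n → 1/ℕ m ≡ 1/ℕ n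
    1/ℕ-cong refl = refl
    cancelled : ∀ n → N n ℕ.* Q (suc n) ≡ N (suc n) ℕ.* Q n ℕ.+ 1 → x n ≡ x (suc n) ℚ.+ gap n
    cancelled n eq = trans (cancel (suc n) n eq)
      (cong (x (suc n) ℚ.+_) (1/ℕ-cong (ℕ.*-comm (Q (suc n)) (Q n))))

  approximants : Approximants (proj₁ b) (convergent b) (convergentDenominator b)
  approximants = record
    { c≢0      = proj₂ b
    ; Q≢0      = λ _ → _
    ; Q-zero   = refl
    ; Q-suc    = Q-suc
    ; fraction = λ n → ↥ convergent b n , ℚ.↥p/↧p≡p (convergent b n)
    ; lowest   = λ p q eq → subst (λ r → ↧ₙ r ℕ.≤ q) eq (↧ₙ[i/n]≤n p q)
    ; mean     = x-suc²
    ; adjacent = adjacent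
    }

module ApproximantsProperties {c x Q} (A : Approximants c x Q) where
  open Approximants A

  instance
    cₙ≢0 : ∀ {n} → NonZero (c n)
    cₙ≢0 {n} = c≢0 n

    Qₙ≢0 : ∀ {n} → NonZero (Q n)
    Qₙ≢0 {n} = Q≢0 n

    Q*Q≢0 : ∀ {m n} → NonZero (Q m ℕ.* Q n)
    Q*Q≢0 {m} {n} = ℕ.m*n≢0 (Q m) (Q n)

    c*Q≢0 : ∀ {m n} → NonZero (c m ℕ.* Q n)
    c*Q≢0 {m} {n} = ℕ.m*n≢0 (c m) (Q n)

  k : ℕ → ℕ
  k n = c n ℕ.* (Q n ℕ.* Q n)

  instance
    k≢0 : ∀ {n} → NonZero (k n)
    k≢0 {n} = ℕ.m*n≢0 (c n) (Q n ℕ.* Q n)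

    8k≢0 : ∀ {n} → NonZero (8 ℕ.* k n)
    8k≢0 {n} = ℕ.m*n≢0 8 (k n)

  c≥1 : ∀ n → 1 ℕ.≤ c n
  c≥1 n = ℕ.>-nonZero⁻¹ (c n)

  c*Q≤Q : ∀ n → c n ℕ.* Q n ℕ.≤ Q (suc n)
  c*Q≤Q n = subst (c n ℕ.* Q n ℕ.≤_) (sym (Q-suc n)) (ℕ.m≤m+n _ _)

  Q≤cQ : ∀ n → Q n ℕ.≤ c n ℕ.* Q n
  Q≤cQ n = subst (ℕ._≤ c n ℕ.* Q n) (ℕ.*-identityˡ (Q n)) (ℕ.*-monoˡ-≤ (Q n) (c≥1 n))

  Q≤Q-suc : ∀ n → Q n ℕ.≤ Q (suc n)
  Q≤Q-suc n = ℕ.≤-trans (Q≤cQ n) (c*Q≤Q n)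

  Q-mono : ∀ {m n} → m ℕ.≤ n → Q m ℕ.≤ Q n
  Q-mono {m} m≤n = subst (λ k → Q m ℕ.≤ Q k) (ℕ.m+[n∸m]≡n m≤n) (climb _)
    where
    climb : ∀ j → Q m ℕ.≤ Q (m ℕ.+ j)
    climb zero    = ℕ.≤-reflexive (cong Q (sym (ℕ.+-identityʳ m)))
    climb (suc j) = ℕ.≤-trans (climb j) (subst (λ k → Q (m ℕ.+ j) ℕ.≤ Q k) (sym (ℕ.+-suc m j)) (Q≤Q-suc (m ℕ.+ j)))

  Q+Q≤Q-suc² : ∀ n → Q (suc n) ℕ.+ Q n ℕ.≤ Q (2 ℕ.+ n)
  Q+Q≤Q-suc² n = subst (Q (suc n) ℕ.+ Q n ℕ.≤_) (sym (Q-suc (suc n))) (ℕ.+-monoˡ-≤ (Q n) (Q≤cQ (suc n)))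

  2Q≤Q-suc² : ∀ n → 2 ℕ.* Q n ℕ.≤ Q (2 ℕ.+ n)
  2Q≤Q-suc² n = ℕ.≤-trans (ℕ.+-mono-≤ (Q≤Q-suc n) (ℕ.≤-reflexive (ℕ.+-identityʳ (Q n)))) (Q+Q≤Q-suc² n)

  Q-suc≤2cQ : ∀ n → Q (suc n) ℕ.≤ 2 ℕ.* (c n ℕ.* Q n)
  Q-suc≤2cQ n = subst (ℕ._≤ 2 ℕ.* (c n ℕ.* Q n)) (sym (Q-suc n)) (ℕ.+-monoʳ-≤ (c n ℕ.* Q n)
    (ℕ.≤-trans (previous≤ n) (ℕ.≤-trans (Q≤cQ n) (ℕ.m≤m+n _ 0))))
    where
    previous≤ : ∀ n → previous Q 0 n ℕ.≤ Q n
    previous≤ zero    = ℕ.z≤n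
    previous≤ (suc n) = Q≤Q-suc n

  -- An explicit growth rate: any threshold for denominators can be used as a threshold for indices.
  -- It rests on Q (n + 2) ≥ Q (n + 1) + Q n.
  n≤Q : ∀ n → n ℕ.≤ Q n
  n≤Q zero          = ℕ.z≤n
  n≤Q (suc zero)    = ℕ.>-nonZero⁻¹ (Q 1)
  n≤Q (suc (suc n)) = ℕ.≤-trans (subst (ℕ._≤ Q (suc n) ℕ.+ Q n) (ℕ.+-comm (suc n) 1)
    (ℕ.+-mono-≤ (n≤Q (suc n)) (ℕ.>-nonZero⁻¹ (Q n)))) (Q+Q≤Q-suc² n)

  weights : ∀ r m → r ℚ.* fromℕ (Q (2 ℕ.+ m)) ≡ r ℚ.* fromℕ (c (suc m) ℕ.* Q (suc m)) ℚ.+ r ℚ.* fromℕ (Q m)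
  weights r m = trans (cong (r ℚ.*_) (trans (cong fromℕ (Q-suc (suc m))) (fromℕ-+ (c (suc m) ℕ.* Q (suc m)) (Q m))))
    (ℚ.*-distribˡ-+ r (fromℕ (c (suc m) ℕ.* Q (suc m))) (fromℕ (Q m)))

  -- Each convergent is a weighted mean of the two preceding ones.
  above-all : ∀ {r} n → r ℚ.< x n → r ℚ.< x (suc n) → ∀ j → r ℚ.< x (j ℕ.+ n)
  below-all : ∀ {r} n → x n ℚ.< r → x (suc n) ℚ.< r → ∀ j → x (j ℕ.+ n) ℚ.< r
  above-all         n r<xₙ _ zero       = r<xₙ
  above-all         n _ r<xₙ₊₁ (suc zero) = r<xₙ₊₁
  above-all {r} n p q (suc (suc j)) = *-cancelʳ-< (fromℕ-pos (Q (2 ℕ.+ m)))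
    (subst₂ ℚ._<_ (sym (weights r m)) (sym (mean m))
      (ℚ.+-mono-< (*-monoˡ-< (fromℕ-pos (c (suc m) ℕ.* Q (suc m))) (above-all n p q (suc j)))
                   (*-monoˡ-< (fromℕ-pos (Q m)) (above-all n p q j))))
    where m = j ℕ.+ n
  below-all         n xₙ<r _ zero       = xₙ<r
  below-all         n _ xₙ₊₁<r (suc zero) = xₙ₊₁<r
  below-all {r} n p q (suc (suc j)) = *-cancelʳ-< (fromℕ-pos (Q (2 ℕ.+ m)))
    (subst₂ ℚ._<_ (sym (mean m)) (sym (weights r m))
      (ℚ.+-mono-< (*-monoˡ-< (fromℕ-pos (c (suc m) ℕ.* Q (suc m))) (below-all n p q (suc j)))
                   (*-monoˡ-< (fromℕ-pos (Q m)) (below-all n p q j))))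
    where m = j ℕ.+ n

  adjacent-close : ∀ n {e} → gap n ℚ.< e → x n ℚ.- e ℚ.< x (suc n) × x (suc n) ℚ.< x n ℚ.+ e
  adjacent-close n {e} g<e = Sum.[ up , down ]′ (adjacent n)
    where
    open +-*-Solver
    0<g : 0ℚ ℚ.< gap n
    0<g = 1/ℕ-pos (Q n ℕ.* Q (suc n))
    0<e : 0ℚ ℚ.< e
    0<e = ℚ.<-trans 0<g g<e
    up : x (suc n) ≡ x n ℚ.+ gap n → _
    up eq = subst (λ z → x n ℚ.- e ℚ.< z × z ℚ.< x n ℚ.+ e) (sym eq)
      (<-transport (eq₁ (x n) e (gap n)) (+-pos 0<g 0<e) , ℚ.+-monoʳ-< (x n) g<e)
      where
      eq₁ : ∀ x e g → g ℚ.+ e ℚ.- 0ℚ ≡ x ℚ.+ g ℚ.- (x ℚ.- e)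
      eq₁ = solve 3 (λ x e g → g :+ e :- con 0ℚ := x :+ g :- (x :- e)) refl
    down : x n ≡ x (suc n) ℚ.+ gap n → _
    down eq = subst (λ z → z ℚ.- e ℚ.< x (suc n) × x (suc n) ℚ.< z ℚ.+ e) (sym eq)
      (<-transport (eq₁ (x (suc n)) e (gap n)) g<e , <-transport (eq₂ (x (suc n)) e (gap n)) (+-pos 0<g 0<e))
      where
      eq₁ : ∀ x e g → e ℚ.- g ≡ x ℚ.- (x ℚ.+ g ℚ.- e)
      eq₁ = solve 3 (λ x e g → e :- g := x :- (x :+ g :- e)) refl
      eq₂ : ∀ x e g → g ℚ.+ e ℚ.- 0ℚ ≡ x ℚ.+ g ℚ.+ e ℚ.- x
      eq₂ = solve 3 (λ x e g → g :+ e :- con 0ℚ := x :+ g :+ e :- x) refl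

  -- Both bounds hold for two consecutive convergents, and taking weighted means preserves them.
  close : ∀ n {e} → gap n ℚ.< e → ∀ m → n ℕ.≤ m → x n ℚ.- e ℚ.< x m × x m ℚ.< x n ℚ.+ e
  close n {e} g<e m n≤m = subst (λ k → x n ℚ.- e ℚ.< x k × x k ℚ.< x n ℚ.+ e) (ℕ.m∸n+n≡m n≤m)
    (above-all n x-e<x (proj₁ (adjacent-close n g<e)) (m ℕ.∸ n) ,
     below-all n (p<p+q (x n) 0<e) (proj₂ (adjacent-close n g<e)) (m ℕ.∸ n))
    where
    0<e = ℚ.<-trans (1/ℕ-pos (Q n ℕ.* Q (suc n))) g<e
    x-e<x : x n ℚ.- e ℚ.< x n
    x-e<x = subst (x n ℚ.- e ℚ.<_) (p-q+q≡p (x n) e) (p<p+q (x n ℚ.- e) 0<e)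

-- Approximation by convergents

-- The rational 1 / m separates the two sides.
⁻¹-<-distance : (X : ℝ⁺) (d : ℝ) → ∀ m .{{_ : NonZero m}} → L (proj₁ X) (fromℕ m) → L d (1/ℕ m) → proj₁ (X ⁻¹) < d
⁻¹-<-distance X d m Lm Ld =
  let s , m<s , Ls = L-open (proj₁ X) Lm
  in 1/ℕ m , (s , ℚ.<-trans (fromℕ-pos m) m<s , Ls ,
     subst (ℚ._< 1/ℕ m ℚ.* s) (1/k*k≡1 m) (*-monoʳ-< (1/ℕ-pos m) m<s)) , Ld

-- The hypothesis on d amounts to d ≤ 1 / m, which is how |θ - xₙ| ≤ 1 / kₙ is available; the
-- strictness of the conclusion comes from X < m.
distance-<-⁻¹ : (X : ℝ⁺) (d : ℝ) → ∀ m .{{_ : NonZero m}} → U (proj₁ X) (fromℕ m) →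
  (∀ {r} → 1/ℕ m ℚ.< r → U d r) → d < proj₁ (X ⁻¹)
distance-<-⁻¹ X d m Um Ud =
  let t , t<m , Ut = U-open (proj₁ X) Um
      0<t = U⇒pos X Ut
      v , 1/m*t<v , v<1 = ℚ.<-dense (subst (1/ℕ m ℚ.* t ℚ.<_) (1/k*k≡1 m) (*-monoʳ-< (1/ℕ-pos m) t<m))
      r , rt≡v = divide v 0<t
  in r , Ud (*-cancelʳ-< 0<t (subst (1/ℕ m ℚ.* t ℚ.<_) (sym rt≡v) 1/m*t<v)) ,
     t , Ut , subst (ℚ._< 1ℚ) (sym rt≡v) v<1

distance-≮-⁻¹ : (X : ℝ⁺) (d : ℝ) → ∀ m .{{_ : NonZero m}} → U (proj₁ X) (fromℕ m) →
  (∀ {r} → 1/ℕ m ℚ.< r → U d r) → ¬ (proj₁ (X ⁻¹) < d)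
distance-≮-⁻¹ X d m Um Ud X⁻¹<d = <⇒≤ {d} {proj₁ (X ⁻¹)} (distance-<-⁻¹ X d m Um Ud) X⁻¹<d

-- The common shape of `ExponentBound` and `BaseBound` at a fixed ε, so that one proof serves both.
TailBound : (ℝ≥1 → ℝ⁺) → ℝ → Set
TailBound V θ = Σ[ q₀ ∈ ℕ ] 0 ℕ.< q₀ × ((p : ℤ) (q : ℕ) .{{_ : NonZero q}} → q₀ ℕ.≤ q →
  proj₁ (V (fromℕ≥1 q) ⁻¹) < distance θ p q)

-- A rational r can be rewritten with denominator q₀ · `↧ₙ r`, past the threshold; if θ were r, its
-- distance to this fraction would be zero and yet positive.
tailBound⇒irrational : ∀ V θ → TailBound V θ → Irrational θ
tailBound⇒irrational V θ (q₀ , 0<q₀ , bound) r (θ≤r , r≤θ) =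
  let s , (t , 0<t , _ , 1<st) , Ls = bound p q (ℕ.m≤m*n q₀ (↧ₙ r))
      0<s = *-cancelʳ-< 0<t (subst (ℚ._< s ℚ.* t) (sym (ℚ.*-zeroˡ t)) (ℚ.<-trans 0<1 1<st))
  in Sum.[ (λ Lθ → θ≤r (_ , p<p+q r 0<s , Lθ))
         , (λ Uθ → r≤θ (_ , Uθ , subst (r ℚ.- s ℚ.<_) (p-q+q≡p r s) (p<p+q (r ℚ.- s) 0<s)))
         ]′ (L-distance⁻¹ θ (subst (λ c → L ∣ θ - fromℚ c ∣ s) p/q≡r Ls))
  where
  instance
    q₀≢0 : NonZero q₀
    q₀≢0 = ℕ.>-nonZero 0<q₀
  p = + q₀ ℤ.* ↥ r
  q = q₀ ℕ.* ↧ₙ r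
  instance
    q≢0 : NonZero q
    q≢0 = ℕ.m*n≢0 q₀ (↧ₙ r)
  p/q≡r : p ℚ./ q ≡ r
  p/q≡r = trans (/-cong-≡ p q (↥ r) (↧ₙ r) (begin
    + q₀ ℤ.* ↥ r ℤ.* ↧ r         ≡⟨ cong (ℤ._* ↧ r) (ℤ.*-comm (+ q₀) (↥ r)) ⟩
    ↥ r ℤ.* + q₀ ℤ.* ↧ r         ≡⟨ ℤ.*-assoc (↥ r) (+ q₀) (↧ r) ⟩
    ↥ r ℤ.* (+ q₀ ℤ.* ↧ r)       ≡⟨ cong (↥ r ℤ.*_) (ℤ.pos-* q₀ (↧ₙ r)) ⟨
    ↥ r ℤ.* + q                  ∎)) (ℚ.↥p/↧p≡p r)
    where open ≡-Reasoning

-- If one of y, z is at most p, the other is less than d away and so below q. This yields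
-- locatedness of `limit`.
separate : ∀ {p q y z} d → p ℚ.+ d ≡ q → p ℚ.< q → y ℚ.- d ℚ.< z → z ℚ.< y ℚ.+ d →
           (p ℚ.< y × p ℚ.< z) ⊎ (y ℚ.< q × z ℚ.< q)
separate {p} {q} {y} {z} d p+d≡q p<q y-d<z z<y+d with p ℚ.<? y | p ℚ.<? z
... | yes p<y | yes p<z = inj₁ (p<y , p<z)
... | no  p≮y | _       = inj₂ (ℚ.≤-<-trans (ℚ.≮⇒≥ p≮y) p<q ,
  ℚ.<-≤-trans z<y+d (subst (y ℚ.+ d ℚ.≤_) p+d≡q (ℚ.+-monoˡ-≤ d {y} {p} (ℚ.≮⇒≥ p≮y))))
... | yes _   | no  p≮z = inj₂ (subst₂ ℚ._<_ (p-q+q≡p y d) p+d≡q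
  (ℚ.+-monoˡ-< d {y ℚ.- d} {p} (ℚ.<-≤-trans y-d<z (ℚ.≮⇒≥ p≮z))) , ℚ.≤-<-trans (ℚ.≮⇒≥ p≮z) p<q)

Apart : ∀ (p : ℤ) q m .{{_ : NonZero q}} .{{_ : NonZero m}} → ℚ → Set
Apart p q m y = (p ℚ./ q ℚ.+ g ℚ.≤ y ⊎ y ℚ.+ g ℚ.≤ p ℚ./ q) ⊎ p ℚ./ q ≡ y
  where g = 1/ℕ (q ℕ.* m) {{ℕ.m*n≢0 q m}}

fractions-apart : ∀ p q a m .{{_ : NonZero q}} .{{_ : NonZero m}} → Apart p q m (a ℚ./ m)
fractions-apart p q a m with ℤ.<-cmp (p ℤ.* + m) (a ℤ.* + q)
... | tri< lt _ _ = inj₁ (inj₁ (/-gap p q a m lt))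
... | tri≈ _ eq _ = inj₂ (/-cong-≡ p q a m eq)
... | tri> _ _ gt = inj₁ (inj₂ (subst (λ g → a ℚ./ m ℚ.+ g ℚ.≤ p ℚ./ q) comm (/-gap a m p q gt)))
  where
  comm : 1/ℕ (m ℕ.* q) {{ℕ.m*n≢0 m q}} ≡ 1/ℕ (q ℕ.* m) {{ℕ.m*n≢0 q m}}
  comm = trans (1/ℕ-* m q) (trans (ℚ.*-comm (1/ℕ m) (1/ℕ q)) (sym (1/ℕ-* q m)))

module _ {c x Q} (A : Approximants c x Q) where
  open Approximants A
  open ApproximantsProperties A

  gap-vanishes : ∀ {e} → 0ℚ ℚ.< e → ∃[ N ] ∀ n → N ℕ.≤ n → gap n ℚ.< e
  gap-vanishes {e} 0<e =
    let N , 1≤Ne = archimedean 1ℚ 0<e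
        1/N<e : 1/ℕ (suc N) ℚ.< e
        1/N<e = *-cancelʳ-< (fromℕ-pos (suc N)) (subst₂ ℚ._<_ (sym (1/k*k≡1 (suc N))) (ℚ.*-comm (fromℕ (suc N)) e)
          (ℚ.≤-<-trans 1≤Ne (*-monoˡ-< 0<e (fromℕ-mono-< (ℕ.n<1+n N)))))
    in N , λ n N≤n → ℚ.≤-<-trans (1/ℕ-antimono-≤ (begin
      suc N                    ≤⟨ ℕ.s≤s N≤n ⟩
      suc n                    ≤⟨ n≤Q (suc n) ⟩
      Q (suc n)                ≤⟨ ℕ.m≤n*m (Q (suc n)) (Q n) ⟩
      Q n ℕ.* Q (suc n)        ∎)) 1/N<e
    where open ℕ.≤-Reasoning

  bracket : ∀ n → ∃[ r ] (r ℚ.< x n × r ℚ.< x (suc n)) × ∃[ s ] (x n ℚ.< s × x (suc n) ℚ.< s)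
  bracket n =
    let g<e = p<p+q (gap n) 0<1
        lo , hi = close n g<e n ℕ.≤-refl
        lo′ , hi′ = close n g<e (suc n) (ℕ.n≤1+n n)
    in _ , (lo , lo′) , _ , (hi , hi′)

  incompatible : ∀ {r} → (∃[ n ] r ℚ.< x n × r ℚ.< x (suc n)) → (∃[ n ] x n ℚ.< r × x (suc n) ℚ.< r) → ⊥
  incompatible {r} (m , lt , lt′) (n , gt , gt′) = ℚ.<-asym (above-all m lt lt′ n)
    (subst (λ k → x k ℚ.< r) (ℕ.+-comm m n) (below-all n gt gt′ m))

  -- Consecutive convergents enclose all later ones, so lying below two consecutive convergents is a
  -- finite certificate for lying below the limit; a single convergent would not do, since it may
  -- exceed the limit.
  limit : ℝ
  limit = record
    { L           = λ r → ∃[ n ] r ℚ.< x n × r ℚ.< x (suc n)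
    ; U           = λ r → ∃[ n ] x n ℚ.< r × x (suc n) ℚ.< r
    ; L-inhabited = let r , <x , _ = bracket 0 in r , 0 , <x
    ; U-inhabited = let _ , _ , r , x< = bracket 0 in r , 0 , x<
    ; L-down      = λ p<q (n , lt , lt′) → n , ℚ.<-trans p<q lt , ℚ.<-trans p<q lt′
    ; U-up        = λ p<q (n , lt , lt′) → n , ℚ.<-trans lt p<q , ℚ.<-trans lt′ p<q
    ; L-open      = λ (n , lt , lt′) → case ℚ.≤-total (x n) (x (suc n)) of λ where
        (inj₁ ≤) → let q , p<q , q< = ℚ.<-dense lt in q , p<q , n , q< , ℚ.<-≤-trans q< ≤
        (inj₂ ≥) → let q , p<q , q< = ℚ.<-dense lt′ in q , p<q , n , ℚ.<-≤-trans q< ≥ , q<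
    ; U-open      = λ (n , lt , lt′) → case ℚ.≤-total (x n) (x (suc n)) of λ where
        (inj₁ ≤) → let q , <q , q<p = ℚ.<-dense lt′ in q , q<p , n , ℚ.≤-<-trans ≤ <q , <q
        (inj₂ ≥) → let q , <q , q<p = ℚ.<-dense lt in q , q<p , n , <q , ℚ.≤-<-trans ≥ <q
    ; disjoint    = incompatible
    ; located     = λ {p} {q} p<q →
        let n , small = gap-vanishes (<⇒0<- p<q)
            lo , hi   = close n (small n ℕ.≤-refl) (suc n) (ℕ.n≤1+n n)
        in Sum.map (n ,_) (n ,_) (separate (q ℚ.- p) (sym (split p q)) p<q lo hi)
    }

  converges-limit : Converges (λ n → fromℚ (x n)) limit
  converges-limit ε (e , 0<e , Le) =
    let N , small = gap-vanishes 0<e in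
    N , λ n N≤n →
      let g<e = small n N≤n
          lo , hi = close n g<e n ℕ.≤-refl
          lo′ , hi′ = close n g<e (suc n) (ℕ.n≤1+n n)
      in e , U-distance′ limit (n , lo , lo′) (n , hi , hi′) , Le

  between : ∀ m → 1 ℕ.≤ m → ∃[ n ] Q n ℕ.≤ m × m ℕ.< Q (suc n)
  between m 1≤m = search (suc m) 0 (subst (ℕ._≤ m) (sym Q-zero) 1≤m)
    (subst (λ j → m ℕ.< Q j) (sym (ℕ.+-identityʳ (suc m))) (n≤Q (suc m)))
    where
    search : ∀ fuel n → Q n ℕ.≤ m → m ℕ.< Q (fuel ℕ.+ n) → ∃[ n ] Q n ℕ.≤ m × m ℕ.< Q (suc n)
    search zero       n Qₙ≤m m<Q = ⊥-elim (ℕ.<⇒≱ m<Q Qₙ≤m)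
    search (suc fuel) n Qₙ≤m m<Q = case m ℕ.<? Q (suc n) of λ where
      (yes m<) → n , Qₙ≤m , m<
      (no  m≮) → search fuel (suc n) (ℕ.≮⇒≥ m≮) (subst (λ j → m ℕ.< Q j) (sym (ℕ.+-suc fuel n)) m<Q)

  gap≤1/k : ∀ n → gap n ℚ.≤ 1/ℕ (k n)
  gap≤1/k n = 1/ℕ-antimono-≤ (begin
    c n ℕ.* (Q n ℕ.* Q n)      ≡⟨ ℕ.*-assoc (c n) (Q n) (Q n) ⟨
    c n ℕ.* Q n ℕ.* Q n        ≤⟨ ℕ.*-monoˡ-≤ (Q n) (c*Q≤Q n) ⟩
    Q (suc n) ℕ.* Q n          ≡⟨ ℕ.*-comm (Q (suc n)) (Q n) ⟩
    Q n ℕ.* Q (suc n)          ∎)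
    where open ℕ.≤-Reasoning

  module _ (θ : ℝ) (xₙ→θ : Converges (λ n → fromℚ (x n)) θ) where

    -- Encodes |θ - xₙ| ≤ `gap n`. For e′ strictly between `gap n` and e, some later convergent is
    -- within e′ of xₙ and within e - e′ of θ.
    near-limit : ∀ n {e} → gap n ℚ.< e → L θ (x n ℚ.- e) × U θ (x n ℚ.+ e)
    near-limit n {e} g<e =
      let e′ , g<e′ , e′<e = ℚ.<-dense g<e
          N , approximates = xₙ→θ (fromℚ (e ℚ.- e′)) (fromℚ-mono-< (<⇒0<- e′<e))
          m = n ℕ.⊔ N
          r , Ur , r<e-e′ = approximates m (ℕ.m≤n⊔m n N)
          lo , hi = U-distance′⁻¹ θ Ur
          lo′ , hi′ = close n g<e′ m (ℕ.m≤m⊔n n N)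
      in L-down θ (<-transport (eq₁ (x n) e e′ (x m) r) (ℚ.+-mono-< lo′ r<e-e′)) lo ,
         U-up θ (<-transport (eq₂ (x n) e e′ (x m) r) (ℚ.+-mono-< hi′ r<e-e′)) hi
      where
      open +-*-Solver
      eq₁ : ∀ y e e′ z r → z ℚ.+ (e ℚ.- e′) ℚ.- (y ℚ.- e′ ℚ.+ r) ≡ z ℚ.- r ℚ.- (y ℚ.- e)
      eq₁ = solve 5 (λ y e e′ z r → z :+ (e :- e′) :- (y :- e′ :+ r) := z :- r :- (y :- e)) refl
      eq₂ : ∀ y e e′ z r → y ℚ.+ e′ ℚ.+ (e ℚ.- e′) ℚ.- (z ℚ.+ r) ≡ y ℚ.+ e ℚ.- (z ℚ.+ r)
      eq₂ = solve 5 (λ y e e′ z r → y :+ e′ :+ (e :- e′) :- (z :+ r) := y :+ e :- (z :+ r)) refl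

    distance-upper : ∀ n {r} → 1/ℕ (k n) ℚ.< r → U ∣ θ - fromℚ (x n) ∣ r
    distance-upper n 1/k<r =
      let lo , hi = near-limit n (ℚ.≤-<-trans (gap≤1/k n) 1/k<r) in U-distance θ lo hi

    -- Here h is half of the guaranteed separation 1 / (q Qₙ). Comparing Q (n + 1) with 2 q instead
    -- of q is what gives `gap n < h`, so the other half is left between θ and p.
    distance-lower-far : ∀ n q .{{_ : NonZero q}} p → Q n ℕ.≤ 2 ℕ.* q → 2 ℕ.* q ℕ.< Q (suc n) →
      let instance _ = ℕ.m*n≢0 q (Q n) ; _ = ℕ.m*n≢0 8 (q ℕ.* q) {{_}} {{ℕ.m*n≢0 q q}} in
      p ℚ.+ 1/ℕ (q ℕ.* Q n) ℚ.≤ x n ⊎ x n ℚ.+ 1/ℕ (q ℕ.* Q n) ℚ.≤ p →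
      L ∣ θ - fromℚ p ∣ (1/ℕ (8 ℕ.* (q ℕ.* q)))
    distance-lower-far n q p Q≤2q 2q<Q = L-distance θ ∘ Sum.map below above
      where
      instance
        qQ≢0 : NonZero (q ℕ.* Q n)
        qQ≢0 = ℕ.m*n≢0 q (Q n)
        2qQ≢0 : NonZero (2 ℕ.* (q ℕ.* Q n))
        2qQ≢0 = ℕ.m*n≢0 2 (q ℕ.* Q n)
        qq≢0 : NonZero (q ℕ.* q)
        qq≢0 = ℕ.m*n≢0 q q
        8qq≢0 : NonZero (8 ℕ.* (q ℕ.* q))
        8qq≢0 = ℕ.m*n≢0 8 (q ℕ.* q)
      h r : ℚ
      h = 1/ℕ (2 ℕ.* (q ℕ.* Q n))
      r = 1/ℕ (8 ℕ.* (q ℕ.* q))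
      h+h : h ℚ.+ h ≡ 1/ℕ (q ℕ.* Q n)
      h+h = 1/ℕ-halve (q ℕ.* Q n)
      open ℕ.≤-Reasoning
      gap<h : gap n ℚ.< h
      gap<h = 1/ℕ-antimono-< (begin-strict
        2 ℕ.* (q ℕ.* Q n)     ≡⟨ ℕ.*-assoc 2 q (Q n) ⟨
        2 ℕ.* q ℕ.* Q n       <⟨ ℕ.*-monoˡ-< (Q n) 2q<Q ⟩
        Q (suc n) ℕ.* Q n     ≡⟨ ℕ.*-comm (Q (suc n)) (Q n) ⟩
        Q n ℕ.* Q (suc n)     ∎)
      r≤h : r ℚ.≤ h
      r≤h = 1/ℕ-antimono-≤ (begin
        2 ℕ.* (q ℕ.* Q n)            ≤⟨ ℕ.*-monoʳ-≤ 2 (ℕ.*-monoʳ-≤ q Q≤2q) ⟩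
        2 ℕ.* (q ℕ.* (2 ℕ.* q))      ≡⟨ solve 1 (λ q → con 2 :* (q :* (con 2 :* q)) := con 4 :* (q :* q)) refl q ⟩
        4 ℕ.* (q ℕ.* q)              ≤⟨ ℕ.*-monoˡ-≤ (q ℕ.* q) (ℕ.m≤m+n 4 4) ⟩
        8 ℕ.* (q ℕ.* q)              ∎)
        where open ℕ.+-*-Solver
      shift : ∀ y z → y ℚ.+ (h ℚ.+ h) ℚ.≤ z → y ℚ.+ h ℚ.≤ z ℚ.- h
      shift y z le = subst (ℚ._≤ z ℚ.- h) (eq y h) (ℚ.+-monoˡ-≤ (ℚ.- h) le)
        where
        open +-*-Solver
        eq : ∀ y h → y ℚ.+ (h ℚ.+ h) ℚ.- h ≡ y ℚ.+ h
        eq = solve 2 (λ y h → y :+ (h :+ h) :- h := y :+ h) refl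
      below : p ℚ.+ 1/ℕ (q ℕ.* Q n) ℚ.≤ x n → L θ (p ℚ.+ r)
      below le = L-down-≤ θ (ℚ.≤-trans (ℚ.+-monoʳ-≤ p r≤h)
        (shift p (x n) (subst (λ g → p ℚ.+ g ℚ.≤ x n) (sym h+h) le))) (proj₁ (near-limit n gap<h))
      above : x n ℚ.+ 1/ℕ (q ℕ.* Q n) ℚ.≤ p → U θ (p ℚ.- r)
      above le = U-up-≤ θ (ℚ.≤-trans (shift (x n) p (subst (λ g → x n ℚ.+ g ℚ.≤ p) (sym h+h) le))
        (ℚ.+-monoʳ-≤ p (ℚ.neg-antimono-≤ r≤h))) (proj₂ (near-limit n gap<h))

    distance-lower-convergent : ∀ n → L ∣ θ - fromℚ (x n) ∣ (1/ℕ (8 ℕ.* k n))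
    distance-lower-convergent n = L-distance θ (Sum.map above below (adjacent n))
      where
      instance
        2QQ≢0 : NonZero (2 ℕ.* (Q n ℕ.* Q (suc n)))
        2QQ≢0 = ℕ.m*n≢0 2 (Q n ℕ.* Q (suc n))
      h r e : ℚ
      h = 1/ℕ (2 ℕ.* (Q n ℕ.* Q (suc n)))
      r = 1/ℕ (8 ℕ.* k n)
      -- A point within e of x (n + 1) is at least r away from xₙ.
      e = gap n ℚ.- r
      open ℕ.≤-Reasoning
      -- Halving the gap and bounding Q (n + 1) by 2 cₙ Qₙ cost a factor 2 each; 8 in place of 4
      -- makes the inequality strict.
      r<h : r ℚ.< h
      r<h = 1/ℕ-antimono-< (begin-strict
        2 ℕ.* (Q n ℕ.* Q (suc n))                  ≤⟨ ℕ.*-monoʳ-≤ 2 (ℕ.*-monoʳ-≤ (Q n) (Q-suc≤2cQ n)) ⟩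
        2 ℕ.* (Q n ℕ.* (2 ℕ.* (c n ℕ.* Q n)))      ≡⟨ regroup (c n) (Q n) ⟩
        4 ℕ.* k n                                  <⟨ ℕ.*-monoˡ-< (k n) (ℕ.m≤m+n 5 3) ⟩
        8 ℕ.* k n                                  ∎)
        where
        open ℕ.+-*-Solver
        regroup : ∀ c q → 2 ℕ.* (q ℕ.* (2 ℕ.* (c ℕ.* q))) ≡ 4 ℕ.* (c ℕ.* (q ℕ.* q))
        regroup = solve 2 (λ c q → con 2 :* (q :* (con 2 :* (c :* q))) := con 4 :* (c :* (q :* q))) refl
      gap-suc≤h : gap (suc n) ℚ.≤ h
      gap-suc≤h = 1/ℕ-antimono-≤ (begin
        2 ℕ.* (Q n ℕ.* Q (suc n))      ≡⟨ ℕ.*-assoc 2 (Q n) (Q (suc n)) ⟨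
        2 ℕ.* Q n ℕ.* Q (suc n)        ≤⟨ ℕ.*-monoˡ-≤ (Q (suc n)) (2Q≤Q-suc² n) ⟩
        Q (2 ℕ.+ n) ℕ.* Q (suc n)      ≡⟨ ℕ.*-comm (Q (2 ℕ.+ n)) (Q (suc n)) ⟩
        Q (suc n) ℕ.* Q (2 ℕ.+ n)      ∎)
      h<e : h ℚ.< e
      h<e = <-transport (trans (eq h r) (cong (λ g → g ℚ.- r ℚ.- h) (1/ℕ-halve (Q n ℕ.* Q (suc n))))) r<h
        where
        open +-*-Solver
        eq : ∀ h r → h ℚ.- r ≡ h ℚ.+ h ℚ.- r ℚ.- h
        eq = solve 2 (λ h r → h :- r := h :+ h :- r :- h) refl
      bounds = near-limit (suc n) (ℚ.≤-<-trans gap-suc≤h h<e)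
      open +-*-Solver
      above : x (suc n) ≡ x n ℚ.+ gap n → L θ (x n ℚ.+ r)
      above eq = subst (L θ) (trans (cong (ℚ._- e) eq) (simplify (x n) (gap n) r)) (proj₁ bounds)
        where
        simplify : ∀ y g r → y ℚ.+ g ℚ.- (g ℚ.- r) ≡ y ℚ.+ r
        simplify = solve 3 (λ y g r → y :+ g :- (g :- r) := y :+ r) refl
      below : x n ≡ x (suc n) ℚ.+ gap n → U θ (x n ℚ.- r)
      below eq = subst (U θ) (trans (simplify (x (suc n)) (gap n) r) (cong (ℚ._- r) (sym eq))) (proj₂ bounds)
        where
        simplify : ∀ y g r → y ℚ.+ (g ℚ.- r) ≡ y ℚ.+ g ℚ.- r
        simplify = solve 3 (λ y g r → y :+ (g :- r) := y :+ g :- r) refl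

    -- The second alternative records two bounds on q: `Q n ≤ q` lets V at Qₙ be compared with V′ at
    -- q, and `2 q < Q (suc n)` forces n to be large when q is.
    distance-lower : ∀ p q .{{_ : NonZero q}} → let instance _ = ℕ.m*n≢0 8 (q ℕ.* q) {{_}} {{ℕ.m*n≢0 q q}} in
      L (distance θ p q) (1/ℕ (8 ℕ.* (q ℕ.* q))) ⊎
      ∃[ n ] 2 ℕ.* q ℕ.< Q (suc n) × Q n ℕ.≤ q × L (distance θ p q) (1/ℕ (8 ℕ.* k n))
    distance-lower p q =
      let n , Q≤2q , 2q<Q = between (2 ℕ.* q) (ℕ.≤-trans (ℕ.>-nonZero⁻¹ q) (ℕ.m≤m+n q _))
          a , a/Q≡x = fraction n
      in Sum.map (distance-lower-far n q (p ℚ./ q) Q≤2q 2q<Q) (λ p/q≡x → n , 2q<Q , lowest p q p/q≡x ,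
           subst (λ y → L ∣ θ - fromℚ y ∣ (1/ℕ (8 ℕ.* k n))) (sym p/q≡x) (distance-lower-convergent n))
         (subst (Apart p q (Q n)) a/Q≡x (fractions-apart p q a (Q n)))

module Approximation {c x Q} (A : Approximants c x Q) (V : ℝ≥1 → ℝ⁺) (θ : ℝ)
  (xₙ→θ : Converges (λ n → fromℚ (x n)) θ)
  (V<k : ∀ n → U (at V (Q n) {{Approximants.Q≢0 A n}}) (fromℕ (ApproximantsProperties.k A n)))
  (k<2V : ∃[ N ] ∀ n → N ℕ.≤ n → ∃[ s ] L (at V (Q n) {{Approximants.Q≢0 A n}}) s ×
          fromℕ (ApproximantsProperties.k A n) ℚ.< fromℕ 2 ℚ.* s)
  where
  open Approximants A
  open ApproximantsProperties A

  approximable : ApproximableToOrder (λ y → V y ⁻¹) θ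
  approximable C 0<C =
    let u , Uu = U-inhabited C
        m , u≤m = ≤-fromℕ u
        n = suc m
        p , p/Q≡x = fraction n
    in p , Q n , Q≢0 n ,
       (u , Uu , ℚ.≤-<-trans u≤m (fromℕ-mono-< (n≤Q n))) ,
       subst (λ y → ∣ θ - fromℚ y ∣ < proj₁ (V (fromℕ≥1 (Q n)) ⁻¹)) (sym p/Q≡x)
         (distance-<-⁻¹ (V (fromℕ≥1 (Q n))) ∣ θ - fromℚ (x n) ∣ (k n) (V<k n) (distance-upper A θ xₙ→θ n))

  -- The threshold q₀ itself serves as the index, since Q q₀ ≥ q₀; at this convergent V′ ≤ V < k
  -- contradicts the bound.
  not-tailBound : ∀ V′ → Bounds V V′ → ¬ TailBound V′ θ
  not-tailBound V′ V′≤V (q₀ , _ , bound) =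
    let p , p/Q≡x = fraction q₀ in
    distance-≮-⁻¹ (V′ (fromℕ≥1 (Q q₀))) ∣ θ - fromℚ (x q₀) ∣ (k q₀) (V′≤V (Q q₀) (V<k q₀))
      (distance-upper A θ xₙ→θ q₀)
      (subst (λ y → proj₁ (V′ (fromℕ≥1 (Q q₀)) ⁻¹) < ∣ θ - fromℚ y ∣) p/Q≡x (bound p (Q q₀) (n≤Q q₀)))

  tailBound : Superquadratic V → ∀ V′ → Dominates V′ V → TailBound V′ θ
  tailBound superquadratic V′ dominates =
    let N , k<2V′ = k<2V
        q₁ , q²<V = superquadratic 1
        -- 16 = 8 · 2, with the 8 of `distance-lower` and the 2 of `k<2V`.
        q₂ , 16V<V′ = dominates 16
    in bound N k<2V′ q₁ q²<V q₂ 16V<V′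
    where
    bound : ∀ N → (∀ n → N ℕ.≤ n → ∃[ s ] L (at V (Q n)) s × fromℕ (k n) ℚ.< fromℕ 2 ℚ.* s) →
            ∀ q₁ → (∀ q .{{_ : NonZero q}} → q₁ ℕ.≤ q → L (at V q) (fromℕ (1 ℕ.* (q ℕ.* q)))) →
            ∀ q₂ → (∀ q .{{_ : NonZero q}} → q₂ ℕ.≤ q → DominatesAt 16 V′ V q) → TailBound V′ θ
    -- `Q N` enters the threshold so that a convergent equal to p / q has an index n ≥ N.
    bound N k<2V q₁ q²<V q₂ 16V<V′ = suc (Q N ℕ.+ (q₁ ℕ.+ q₂)) , ℕ.s≤s ℕ.z≤n , λ p q q₀≤q →
      let Q≤q : Q N ℕ.≤ q
          Q≤q = ℕ.≤-trans (ℕ.≤-trans (ℕ.m≤m+n (Q N) _) (ℕ.n≤1+n _)) q₀≤q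
          q₁≤q : q₁ ℕ.≤ q
          q₁≤q = ℕ.≤-trans (ℕ.≤-trans (ℕ.m≤m+n q₁ q₂) (ℕ.≤-trans (ℕ.m≤n+m _ (Q N)) (ℕ.n≤1+n _))) q₀≤q
          q₂≤q : q₂ ℕ.≤ q
          q₂≤q = ℕ.≤-trans (ℕ.≤-trans (ℕ.m≤n+m q₂ q₁) (ℕ.≤-trans (ℕ.m≤n+m _ (Q N)) (ℕ.n≤1+n _))) q₀≤q
      in Sum.[ far p q q₁≤q q₂≤q
             , (λ (n , 2q<Q , Q≤q′ , Ld) → convergent-case p q Q≤q q₂≤q n 2q<Q Q≤q′ Ld)
             ]′ (distance-lower A θ xₙ→θ p q)
      where
      far : ∀ p q .{{_ : NonZero q}} → q₁ ℕ.≤ q → q₂ ℕ.≤ q →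
            let instance _ = ℕ.m*n≢0 8 (q ℕ.* q) {{_}} {{ℕ.m*n≢0 q q}} in
            L (distance θ p q) (1/ℕ (8 ℕ.* (q ℕ.* q))) → proj₁ (V′ (fromℕ≥1 q) ⁻¹) < distance θ p q
      far p q q₁≤q q₂≤q = ⁻¹-<-distance (V′ (fromℕ≥1 q)) (distance θ p q) (8 ℕ.* (q ℕ.* q))
        (L-down (at V′ q) 8q²<16q² (16V<V′ q q₂≤q q ℕ.≤-refl (fromℕ-pos (1 ℕ.* (q ℕ.* q))) (q²<V q q₁≤q)))
        where
        instance
          qq≢0 : NonZero (q ℕ.* q)
          qq≢0 = ℕ.m*n≢0 q q
          1qq≢0 : NonZero (1 ℕ.* (q ℕ.* q))
          1qq≢0 = ℕ.m*n≢0 1 (q ℕ.* q)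
          8qq≢0 : NonZero (8 ℕ.* (q ℕ.* q))
          8qq≢0 = ℕ.m*n≢0 8 (q ℕ.* q)
        8q²<16q² : fromℕ (8 ℕ.* (q ℕ.* q)) ℚ.< fromℕ 16 ℚ.* fromℕ (1 ℕ.* (q ℕ.* q))
        8q²<16q² = subst₂ ℚ._<_ (cong (λ z → fromℕ (8 ℕ.* z)) (ℕ.*-identityˡ (q ℕ.* q))) (fromℕ-* 16 (1 ℕ.* (q ℕ.* q)))
          (fromℕ-mono-< (ℕ.*-monoˡ-< (1 ℕ.* (q ℕ.* q)) (ℕ.m≤m+n 9 7)))
      convergent-case : ∀ p q .{{_ : NonZero q}} → Q N ℕ.≤ q → q₂ ℕ.≤ q →
            ∀ n → 2 ℕ.* q ℕ.< Q (suc n) → Q n ℕ.≤ q →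
            L (distance θ p q) (1/ℕ (8 ℕ.* k n)) → proj₁ (V′ (fromℕ≥1 q) ⁻¹) < distance θ p q
      convergent-case p q QN≤q q₂≤q n 2q<Q Q≤q =
        let s , Ls , k<2s = k<2V n N≤n
            0<s = *-cancelʳ-< {0ℚ} {s} {fromℕ 2} (fromℕ-pos 2)
              (subst₂ ℚ._<_ (sym (ℚ.*-zeroˡ (fromℕ 2))) (ℚ.*-comm (fromℕ 2) s)
              (ℚ.<-trans (fromℕ-pos (k n)) k<2s))
        in ⁻¹-<-distance (V′ (fromℕ≥1 q)) (distance θ p q) (8 ℕ.* k n)
             (L-down (at V′ q) (8k<16s s k<2s) (16V<V′ q q₂≤q (Q n) Q≤q 0<s Ls))
        where
        N≤n : N ℕ.≤ n
        N≤n = ℕ.≮⇒≥ λ n<N → ℕ.<-irrefl refl (begin-strict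
          q              ≤⟨ ℕ.m≤m+n q _ ⟩
          2 ℕ.* q        <⟨ 2q<Q ⟩
          Q (suc n)      ≤⟨ Q-mono n<N ⟩
          Q N            ≤⟨ QN≤q ⟩
          q              ∎)
          where open ℕ.≤-Reasoning
        8k<16s : ∀ s → fromℕ (k n) ℚ.< fromℕ 2 ℚ.* s → fromℕ (8 ℕ.* k n) ℚ.< fromℕ 16 ℚ.* s
        8k<16s s k<2s = subst₂ ℚ._<_ (sym (fromℕ-* 8 (k n)))
          (trans (sym (ℚ.*-assoc (fromℕ 8) (fromℕ 2) s)) (cong (ℚ._* s) (sym (fromℕ-* 8 2))))
          (*-monoʳ-< (fromℕ-pos 8) k<2s)

-- The growth condition in terms of cuts

module Growth (ω : ℝ≥1 → ℝ⁺) (b : ℕ → ℕ) (b≢0 : ∀ n → NonZero (b n)) (n : ℕ) where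

  Q K : ℕ
  Q = convergentDenominator (b , b≢0) n
  K = b n ℕ.* (Q ℕ.* Q)

  K≢0 : NonZero K
  K≢0 = ℕ.m*n≢0 (b n) (Q ℕ.* Q) {{b≢0 n}}

  -- `growth` keeps its non-zero proofs local; as `_·_` takes such a proof irrelevantly, `K≢0` can
  -- replace them.
  L-growth : L (growth ω (b , b≢0) n) ≡ L (_·_ K {{K≢0}} (proj₁ (ω (fromℕ≥1 Q))))
  L-growth = refl

  U-growth : U (growth ω (b , b≢0) n) ≡ U (_·_ K {{K≢0}} (proj₁ (ω (fromℕ≥1 Q))))
  U-growth = refl

module _ (V : ℝ≥1 → ℝ⁺) (b : ℕ → ℕ) (b≢0 : ∀ n → NonZero (b n)) (n : ℕ) where

  private
    g : ℝ
    g = growth (λ y → V y ⁻¹) (b , b≢0) n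
  open Growth (λ y → V y ⁻¹) b b≢0 n

  1<growth⇒V<k : 1ℝ < g → U (at V Q) (fromℕ K)
  1<growth⇒V<k (r , 1<r , Lr) = 1<k·X⁻¹⇒X<k K {{K≢0}} (V (fromℕ≥1 Q)) (r , 1<r , subst (λ P → P r) L-growth Lr)

  V<k⇒1<growth : U (at V Q) (fromℕ K) → 1ℝ < g
  V<k⇒1<growth V<k = let r , 1<r , Lr = X<k⇒1<k·X⁻¹ K {{K≢0}} (V (fromℕ≥1 Q)) V<k in
    r , 1<r , subst (λ P → P r) (sym L-growth) Lr

  U-growth⇒ : ∀ {r} → U g r → ∃[ s ] L (at V Q) s × fromℕ K ℚ.< r ℚ.* s
  U-growth⇒ {r} Ur = U-k·X⁻¹⁻¹ K {{K≢0}} (V (fromℕ≥1 Q)) {r} (subst (λ P → P r) U-growth Ur)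

  U-growth⇐ : ∀ {r s} → 0ℚ ℚ.< s → L (at V Q) s → fromℕ K ℚ.< r ℚ.* s → U g r
  U-growth⇐ {r} {s} 0<s Ls K<rs = subst (λ P → P r) (sym U-growth)
    (U-k·X⁻¹ K {{K≢0}} (V (fromℕ≥1 Q)) {r} {s} 0<s Ls K<rs)

module FromGrowth (V : ℝ≥1 → ℝ⁺) (b : ℕ → ℕ) (b≢0 : ∀ n → NonZero (b n)) (θ : ℝ)
  (θ≡[b] : θ IsContinuedFraction (b , b≢0)) (growing : GrowthCondition (λ y → V y ⁻¹) (b , b≢0)) where

  private
    A = Convergents.approximants (b , b≢0)
    Q = convergentDenominator (b , b≢0)
    g = growth (λ y → V y ⁻¹) (b , b≢0)
    k = ApproximantsProperties.k A

    K≡k : ∀ n → b n ℕ.* (Q n ℕ.* Q n) ≡ k n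
    K≡k n = refl

    V<k : ∀ n → U (at V (Q n)) (fromℕ (k n))
    V<k n = subst (λ K → U (at V (Q n)) (fromℕ K)) (K≡k n) (1<growth⇒V<k V b b≢0 n (proj₁ growing n))

    k<2V : ∃[ N ] ∀ n → N ℕ.≤ n → ∃[ s ] L (at V (Q n)) s × fromℕ (k n) ℚ.< fromℕ 2 ℚ.* s
    -- The limit 1 tested with ε = 1 bounds the growth by 2.
    k<2V = let N , close = proj₂ growing 1ℝ 0<1ℝ in N , λ n N≤n →
      let r , Ur , r<1 = close n N≤n in
      subst (λ K → ∃[ s ] L (at V (Q n)) s × fromℕ K ℚ.< fromℕ 2 ℚ.* s) (K≡k n)
        (U-growth⇒ V b b≢0 n {fromℕ 2}
          (U-up (g n) {1ℚ ℚ.+ r} {fromℕ 2} (ℚ.+-monoʳ-< 1ℚ r<1) (U-untranslate (g n) (proj₁ Ur))))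

  open Approximation A V θ θ≡[b] V<k k<2V public

-- A continued fraction with prescribed growth

module Base (β : ℝ) (1≤β : 1ℝ ≤ β) (1<β : 1ℝ < β) where

  superquadratic : Superquadratic (λ y → (β , 1≤β) ^ ≥1⇒⁺ y)
  superquadratic = superquadratic-exponential (β , 1≤β) 1<β

  module _ (b : ℕ → ℕ) (b≢0 : ∀ n → NonZero (b n)) (θ : ℝ) (θ≡[b] : θ IsContinuedFraction (b , b≢0))
    (growing : GrowthCondition (λ y → ((β , 1≤β) ^ ≥1⇒⁺ y) ⁻¹) (b , b≢0)) where
    open FromGrowth (λ y → (β , 1≤β) ^ ≥1⇒⁺ y) b b≢0 θ θ≡[b] growing

    bounded : BaseBound θ β
    bounded = 1≤β , λ ε → tailBound superquadratic (λ y → ((β , 1≤β) +¹ ε) ^ ≥1⇒⁺ y)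
      (dominates-exponential (β , 1≤β) ε)

    least : ∀ γ → BaseBound θ γ → β ≤ γ
    least γ (1≤γ , bound) γ<β =
       let ε , below = bounds-exponential (β , 1≤β) (γ , 1≤γ) γ<β in
       not-tailBound (λ y → ((γ , 1≤γ) +¹ ε) ^ ≥1⇒⁺ y) below (bound ε)

    conclusion : IrrationalityBase θ β × ApproximableToOrder (λ y → ((β , 1≤β) ^ ≥1⇒⁺ y) ⁻¹) θ
    conclusion = (bounded , least) , approximable

module Exponent (μ : ℝ) (0<μ : 0ℝ < μ) (2<μ : 2ℝ < μ) where

  superquadratic : Superquadratic (λ y → y ^ (μ , 0<μ))
  superquadratic = superquadratic-power (μ , 0<μ) 2<μ

  module _ (b : ℕ → ℕ) (b≢0 : ∀ n → NonZero (b n)) (θ : ℝ) (θ≡[b] : θ IsContinuedFraction (b , b≢0))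
    (growing : GrowthCondition (λ y → (y ^ (μ , 0<μ)) ⁻¹) (b , b≢0)) where
    open FromGrowth (λ y → y ^ (μ , 0<μ)) b b≢0 θ θ≡[b] growing

    tails : ∀ ε → TailBound (λ y → y ^ ((μ , 0<μ) +⁺ ε)) θ
    tails ε = tailBound superquadratic (λ y → y ^ ((μ , 0<μ) +⁺ ε)) (dominates-power (μ , 0<μ) ε)

    irrational : Irrational θ
    irrational = tailBound⇒irrational (λ y → y ^ ((μ , 0<μ) +⁺ (1ℝ , 0<1ℝ))) θ (tails (1ℝ , 0<1ℝ))

    least : ∀ ν → ExponentBound θ ν → μ ≤ ν
    least ν (0<ν , bound) ν<μ =
      let ε , below = bounds-power (μ , 0<μ) (ν , 0<ν) ν<μ in
      not-tailBound (λ y → y ^ ((ν , 0<ν) +⁺ ε)) below (bound ε)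

    conclusion : IrrationalityExponent θ μ × ApproximableToOrder (λ y → (y ^ (μ , 0<μ)) ⁻¹) θ
    conclusion = (irrational , (0<μ , tails) , least) , approximable

-- Choice of the partial quotients

module Construction (V : ℝ≥1 → ℝ⁺) (superquadratic : Superquadratic V) where

  steps : ∀ n .{{_ : NonZero n}} → ∃[ i ]
    L (at V n) (fromℕ (i ℕ.* (n ℕ.* n))) × U (at V n) (fromℕ ((2 ℕ.+ i) ℕ.* (n ℕ.* n)))
  steps n =
    let q , 0<q , Lq = proj₂ (V (fromℕ≥1 n))
        i , Li , Ui = grid (at V n) (fromℕ-pos (n ℕ.* n) {{ℕ.m*n≢0 n n}}) (L-down (at V n) 0<q Lq)
    in i , subst (L (at V n)) (multiple i) Li , subst (U (at V n)) (multiple (2 ℕ.+ i)) Ui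
    where
    multiple : ∀ i → 0ℚ ℚ.+ fromℕ i ℚ.* fromℕ (n ℕ.* n) ≡ fromℕ (i ℕ.* (n ℕ.* n))
    multiple i = trans (ℚ.+-identityˡ (fromℕ i ℚ.* fromℕ (n ℕ.* n))) (sym (fromℕ-* i (n ℕ.* n)))

  -- The value at 0 is a default that is never reached; it makes `next` total, so that `state` can
  -- be defined before its denominators are known to be positive.
  next : ℕ → ℕ
  next zero    = 1
  next (suc n) = 2 ℕ.+ proj₁ (steps (suc n))

  next≢0 : ∀ n → NonZero (next n)
  next≢0 zero    = _
  next≢0 (suc n) = _

  V<next : ∀ n .{{_ : NonZero n}} → U (at V n) (fromℕ (next n ℕ.* (n ℕ.* n)))
  V<next (suc n) = proj₂ (proj₂ (steps (suc n)))

  -- Since i n² < V(n), the ratio of (2 + i) n² to V(n) is below 1 + 2 / i, and superquadratic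
  -- growth pushes i beyond any T with T e ≥ 2.
  next-asymptotic : ∀ {e} → 0ℚ ℚ.< e → Eventually λ n →
    ∃[ s ] 0ℚ ℚ.< s × L (at V n) s × fromℕ (next n ℕ.* (n ℕ.* n)) ℚ.< (1ℚ ℚ.+ e) ℚ.* s
  next-asymptotic {e} 0<e =
    let T , 2≤Te = archimedean (fromℕ 2) 0<e
        -- The extra 2 compensates for V(n) < (2 + i) n², so that T < i results.
        n₀ , large = superquadratic (2 ℕ.+ T)
    in n₀ , λ where n@(suc n-1) n₀≤n → estimate T 2≤Te n (steps n) (large n n₀≤n)
    where
    estimate : ∀ T → fromℕ 2 ℚ.≤ fromℕ T ℚ.* e → ∀ n .{{_ : NonZero n}} →
      ((i , _) : ∃[ i ] L (at V n) (fromℕ (i ℕ.* (n ℕ.* n))) × U (at V n) (fromℕ ((2 ℕ.+ i) ℕ.* (n ℕ.* n)))) →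
      L (at V n) (fromℕ ((2 ℕ.+ T) ℕ.* (n ℕ.* n))) →
      ∃[ s ] 0ℚ ℚ.< s × L (at V n) s × fromℕ ((2 ℕ.+ i) ℕ.* (n ℕ.* n)) ℚ.< (1ℚ ℚ.+ e) ℚ.* s
    estimate T 2≤Te n (i , Li , Ui) large = s , fromℕ-pos (i ℕ.* n²) , Li , (begin-strict
      fromℕ ((2 ℕ.+ i) ℕ.* n²)                 ≡⟨ fromℕ-* (2 ℕ.+ i) n² ⟩
      fromℕ (2 ℕ.+ i) ℚ.* N                    ≡⟨ cong (ℚ._* N) (fromℕ-+ 2 i) ⟩
      (fromℕ 2 ℚ.+ fromℕ i) ℚ.* N              <⟨ *-monoˡ-< 0<N (ℚ.+-monoˡ-< (fromℕ i) 2<ie) ⟩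
      (fromℕ i ℚ.* e ℚ.+ fromℕ i) ℚ.* N        ≡⟨ regroup (fromℕ i) e N ⟩
      (1ℚ ℚ.+ e) ℚ.* (fromℕ i ℚ.* N)           ≡⟨ cong ((1ℚ ℚ.+ e) ℚ.*_) (fromℕ-* i n²) ⟨
      (1ℚ ℚ.+ e) ℚ.* s                         ∎)
      where
      open ℚ.≤-Reasoning
      n² = n ℕ.* n
      N = fromℕ n²
      s = fromℕ (i ℕ.* n²)
      instance
        n²≢0 : NonZero n²
        n²≢0 = ℕ.m*n≢0 n n
      T<i : T ℕ.< i
      T<i = ℕ.+-cancelˡ-< 2 T i (ℕ.*-cancelʳ-< n² (2 ℕ.+ T) (2 ℕ.+ i) (fromℕ-cancel-< (L<U (at V n) large Ui)))
      instance
        i≢0 : NonZero i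
        i≢0 = ℕ.>-nonZero (ℕ.≤-<-trans ℕ.z≤n T<i)
        in²≢0 : NonZero (i ℕ.* n²)
        in²≢0 = ℕ.m*n≢0 i n²
      0<N : 0ℚ ℚ.< N
      0<N = fromℕ-pos n²
      2<ie : fromℕ 2 ℚ.< fromℕ i ℚ.* e
      2<ie = ℚ.≤-<-trans 2≤Te (*-monoˡ-< 0<e (fromℕ-mono-< T<i))
      regroup : ∀ i e N → (i ℚ.* e ℚ.+ i) ℚ.* N ≡ (1ℚ ℚ.+ e) ℚ.* (i ℚ.* N)
      regroup = let open ℕCoefficients in
        solve 3 (λ i e N → (i :* e :+ i) :* N := (con 1 :+ e) :* (i :* N)) refl

  -- The quotient of index n is computed from qₙ, which itself depends on the earlier quotients.
  -- Running the recurrence on pairs (qₙ, qₙ₋₁), started at (1, 0), breaks the circle; `state≡Q`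
  -- then identifies it with the true denominators.
  state : ℕ → ℕ × ℕ
  state zero    = 1 , 0
  state (suc n) = let q , q′ = state n in next q ℕ.* q ℕ.+ q′ , q

  b : ℕ → ℕ
  b n = next (proj₁ (state n))

  b≢0 : ∀ n → NonZero (b n)
  b≢0 n = next≢0 (proj₁ (state n))

  Q : ℕ → ℕ
  Q = convergentDenominator (b , b≢0)

  A : Approximants b (convergent (b , b≢0)) Q
  A = Convergents.approximants (b , b≢0)

  state≡Q : ∀ n → state n ≡ (Q n , previous Q 0 n)
  state≡Q zero    = refl
  state≡Q (suc n) = cong₂ _,_ (trans (cong (λ (q , q′) → b n ℕ.* q ℕ.+ q′) (state≡Q n)) (sym (Approximants.Q-suc A n)))
                              (cong proj₁ (state≡Q n))

  b≡next : ∀ n → next (Q n) ≡ b n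
  b≡next n = cong (λ s → next (proj₁ s)) (sym (state≡Q n))

  growing : GrowthCondition (λ y → V y ⁻¹) (b , b≢0)
  growing = 1<g , g→1
    where
    g : ℕ → ℝ
    g = growth (λ y → V y ⁻¹) (b , b≢0)
    1<g : ∀ n → 1ℝ < g n
    1<g n = V<k⇒1<growth V b b≢0 n
      (subst (λ c → U (at V (Q n)) (fromℕ (c ℕ.* (Q n ℕ.* Q n)))) (b≡next n) (V<next (Q n)))
    g→1 : Converges g 1ℝ
    g→1 ε (e , 0<e , Le) =
      let n₀ , asymptotic = next-asymptotic 0<e in n₀ , λ n n₀≤n →
      let s , 0<s , Ls , lt = asymptotic (Q n) (ℕ.≤-trans n₀≤n (ApproximantsProperties.n≤Q A n))
          r , 1<r , Lr = 1<g n
      in e , U-distance (g n)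
           (L-down (g n) (ℚ.<-trans (subst (1ℚ ℚ.- e ℚ.<_) (p-q+q≡p 1ℚ e) (p<p+q (1ℚ ℚ.- e) 0<e)) 1<r) Lr)
           (U-growth⇐ V b b≢0 n {1ℚ ℚ.+ e} 0<s Ls
             (subst (λ c → fromℕ (c ℕ.* (Q n ℕ.* Q n)) ℚ.< (1ℚ ℚ.+ e) ℚ.* s) (b≡next n) lt)) ,
         Le

  θ : ℝ
  θ = limit A

  θ-isContinuedFraction : θ IsContinuedFraction (b , b≢0)
  θ-isContinuedFraction = converges-limit A

-- Existence is the criterion applied to the constructed continued fraction. The separate ω lets the
-- result be stated with `exponentialOrder` or `powerOrder`, each of which is 1 / V by definition.
witness-and-criterion : (V : ℝ≥1 → ℝ⁺) → Superquadratic V → (P : ℝ → Set₁) →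
  (∀ b b≢0 θ → θ IsContinuedFraction (b , b≢0) → GrowthCondition (λ y → V y ⁻¹) (b , b≢0) →
    P θ × ApproximableToOrder (λ y → V y ⁻¹) θ) →
  ∀ ω → ω ≡ (λ y → V y ⁻¹) →
  (∃ λ θ → P θ × ApproximableToOrder ω θ)
  × ((b : PartialQuotients) (θ : ℝ) → θ IsContinuedFraction b →
      GrowthCondition ω b → P θ × ApproximableToOrder ω θ)
witness-and-criterion V superquadratic P conclusion _ refl =
  (θ , conclusion b b≢0 θ θ-isContinuedFraction growing) ,
  λ (b , b≢0) → conclusion b b≢0
  where open Construction V superquadratic

corollary4 : ((β : ℝ) (1<β : 1ℝ < β) →
    (∃ λ θ → IrrationalityBase θ β × ApproximableToOrder (exponentialOrder β 1<β) θ)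
    × ((b : PartialQuotients) (θ : ℝ) → θ IsContinuedFraction b →
    GrowthCondition (exponentialOrder β 1<β) b →
    IrrationalityBase θ β × ApproximableToOrder (exponentialOrder β 1<β) θ))
    × ((μ : ℝ) (2<μ : 2ℝ < μ) →
    let 0<μ = <-trans {0ℝ} {2ℝ} {μ} 0<2ℝ 2<μ in
    (∃ λ θ → IrrationalityExponent θ μ × ApproximableToOrder (powerOrder μ 0<μ) θ)
    × ((b : PartialQuotients) (θ : ℝ) → θ IsContinuedFraction b →
    GrowthCondition (powerOrder μ 0<μ) b →
    IrrationalityExponent θ μ × ApproximableToOrder (powerOrder μ 0<μ) θ))
corollary4 =
  (λ β 1<β → let 1≤β = <⇒≤ {1ℝ} {β} 1<β in
    witness-and-criterion (λ y → (β , 1≤β) ^ ≥1⇒⁺ y) (superquadratic-exponential (β , 1≤β) 1<β)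
      (λ θ → IrrationalityBase θ β) (Base.conclusion β 1≤β 1<β) (exponentialOrder β 1<β) refl) ,
  (λ μ 2<μ → let 0<μ = <-trans {0ℝ} {2ℝ} {μ} 0<2ℝ 2<μ in
    witness-and-criterion (λ y → y ^ (μ , 0<μ)) (superquadratic-power (μ , 0<μ) 2<μ)
      (λ θ → IrrationalityExponent θ μ) (Exponent.conclusion μ 0<μ 2<μ) (powerOrder μ 0<μ) refl)
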